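{- For every fixed $r\ge 3$, the number of $r$-uniform hypergraphs on $n$ labeled vertices with girth greater than $5$ is $2^{o(n^{3/2})}$ as $n\to\infty$.
   Context: A (Berge) cycle of length $k\ge 2$ in a hypergraph is an alternating sequence $v_1,e_1,\dots,v_k,e_k$ of distinct vertices and distinct edges with $v_i,v_{i+1}\in e_i$ for each $i$ (indices mod $k$). The girth is the length of the shortest cycle. -}

module Defs where

open import Data.Nat using (ℕ; zero; suc; _≤_; _^_; _*_)
open import Data.Nat.DivMod using (_mod_)
open import Data.Fin using (Fin; toℕ)
open import Data.Fin.Subset using (Subset; _∈_; ∣_∣)
open import Data.Bool using (Bool; true)
open import Data.Product using (Σ; ∃; _×_; _,_)
open import Data.List using (List; length)
open import Data.List.Relation.Unary.All using (All)
open import Data.List.Relation.Unary.AllPairs using (AllPairs)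
open import Function.Definitions using (Injective)
open import Relation.Nullary using (¬_)
open import Relation.Binary.PropositionalEquality using (_≡_; _≢_)

Hypergraph : ℕ → Set
Hypergraph n = Subset n → Bool

IsEdge : ∀ {n} → Hypergraph n → Subset n → Set
IsEdge H e = H e ≡ true

Uniform : ∀ {n} → ℕ → Hypergraph n → Set
Uniform r H = ∀ e → IsEdge H e → ∣ e ∣ ≡ r

next : ∀ {m} → Fin (suc m) → Fin (suc m)
next {m} i = suc (toℕ i) mod suc m

record BergeCycle {n : ℕ} (H : Hypergraph n) (m : ℕ) : Set where
  field
    vtx      : Fin (suc m) → Fin n
    edg      : Fin (suc m) → Subset n
    vtx-inj  : Injective _≡_ _≡_ vtx
    edg-inj  : Injective _≡_ _≡_ edg
    edg-edge : ∀ i → IsEdge H (edg i)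
    vtx-in   : ∀ i → vtx i ∈ edg i
    nxt-in   : ∀ i → vtx (next i) ∈ edg i

-- girth > g : no cycle of any length k = suc m with 2 ≤ k ≤ g
-- (an acyclic hypergraph has girth ∞ > g).
GirthGreaterThan : ∀ {n} → ℕ → Hypergraph n → Set
GirthGreaterThan g H = ∀ m → 2 ≤ suc m → suc m ≤ g → ¬ BergeCycle H m

Differ : ∀ {n} → Hypergraph n → Hypergraph n → Set
Differ H H' = ∃ λ e → H e ≢ H' e

Good : ∀ {n} → ℕ → Hypergraph n → Set
Good r H = Uniform r H × GirthGreaterThan 5 H

{-# OPTIONS --safe #-}

-- Extremal part. List three vertices (x , y , z) of each hyperedge. For a vertex u let S u, S' u be the second
-- neighbourhoods of u through the first part, on the y-side and on the z-side. Without 5-cycles almost no pair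
-- (y , z) lies in S u × S' u. Greedily choose boundedly many u whose rectangles S u × S' u exhaust all rectangles
-- up to small measure; the pairs (y , z) live on the complement, a union of boundedly many classes. If there are
-- ≥ c n^{3/2} triples, then Cauchy–Schwarz gives ≥ c² n² incidences of a triple (x , y , z) with a second pair
-- (x , u), and in most of them S u and S' u fill a constant fraction of the classes of y and z. Hence for most u
-- only a small part of the live region consists of such classes. Since a C₄-free graph has few edges in a
-- region of small measure made of few classes (applied once to the pairs (y , z) and once to the pairs (x , u)),
-- the incidences are fewer than c² n², so there are o(n^{3/2}) triples.
--
-- Counting part. The hypergraph is determined by the r² graphs formed by the pairs of vertices of given ranks in
-- a hyperedge; these are C₄-free and have o(n^{3/2}) edges. The Kleitman–Winston argument, with weights that
-- charge O(1) bits per edge and o(√n) bits per vertex, bounds the number of such graphs by 2^{o(n^{3/2})}.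
-- Throughout, s denotes the integer part of √n.
module Submission where

open import Defs
open import Data.Bool using (Bool; true; false; _∧_; not)
import Data.Bool.Properties as Bool
open import Data.Empty using (⊥-elim)
open import Data.Fin using (Fin; zero; suc; combine; remQuot; toℕ; fromℕ<)
open import Data.Fin.Properties as F using (any?; combine-injective)
open import Data.Fin.Subset using (Subset; ∣_∣)
open import Data.Fin.Subset.Properties using (anySubset?; p⊂q⇒∣p∣<∣q∣)
open import Data.List using (List; []; _∷_; length; map; allFin; _++_; deduplicate)
import Data.List.Membership.Propositional as List
open import Data.List.Membership.Propositional.Properties using (∈-allFin; ∈-map⁺; ∈-deduplicate⁺)
open import Data.List.Properties using (length-map; length-++; length-tabulate)
open import Data.List.Relation.Unary.All as All using (All; []; _∷_)
import Data.List.Relation.Unary.All.Properties as All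
open import Data.List.Relation.Unary.AllPairs using (AllPairs; []; _∷_)
open import Data.List.Relation.Unary.Any using (here; there)
import Data.List.Relation.Unary.Unique.DecPropositional.Properties as DecUnique
open import Data.List.Relation.Unary.Unique.Propositional using (Unique)
open import Data.Nat
open import Data.Nat.DivMod using (_/_; m/n*n≤m; m≡m%n+[m/n]*n; m%n<n)
open import Data.Nat.Properties
open import Data.Nat.Tactic.RingSolver using (solve-∀)
open import Data.Product using (∃; _×_; _,_; proj₁; proj₂)
import Data.Product.Properties as Prod
open import Data.Sum using (_⊎_; inj₁; inj₂)
open import Data.Vec using (Vec; []; _∷_; lookup; tabulate)
import Data.Vec.Properties as Vec
open import Data.Vec.Relation.Unary.All using ([]; _∷_)
open import Data.Vec.Relation.Unary.AllPairs using ([]; _∷_)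
import Data.Vec.Relation.Unary.Unique.Propositional as VUnique
open import Data.Vec.Relation.Unary.Unique.Propositional.Properties using (lookup-injective)
open import Relation.Binary.Definitions using (DecidableEquality)
open import Relation.Binary.PropositionalEquality hiding (J)
open import Relation.Nullary using (¬_; Dec; yes; no; does; contradiction)
open import Relation.Nullary.Decidable using (_×-dec_; _⊎-dec_; ¬?; map′)
import Algebra.Properties.Semiring.Sum +-*-semiring as Sum

-- Four-cycles alone cannot give the extremal bound: a `C₄`-free graph may have of order `n^{3/2}`
-- edges, so the gain has to come from five-cycles. If `y ∈ S u` and `z ∈ S' u`, a triple
-- `(x , y , z)` closes a walk of length five through `u`. The walk must collapse, which joins `x`
-- to `u`, and this can happen only once for each `y`; so a rectangle holds at most `n` triples.
--
-- Kővári-Sós-Turán profits from small measure only on a union of few classes, because each class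
-- costs `O(n)` edges. This is why the exhaustion must stop after boundedly many `u`, and why the
-- pairs `(x , u)` are grouped by the list of classes that are thin for `u`.
--
-- The extremal bound comes without a rate, so listing the edges at `log n` bits each would be too
-- expensive for the count. A container for a neighbourhood of size `d` has size `O(n / d)`; the
-- resulting factor of order `(n / d²)^d` is split into boundedly many bits per edge and a small
-- multiple of `√n` per vertex.

private variable
  n m : ℕ

-- Indicators and finite sums

𝟙 : Bool → ℕ
𝟙 true  = 1
𝟙 false = 0

𝟙≤1 : ∀ b → 𝟙 b ≤ 1
𝟙≤1 true  = ≤-refl
𝟙≤1 false = z≤n

𝟙-true : ∀ {b} → 1 ≤ 𝟙 b → b ≡ true
𝟙-true {true} _ = refl

𝟙-∧ : ∀ a b → 𝟙 (a ∧ b) ≡ 𝟙 a * 𝟙 b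
𝟙-∧ true  b = sym (+-identityʳ (𝟙 b))
𝟙-∧ false b = refl

𝟙-not : ∀ b → 𝟙 b + 𝟙 (not b) ≡ 1
𝟙-not true  = refl
𝟙-not false = refl

δ : Fin n → Fin n → ℕ
δ i j = 𝟙 (does (i F.≟ j))

-- Opaque, so that the unifier can read off the summand.
opaque
  sum : (Fin n → ℕ) → ℕ
  sum = Sum.sum

  sum-empty : (f : Fin 0 → ℕ) → sum f ≡ 0
  sum-empty f = refl

  sum-suc : (f : Fin (suc n) → ℕ) → sum f ≡ f zero + sum (λ i → f (suc i))
  sum-suc f = refl

  sum-mono : {f g : Fin n → ℕ} → (∀ i → f i ≤ g i) → sum f ≤ sum g
  sum-mono {zero}  h = z≤n
  sum-mono {suc n} h = +-mono-≤ (h zero) (sum-mono (λ i → h (suc i)))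

  sum-cong : {f g : Fin n → ℕ} → (∀ i → f i ≡ g i) → sum f ≡ sum g
  sum-cong {n} h = Sum.sum-cong-≗ {n} h

  sum-distrib-+ : (f g : Fin n → ℕ) → sum (λ i → f i + g i) ≡ sum f + sum g
  sum-distrib-+ = Sum.∑-distrib-+

  sum-comm : (f : Fin m → Fin n → ℕ) → sum (λ i → sum (λ j → f i j)) ≡ sum (λ j → sum (λ i → f i j))
  sum-comm {m} {n} = Sum.∑-comm {m} {n}

  *-distribˡ-sum : ∀ c (f : Fin n → ℕ) → c * sum f ≡ sum (λ i → c * f i)
  *-distribˡ-sum {n} = Sum.*-distribˡ-sum {n}

  *-distribʳ-sum : ∀ c (f : Fin n → ℕ) → sum f * c ≡ sum (λ i → f i * c)
  *-distribʳ-sum {n} = Sum.*-distribʳ-sum {n}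

  sum-const : ∀ n c → sum {n} (λ _ → c) ≡ n * c
  sum-const zero    c = refl
  sum-const (suc n) c = cong (c +_) (sum-const n c)

sum-zero : {f : Fin n → ℕ} → (∀ i → f i ≡ 0) → sum f ≡ 0
sum-zero {n} h = trans (sum-cong h) (trans (sum-const n 0) (*-zeroʳ n))

sum-≤-const : {f : Fin n → ℕ} {c : ℕ} → (∀ i → f i ≤ c) → sum f ≤ n * c
sum-≤-const {n} {c = c} h = ≤-trans (sum-mono h) (≤-reflexive (sum-const n c))

opaque
  unfolding sum
  term≤sum : (f : Fin n → ℕ) (i : Fin n) → f i ≤ sum f
  term≤sum f zero    = m≤m+n _ _
  term≤sum f (suc i) = ≤-trans (term≤sum (λ j → f (suc j)) i) (m≤n+m _ (f zero))

  sum-pos : (f : Fin n → ℕ) → 1 ≤ sum f → ∃ λ i → 1 ≤ f i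
  sum-pos {suc n} f h with f zero in eq
  ... | suc k = zero , subst (1 ≤_) (sym eq) (s≤s z≤n)
  ... | zero  with sum-pos (λ i → f (suc i)) h
  ...   | i , p = suc i , p

*-pos : ∀ a b → 1 ≤ a * b → 1 ≤ a × 1 ≤ b
*-pos (suc a) (suc b) _ = s≤s z≤n , s≤s z≤n
*-pos (suc a) zero    h = contradiction (subst (1 ≤_) (*-zeroʳ a) h) (λ ())

≤-from-pos : ∀ {a b} → (1 ≤ a → a ≤ b) → a ≤ b
≤-from-pos {zero}  h = z≤n
≤-from-pos {suc a} h = h (s≤s z≤n)

≤1-from-pos : ∀ {a b} → a ≤ 1 → (1 ≤ a → 1 ≤ b) → a ≤ b
≤1-from-pos a≤1 h = ≤-from-pos (λ p → ≤-trans a≤1 (h p))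

opaque
  unfolding sum
  sum-≤1 : (f : Fin n → ℕ) → (∀ i → f i ≤ 1) → (∀ i j → 1 ≤ f i → 1 ≤ f j → i ≡ j) → sum f ≤ 1
  sum-≤1 {zero}  f f≤1 uniq = z≤n
  sum-≤1 {suc n} f f≤1 uniq with f zero in eq
  ... | zero  = sum-≤1 _ (λ i → f≤1 (suc i)) (λ i j p q → F.suc-injective (uniq _ _ p q))
  ... | suc k = ≤-trans (≤-reflexive (trans (cong (suc k +_) (sum-zero rest)) (+-identityʳ _)))
                        (subst (_≤ 1) eq (f≤1 zero))
    where
    rest : ∀ i → f (suc i) ≡ 0
    rest i with f (suc i) in eq'
    ... | zero  = refl
    ... | suc _ with uniq zero (suc i) (subst (1 ≤_) (sym eq) (s≤s z≤n)) (subst (1 ≤_) (sym eq') (s≤s z≤n))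
    ...   | ()

opaque
  unfolding sum
  sum-δ : (i : Fin n) (f : Fin n → ℕ) → sum (λ j → δ i j * f j) ≡ f i
  sum-δ {suc n} zero f = trans (cong₂ _+_ (*-identityˡ (f zero)) (sum-zero {n} (λ _ → refl))) (+-identityʳ _)
  sum-δ {suc n} (suc i) f = trans (sum-cong (λ j → cong (_* f (suc j)) (step j))) (sum-δ i (λ j → f (suc j)))
    where
    step : ∀ j → δ (suc i) (suc j) ≡ δ i j
    step j with i F.≟ j
    ... | yes _ = refl
    ... | no _  = refl

sum-fibres : (cl : Fin n → Fin m) (f : Fin n → ℕ) → sum f ≡ sum (λ j → sum (λ y → δ (cl y) j * f y))
sum-fibres cl f = trans (sum-cong (λ y → sym (sum-δ (cl y) (λ _ → f y))))
                        (sum-comm (λ y j → δ (cl y) j * f y))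

-- Cauchy-Schwarz and sums of squares

2ab≤a²+b² : ∀ a b → 2 * (a * b) ≤ a * a + b * b
2ab≤a²+b² a b with ≤-total a b
... | inj₁ a≤b with m≤n⇒∃[o]m+o≡n a≤b
...   | k , refl = subst (2 * (a * (a + k)) ≤_) (id a k) (m≤m+n _ (k * k))
  where
  id : ∀ a k → 2 * (a * (a + k)) + k * k ≡ a * a + (a + k) * (a + k)
  id = solve-∀
2ab≤a²+b² a b | inj₂ b≤a with m≤n⇒∃[o]m+o≡n b≤a
...   | k , refl = subst (2 * ((b + k) * b) ≤_) (id b k) (m≤m+n _ (k * k))
  where
  id : ∀ b k → 2 * ((b + k) * b) + k * k ≡ (b + k) * (b + k) + b * b
  id = solve-∀

sum-cauchy-schwarz : (f : Fin n → ℕ) → sum f * sum f ≤ n * sum (λ i → f i * f i)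
sum-cauchy-schwarz {zero}  f rewrite sum-empty f = z≤n
sum-cauchy-schwarz {suc n} f rewrite sum-suc f | sum-suc (λ i → f i * f i) = begin
  (a + S) * (a + S)              ≡⟨ expand a S ⟩
  a * a + 2 * (a * S) + S * S    ≤⟨ +-mono-≤ (+-monoʳ-≤ (a * a) cross) (sum-cauchy-schwarz (λ i → f (suc i))) ⟩
  a * a + (n * (a * a) + Q) + n * Q ≡⟨ collect n a Q ⟩
  suc n * (a * a + Q) ∎
  where
  open ≤-Reasoning
  a = f zero
  S = sum (λ i → f (suc i))
  Q = sum (λ i → f (suc i) * f (suc i))
  expand : ∀ a S → (a + S) * (a + S) ≡ a * a + 2 * (a * S) + S * S
  expand = solve-∀
  collect : ∀ n a Q → a * a + (n * (a * a) + Q) + n * Q ≡ (1 + n) * (a * a + Q)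
  collect = solve-∀
  cross : 2 * (a * S) ≤ n * (a * a) + Q
  cross = begin
    2 * (a * S)                                    ≡⟨ cong (2 *_) (*-distribˡ-sum a _) ⟩
    2 * sum (λ i → a * f (suc i))                  ≡⟨ *-distribˡ-sum 2 (λ i → a * f (suc i)) ⟩
    sum (λ i → 2 * (a * f (suc i)))                ≤⟨ sum-mono (λ i → 2ab≤a²+b² a (f (suc i))) ⟩
    sum (λ i → a * a + f (suc i) * f (suc i))      ≡⟨ sum-distrib-+ (λ _ → a * a) (λ i → f (suc i) * f (suc i)) ⟩
    sum (λ (_ : Fin n) → a * a) + Q                ≡⟨ cong (_+ Q) (sum-const n (a * a)) ⟩
    n * (a * a) + Q ∎

-- Double counting of pairs `y , y'` with a common `z`; codegree hypotheses apply to the right-hand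
-- side.
sum-of-squares : (f : Fin n → Fin m → ℕ) →
  sum (λ z → sum (λ y → f y z) * sum (λ y → f y z)) ≡ sum (λ y → sum (λ y' → sum (λ z → f y z * f y' z)))
sum-of-squares {n} {m} f = begin
  sum (λ z → sum (λ y → f y z) * sum (λ y → f y z))
    ≡⟨ sum-cong (λ z → *-distribʳ-sum (sum (λ y → f y z)) (λ y → f y z)) ⟩
  sum (λ z → sum (λ y → f y z * sum (λ y' → f y' z)))
    ≡⟨ sum-comm {m} {n} _ ⟩
  sum (λ y → sum (λ z → f y z * sum (λ y' → f y' z)))
    ≡⟨ sum-cong (λ y → sum-cong (λ z → *-distribˡ-sum (f y z) (λ y' → f y' z))) ⟩
  sum (λ y → sum (λ z → sum (λ y' → f y z * f y' z)))
    ≡⟨ sum-cong (λ y → sum-comm {m} {n} _) ⟩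
  sum (λ y → sum (λ y' → sum (λ z → f y z * f y' z))) ∎
  where open ≡-Reasoning

-- Partitions into classes

bit : Bool → Fin 2
bit true  = suc zero
bit false = zero

bit-injective : ∀ {a b} → bit a ≡ bit b → a ≡ b
bit-injective {true}  {true}  _ = refl
bit-injective {false} {false} _ = refl

-- The atoms of the Boolean algebra generated by `fs`, numbered in binary, so that the type shows
-- how many classes there are.
classify : (fs : List (Fin n → Bool)) → Fin n → Fin (2 ^ length fs)
classify []       y = zero
classify (f ∷ fs) y = combine {2} (bit (f y)) (classify fs y)

classify-sound : (fs : List (Fin n → Bool)) {y y' : Fin n} → classify fs y ≡ classify fs y' →
                 All (λ f → f y ≡ f y') fs
classify-sound []       eq = []
classify-sound (f ∷ fs) {y} {y'} eq
  with combine-injective {2} (bit (f y)) (classify fs y) (bit (f y')) (classify fs y') eq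
... | p , q = bit-injective p ∷ classify-sound fs q

-- g takes the junk value 0 at empty classes.
class-function : (cl : Fin n → Fin m) (f : Fin n → ℕ) → (∀ {y y'} → cl y ≡ cl y' → f y ≡ f y') →
  ∃ λ (g : Fin m → ℕ) → (∀ y → f y ≡ g (cl y)) × (∀ j → 1 ≤ g j → ∃ λ y → cl y ≡ j)
class-function cl f inv = (λ j → g (any? (λ y → cl y F.≟ j))) , (λ y → spec y (any? _)) , (λ j → hit j (any? _))
  where
  g : ∀ {j} → Dec (∃ λ y → cl y ≡ j) → ℕ
  g (yes (y , _)) = f y
  g (no _)        = 0
  spec : ∀ y → (d : Dec (∃ λ y' → cl y' ≡ cl y)) → f y ≡ g d
  spec y (yes (y' , eq)) = inv (sym eq)
  spec y (no ¬p)         = contradiction (y , refl) ¬p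
  hit : ∀ j → (d : Dec (∃ λ y → cl y ≡ j)) → 1 ≤ g d → ∃ λ y → cl y ≡ j
  hit j (yes p) _ = p

-- Kővári-Sós-Turán on a union of classes

δ≤1 : (i j : Fin n) → δ i j ≤ 1
δ≤1 i j = 𝟙≤1 _

sum-δʳ : (i : Fin n) (f : Fin n → ℕ) → sum (λ j → δ i j * f i) ≡ f i
sum-δʳ i f = sum-δ i (λ _ → f i)

*-sum-sum : (f : Fin n → ℕ) (g : Fin m → ℕ) → sum f * sum g ≡ sum (λ y → sum (λ z → f y * g z))
*-sum-sum f g = trans (*-distribʳ-sum (sum g) f) (sum-cong (λ y → *-distribˡ-sum (f y) g))

-- The diagonal pairs contribute the edges themselves, as `f ≤ 1`; the others are bounded by
-- `codeg`. The weight `β` confines the main term to the vertices of one class.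
sum-squares-≤ : (f : Fin n → Fin m → ℕ) (β : Fin n → ℕ) → (∀ y z → f y z ≤ 1) →
  (∀ y y' → y ≢ y' → sum (λ z → f y z * f y' z) ≤ β y * β y') →
  sum (λ z → sum (λ y → f y z) * sum (λ y → f y z)) ≤ sum β * sum β + sum (λ z → sum (λ y → f y z))
sum-squares-≤ f β f≤1 codeg = begin
  sum (λ z → sum (λ y → f y z) * sum (λ y → f y z))
    ≡⟨ sum-of-squares f ⟩
  sum (λ y → sum (λ y' → sum (λ z → f y z * f y' z)))
    ≤⟨ sum-mono (λ y → sum-mono (λ y' → term y y')) ⟩
  sum (λ y → sum (λ y' → β y * β y' + δ y y' * sum (λ z → f y z)))
    ≡⟨ sum-cong (λ y → sum-distrib-+ (λ y' → β y * β y') (λ y' → δ y y' * sum (λ z → f y z))) ⟩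
  sum (λ y → sum (λ y' → β y * β y') + sum (λ y' → δ y y' * sum (λ z → f y z)))
    ≡⟨ sum-cong (λ y → cong (sum (λ y' → β y * β y') +_) (sum-δʳ y (λ y → sum (λ z → f y z)))) ⟩
  sum (λ y → sum (λ y' → β y * β y') + sum (λ z → f y z))
    ≡⟨ sum-distrib-+ (λ y → sum (λ y' → β y * β y')) (λ y → sum (λ z → f y z)) ⟩
  sum (λ y → sum (λ y' → β y * β y')) + sum (λ y → sum (λ z → f y z))
    ≡⟨ cong₂ _+_ (sym (*-sum-sum β β)) (sum-comm f) ⟩
  sum β * sum β + sum (λ z → sum (λ y → f y z)) ∎
  where
  open ≤-Reasoning
  term : ∀ y y' → sum (λ z → f y z * f y' z) ≤ β y * β y' + δ y y' * sum (λ z → f y z)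
  term y y' with y F.≟ y'
  ... | yes refl = begin
    sum (λ z → f y z * f y z)             ≤⟨ sum-mono (λ z → *-monoʳ-≤ (f y z) (f≤1 y z)) ⟩
    sum (λ z → f y z * 1)                 ≡⟨ sum-cong (λ z → *-identityʳ (f y z)) ⟩
    sum (λ z → f y z)                     ≡⟨ sym (*-identityˡ _) ⟩
    1 * sum (λ z → f y z)                 ≤⟨ m≤n+m _ (β y * β y) ⟩
    β y * β y + 1 * sum (λ z → f y z)     ∎
  ... | no ne    = ≤-trans (codeg y y' ne) (m≤m+n _ _)

private
  -- Kővári–Sós–Turán for one class. AM-GM is used with ratio s d : L b, so that L can be chosen
  -- independently of the size b of the class.
  kst-class : (s L : ℕ) → 1 ≤ L → s * s ≤ m →
    (f : Fin n → Fin m → ℕ) (β : Fin n → ℕ) (D : Fin m → ℕ) →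
    (∀ y z → f y z ≤ β y * D z) → (∀ y → β y ≤ 1) → (∀ z → D z ≤ 1) →
    (∀ y y' → y ≢ y' → sum (λ z → f y z * f y' z) ≤ 1) →
    L * s * sum (λ z → sum (λ y → f y z)) ≤
      s * s * sum β + L * L * (sum β * sum D) + L * s * (2 * m)
  kst-class {m} {n} s L 1≤L s²≤m f β D f≤ β≤1 D≤1 codeg = by-size (≤-total b s)
    where
    open ≤-Reasoning
    b  = sum β
    d : Fin m → ℕ
    d z = sum (λ y → f y z)
    E  = sum d
    Σd² = sum (λ z → d z * d z)
    f≤1 : ∀ y z → f y z ≤ 1
    f≤1 y z = ≤-trans (f≤ y z) (*-mono-≤ (β≤1 y) (D≤1 z))
    -- A common neighbour certifies that both vertices have positive weight, since
    -- `f y z ≤ β y * D z`.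
    codegβ : ∀ y y' → y ≢ y' → sum (λ z → f y z * f y' z) ≤ β y * β y'
    codegβ y y' ne = ≤1-from-pos (codeg y y' ne) pos
      where
      pos : 1 ≤ sum (λ z → f y z * f y' z) → 1 ≤ β y * β y'
      pos p with sum-pos _ p
      ... | z , q with *-pos (f y z) (f y' z) q
      ... | q₁ , q₂ = *-mono-≤ (proj₁ (*-pos (β y) (D z) (≤-trans q₁ (f≤ y z))))
                               (proj₁ (*-pos (β y') (D z) (≤-trans q₂ (f≤ y' z))))
    squares : Σd² ≤ b * b + E
    squares = sum-squares-≤ f β f≤1 codegβ
    by-size : b ≤ s ⊎ s ≤ b → L * s * E ≤ s * s * b + L * L * (b * sum D) + L * s * (2 * m)
    -- A small class is paid for by the term in `m` alone: `2 d ≤ d² + 1` and `b² ≤ s² ≤ m` give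
    -- `E ≤ 2 m`.
    by-size (inj₁ b≤s) = ≤-trans (*-monoʳ-≤ (L * s) E≤2m) (m≤n+m _ _)
      where
      E+E : E + E ≤ (b * b + m) + E
      E+E = begin
        E + E                         ≡⟨ cong (E +_) (sym (+-identityʳ E)) ⟩
        2 * E                         ≡⟨ *-distribˡ-sum 2 d ⟩
        sum (λ z → 2 * d z)           ≤⟨ sum-mono (λ z → subst (_≤ d z * d z + 1) (cong (2 *_) (*-identityʳ (d z))) (2ab≤a²+b² (d z) 1)) ⟩
        sum (λ z → d z * d z + 1)     ≡⟨ sum-distrib-+ (λ z → d z * d z) (λ _ → 1) ⟩
        Σd² + sum (λ (_ : Fin m) → 1) ≡⟨ cong (Σd² +_) (trans (sum-const m 1) (*-identityʳ m)) ⟩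
        Σd² + m                       ≤⟨ +-monoˡ-≤ m squares ⟩
        b * b + E + m                 ≡⟨ swap (b * b) E m ⟩
        (b * b + m) + E ∎
        where
        swap : ∀ x y z → x + y + z ≡ x + z + y
        swap = solve-∀
      E≤2m : E ≤ 2 * m
      E≤2m = begin
        E         ≤⟨ +-cancelʳ-≤ E E _ E+E ⟩
        b * b + m ≤⟨ +-monoˡ-≤ m (≤-trans (*-mono-≤ b≤s b≤s) s²≤m) ⟩
        m + m     ≡⟨ cong (m +_) (sym (+-identityʳ m)) ⟩
        2 * m ∎
    -- Now `s ≤ b` lets half of `2 L b s E` absorb the diagonal term `s² E`. Columns outside `D`
    -- have `d z ≡ 0`, so only `sum D` columns pay `L² b²`.
    by-size (inj₂ s≤b) = ≤-trans (cancel b s≤b amgm') (m≤m+n _ _)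
      where
      pointwise : ∀ z → 2 * (L * b * s) * d z ≤ s * s * (d z * d z) + L * L * (b * b) * D z
      pointwise z with D z | D≤1 z | (λ y → f≤ y z)
      ... | zero | _ | f≤0 = ≤-trans (≤-reflexive (trans (cong (2 * (L * b * s) *_) d≡0) (*-zeroʳ (2 * (L * b * s))))) z≤n
        where
        d≡0 : d z ≡ 0
        d≡0 = sum-zero (λ y → n≤0⇒n≡0 (subst (f y z ≤_) (*-zeroʳ (β y)) (f≤0 y)))
      ... | suc zero | _ | _ = subst₂ _≤_ (id₁ s (d z) L b) (id₂ s (d z) L b) (2ab≤a²+b² (s * d z) (L * b))
        where
        id₁ : ∀ s d L b → 2 * (s * d * (L * b)) ≡ 2 * (L * b * s) * d
        id₁ = solve-∀
        id₂ : ∀ s d L b → s * d * (s * d) + L * b * (L * b) ≡ s * s * (d * d) + L * L * (b * b) * 1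
        id₂ = solve-∀
      ... | suc (suc _) | s≤s () | _
      amgm : 2 * (L * b * s) * E ≤ s * s * Σd² + L * L * (b * b) * sum D
      amgm = begin
        2 * (L * b * s) * E                ≡⟨ *-distribˡ-sum (2 * (L * b * s)) d ⟩
        sum (λ z → 2 * (L * b * s) * d z)  ≤⟨ sum-mono pointwise ⟩
        sum (λ z → s * s * (d z * d z) + L * L * (b * b) * D z)
          ≡⟨ sum-distrib-+ (λ z → s * s * (d z * d z)) (λ z → L * L * (b * b) * D z) ⟩
        sum (λ z → s * s * (d z * d z)) + sum (λ z → L * L * (b * b) * D z)
          ≡⟨ sym (cong₂ _+_ (*-distribˡ-sum (s * s) (λ z → d z * d z)) (*-distribˡ-sum (L * L * (b * b)) D)) ⟩
        s * s * Σd² + L * L * (b * b) * sum D ∎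
      amgm' : b * (L * s * E) ≤ b * (s * s * b + L * L * (b * sum D))
      amgm' = +-cancelʳ-≤ (L * b * s * E) _ _ (begin
        b * (L * s * E) + L * b * s * E ≡⟨ id₁ b L s E ⟩
        2 * (L * b * s) * E             ≤⟨ amgm ⟩
        s * s * Σd² + L * L * (b * b) * sum D ≤⟨ +-monoˡ-≤ _ (*-monoʳ-≤ (s * s) squares) ⟩
        s * s * (b * b + E) + L * L * (b * b) * sum D ≡⟨ id₂ s b E L (sum D) ⟩
        b * (s * s * b + L * L * (b * sum D)) + 1 * (s * s) * E
          ≤⟨ +-monoʳ-≤ (b * (s * s * b + L * L * (b * sum D))) (*-monoˡ-≤ E (*-mono-≤ 1≤L (*-monoˡ-≤ s s≤b))) ⟩
        b * (s * s * b + L * L * (b * sum D)) + L * (b * s) * E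
          ≡⟨ cong (λ x → b * (s * s * b + L * L * (b * sum D)) + x * E) (sym (*-assoc L b s)) ⟩
        b * (s * s * b + L * L * (b * sum D)) + L * b * s * E ∎)
        where
        id₁ : ∀ b L s E → b * (L * s * E) + L * b * s * E ≡ 2 * (L * b * s) * E
        id₁ = solve-∀
        id₂ : ∀ s b E L D → s * s * (b * b + E) + L * L * (b * b) * D ≡
              b * (s * s * b + L * L * (b * D)) + 1 * (s * s) * E
        id₂ = solve-∀
      cancel : ∀ b → s ≤ b → b * (L * s * E) ≤ b * (s * s * sum β + L * L * (sum β * sum D)) →
               L * s * E ≤ s * s * sum β + L * L * (sum β * sum D)
      cancel zero    z≤n _ = ≤-trans (≤-reflexive (cong (_* E) (*-zeroʳ L))) z≤n
      cancel (suc b) _   h = *-cancelˡ-≤ (suc b) h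

-- Kővári–Sós–Turán applied class by class: small classes contribute O(n) edges each.
kst : (s L : ℕ) → 1 ≤ s → 1 ≤ L → s * s ≤ n → n ≤ 4 * (s * s) → {M : ℕ} → 2 * (M * L) ≤ s →
  (e : Fin n → Fin n → ℕ) → (∀ y z → e y z ≤ 1) →
  (∀ y y' → y ≢ y' → sum (λ z → e y z * e y' z) ≤ 1) →
  (cl : Fin n → Fin M) (D : Fin n → Fin n → ℕ) → (∀ y z → D y z ≤ 1) →
  (∀ z {y y'} → cl y ≡ cl y' → D y z ≡ D y' z) →
  L * L * sum (λ y → sum (λ z → D y z)) ≤ n * n →
  L * sum (λ y → sum (λ z → D y z * e y z)) ≤ 6 * (s * n)
kst {n} s L 1≤s 1≤L s²≤n n≤4s² {M} M≤s e e≤1 codeg cl D D≤1 inv small =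
  *-cancelˡ-≤ s {{>-nonZero 1≤s}} (begin
    s * (L * F)                  ≡⟨ trans (sym (*-assoc s L F)) (cong (_* F) (*-comm s L)) ⟩
    L * s * F                    ≡⟨ cong (L * s *_) F-fibres ⟩
    L * s * sum E                ≡⟨ *-distribˡ-sum (L * s) E ⟩
    sum (λ j → L * s * E j)      ≤⟨ sum-mono per-class ⟩
    sum (λ j → s * s * b j + L * L * (b j * Dj j) + L * s * (2 * n))
      ≡⟨ sum-distrib-+ (λ j → s * s * b j + L * L * (b j * Dj j)) (λ _ → L * s * (2 * n)) ⟩
    sum (λ j → s * s * b j + L * L * (b j * Dj j)) + sum (λ (_ : Fin M) → L * s * (2 * n))
      ≡⟨ cong₂ _+_ (sum-distrib-+ (λ j → s * s * b j) (λ j → L * L * (b j * Dj j))) (sum-const M _) ⟩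
    sum (λ j → s * s * b j) + sum (λ j → L * L * (b j * Dj j)) + M * (L * s * (2 * n))
      ≡⟨ cong (_+ M * (L * s * (2 * n))) (sym (cong₂ _+_ (*-distribˡ-sum (s * s) b) (*-distribˡ-sum (L * L) (λ j → b j * Dj j)))) ⟩
    s * s * sum b + L * L * sum (λ j → b j * Dj j) + M * (L * s * (2 * n))
      ≡⟨ cong₂ (λ x y → s * s * x + L * L * y + M * (L * s * (2 * n))) b-total D-total ⟩
    -- The final constant is `6 = 1 + 4 + 1`: the sizes of the classes, `n ≤ 4 s²` in the measure of
    -- `D`, and the loss of `2 n` per class.
    s * s * n + L * L * sum (λ y → sum (λ z → D y z)) + M * (L * s * (2 * n))
      ≤⟨ +-mono-≤ (+-monoʳ-≤ (s * s * n) (≤-trans small (*-monoˡ-≤ n n≤4s²))) (≤-reflexive (id₁ M L s n)) ⟩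
    s * s * n + 4 * (s * s) * n + 2 * (M * L) * (s * n)
      ≤⟨ +-monoʳ-≤ (s * s * n + 4 * (s * s) * n) (*-monoˡ-≤ (s * n) M≤s) ⟩
    s * s * n + 4 * (s * s) * n + s * (s * n) ≡⟨ id₂ s n ⟩
    s * (6 * (s * n)) ∎)
  where
  open ≤-Reasoning
  F = sum (λ y → sum (λ z → D y z * e y z))
  id₁ : ∀ M L s n → M * (L * s * (2 * n)) ≡ 2 * (M * L) * (s * n)
  id₁ = solve-∀
  id₂ : ∀ s n → s * s * n + 4 * (s * s) * n + s * (s * n) ≡ s * (6 * (s * n))
  id₂ = solve-∀
  g : Fin n → Fin M → ℕ
  g z = proj₁ (class-function cl (λ y → D y z) (inv z))
  g-spec : ∀ z y → D y z ≡ g z (cl y)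
  g-spec z = proj₁ (proj₂ (class-function cl (λ y → D y z) (inv z)))
  g≤1 : ∀ z j → g z j ≤ 1
  g≤1 z j = ≤-from-pos bound
    where
    bound : 1 ≤ g z j → g z j ≤ 1
    bound p with proj₂ (proj₂ (class-function cl (λ y → D y z) (inv z))) j p
    ... | y , refl = subst (_≤ 1) (g-spec z y) (D≤1 y z)
  f : Fin M → Fin n → Fin n → ℕ
  f j y z = δ (cl y) j * (D y z * e y z)
  b Dj E : Fin M → ℕ
  b j  = sum (λ y → δ (cl y) j)
  Dj j = sum (λ z → g z j)
  E j  = sum (λ z → sum (λ y → f j y z))
  f≤e : ∀ j y z → f j y z ≤ e y z
  f≤e j y z = ≤-trans (*-mono-≤ (δ≤1 (cl y) j) (*-monoˡ-≤ (e y z) (D≤1 y z)))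
                      (≤-reflexive (trans (*-identityˡ _) (*-identityˡ _)))
  f≤ : ∀ j y z → f j y z ≤ δ (cl y) j * g z j
  f≤ j y z with cl y F.≟ j
  ... | yes refl = +-monoˡ-≤ 0 (≤-trans (≤-trans (*-monoʳ-≤ (D y z) (e≤1 y z)) (≤-reflexive (*-identityʳ _)))
                                        (≤-reflexive (g-spec z y)))
  ... | no _     = z≤n
  per-class : ∀ j → L * s * E j ≤ s * s * b j + L * L * (b j * Dj j) + L * s * (2 * n)
  per-class j = kst-class s L 1≤L s²≤n (f j) (λ y → δ (cl y) j) (λ z → g z j) (f≤ j) (λ y → δ≤1 (cl y) j) (λ z → g≤1 z j)
    (λ y y' ne → ≤-trans (sum-mono (λ z → *-mono-≤ (f≤e j y z) (f≤e j y' z))) (codeg y y' ne))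
  F-fibres : F ≡ sum E
  F-fibres = begin-equality
    F ≡⟨ sum-fibres cl (λ y → sum (λ z → D y z * e y z)) ⟩
    sum (λ j → sum (λ y → δ (cl y) j * sum (λ z → D y z * e y z)))
      ≡⟨ sum-cong (λ j → sum-cong (λ y → *-distribˡ-sum (δ (cl y) j) (λ z → D y z * e y z))) ⟩
    sum (λ j → sum (λ y → sum (λ z → f j y z)))
      ≡⟨ sum-cong (λ j → sum-comm (f j)) ⟩
    sum E ∎
  b-total : sum b ≡ n
  b-total = begin-equality
    sum b                                         ≡⟨ sum-cong (λ j → sum-cong (λ y → sym (*-identityʳ _))) ⟩
    sum (λ j → sum (λ y → δ (cl y) j * 1))        ≡⟨ sym (sum-fibres cl (λ _ → 1)) ⟩
    sum {n} (λ _ → 1)                             ≡⟨ trans (sum-const n 1) (*-identityʳ n) ⟩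
    n ∎
  D-total : sum (λ j → b j * Dj j) ≡ sum (λ y → sum (λ z → D y z))
  D-total = begin-equality
    sum (λ j → b j * Dj j)
      ≡⟨ sum-cong (λ j → *-distribʳ-sum (Dj j) (λ y → δ (cl y) j)) ⟩
    sum (λ j → sum (λ y → δ (cl y) j * Dj j))
      ≡⟨ sum-comm (λ j y → δ (cl y) j * Dj j) ⟩
    sum (λ y → sum (λ j → δ (cl y) j * Dj j))
      ≡⟨ sum-cong (λ y → sum-δ (cl y) Dj) ⟩
    sum (λ y → Dj (cl y))
      ≡⟨ sum-cong (λ y → sum-cong (λ z → sym (g-spec z y))) ⟩
    sum (λ y → sum (λ z → D y z)) ∎

-- Multiple sums

does-cases : {P : Set} (d : Dec P) → (does d ≡ true × P) ⊎ (does d ≡ false × ¬ P)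
does-cases (yes p) = inj₁ (refl , p)
does-cases (no ¬p) = inj₂ (refl , ¬p)

≤𝟙-1≤? : ∀ {a} → a ≤ 1 → a ≤ 𝟙 (does (1 ≤? a))
≤𝟙-1≤? {zero}  _ = z≤n
≤𝟙-1≤? {suc a} p = p

sum³-cong : {f g : Fin n → Fin n → Fin n → ℕ} → (∀ x y z → f x y z ≡ g x y z) →
  sum (λ x → sum (λ y → sum (λ z → f x y z))) ≡ sum (λ x → sum (λ y → sum (λ z → g x y z)))
sum³-cong h = sum-cong (λ x → sum-cong (λ y → sum-cong (h x y)))

sum³-mono : {f g : Fin n → Fin n → Fin n → ℕ} → (∀ x y z → f x y z ≤ g x y z) →
  sum (λ x → sum (λ y → sum (λ z → f x y z))) ≤ sum (λ x → sum (λ y → sum (λ z → g x y z)))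
sum³-mono h = sum-mono (λ x → sum-mono (λ y → sum-mono (h x y)))

sum²-distrib-+ : (f g : Fin n → Fin m → ℕ) → sum (λ x → sum (λ y → f x y + g x y)) ≡
  sum (λ x → sum (λ y → f x y)) + sum (λ x → sum (λ y → g x y))
sum²-distrib-+ f g = trans (sum-cong (λ x → sum-distrib-+ (f x) (g x))) (sum-distrib-+ (λ x → sum (f x)) (λ x → sum (g x)))

sum³-distrib-+ : (f g : Fin n → Fin n → Fin n → ℕ) → sum (λ x → sum (λ y → sum (λ z → f x y z + g x y z))) ≡
  sum (λ x → sum (λ y → sum (λ z → f x y z))) + sum (λ x → sum (λ y → sum (λ z → g x y z)))
sum³-distrib-+ f g = trans (sum-cong (λ x → sum²-distrib-+ (f x) (g x)))
                           (sum-distrib-+ (λ x → sum (λ y → sum (f x y))) (λ x → sum (λ y → sum (g x y))))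

*-distribˡ-sum² : ∀ c (f : Fin n → Fin m → ℕ) →
  c * sum (λ x → sum (λ y → f x y)) ≡ sum (λ x → sum (λ y → c * f x y))
*-distribˡ-sum² c f = trans (*-distribˡ-sum c _) (sum-cong (λ x → *-distribˡ-sum c (f x)))

sum-rotate : (f : Fin n → Fin n → Fin n → ℕ) → sum (λ x → sum (λ y → sum (λ z → f x y z))) ≡
  sum (λ y → sum (λ z → sum (λ x → f x y z)))
sum-rotate f = trans (sum-comm (λ x y → sum (f x y))) (sum-cong (λ y → sum-comm (λ x z → f x y z)))

-- Classes in which a set is sparse

module Thin {n M : ℕ} (cl : Fin n → Fin M) (S : Fin n → Bool) (q : ℕ) where

  size trace : Fin M → ℕ
  size j  = sum (λ y → δ (cl y) j)
  trace j = sum (λ y → δ (cl y) j * 𝟙 (S y))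

  thin : Fin M → Bool
  thin j = does (q * trace j <? size j)

  thin-or-thick : ∀ j → (thin j ≡ true × q * trace j ≤ size j) ⊎ (thin j ≡ false × size j ≤ q * trace j)
  thin-or-thick j with does-cases (q * trace j <? size j)
  ... | inj₁ (eq , p)  = inj₁ (eq , <⇒≤ p)
  ... | inj₂ (eq , ¬p) = inj₂ (eq , ≮⇒≥ ¬p)

  sum-size : sum size ≡ n
  sum-size = trans (sum-cong (λ j → sum-cong (λ y → sym (*-identityʳ _))))
    (trans (sym (sum-fibres cl (λ _ → 1))) (trans (sum-const n 1) (*-identityʳ n)))

  -- A thin class meets `S` in at most `size / q` points, and the sizes add up to `n`.
  thin-trace : q * sum (λ y → 𝟙 (thin (cl y)) * 𝟙 (S y)) ≤ n
  thin-trace = begin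
    q * sum (λ y → 𝟙 (thin (cl y)) * 𝟙 (S y))
      ≡⟨ cong (q *_) (sum-fibres cl _) ⟩
    q * sum (λ j → sum (λ y → δ (cl y) j * (𝟙 (thin (cl y)) * 𝟙 (S y))))
      ≡⟨ cong (q *_) (sum-cong (λ j → trans (sum-cong (λ y → move j y)) (sym (*-distribˡ-sum (𝟙 (thin j)) _)))) ⟩
    q * sum (λ j → 𝟙 (thin j) * trace j)
      ≡⟨ *-distribˡ-sum q _ ⟩
    sum (λ j → q * (𝟙 (thin j) * trace j))
      ≤⟨ sum-mono term ⟩
    sum size ≡⟨ sum-size ⟩
    n ∎
    where
    open ≤-Reasoning
    move : ∀ j y → δ (cl y) j * (𝟙 (thin (cl y)) * 𝟙 (S y)) ≡ 𝟙 (thin j) * (δ (cl y) j * 𝟙 (S y))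
    move j y with cl y F.≟ j
    ... | yes refl = trans (+-identityʳ _) (cong (𝟙 (thin (cl y)) *_) (sym (+-identityʳ _)))
    ... | no _     = sym (*-zeroʳ (𝟙 (thin j)))
    term : ∀ j → q * (𝟙 (thin j) * trace j) ≤ size j
    term j with thin-or-thick j
    ... | inj₁ (eq , p) rewrite eq = subst (λ x → q * x ≤ size j) (sym (+-identityʳ _)) p
    ... | inj₂ (eq , _) rewrite eq = ≤-trans (≤-reflexive (*-zeroʳ q)) z≤n

  -- On a thick class the restriction to `S` loses at most a factor `q`; as `f` is constant on
  -- classes, this passes from cardinalities to sums of `f`.
  thick-sum : (f : Fin n → ℕ) → (∀ {y y'} → cl y ≡ cl y' → f y ≡ f y') → (∀ y → 1 ≤ f y → thin (cl y) ≡ false) →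
              sum f ≤ q * sum (λ y → f y * 𝟙 (S y))
  thick-sum f inv thick = begin
    sum f ≡⟨ by-class (λ _ → 1) f (λ y → *-identityʳ (f y)) ⟩
    sum (λ j → g j * sum (λ y → δ (cl y) j * 1))
      ≡⟨ sum-cong (λ j → cong (g j *_) (sum-cong (λ y → *-identityʳ _))) ⟩
    sum (λ j → g j * size j)
      ≤⟨ sum-mono (λ j → dominated j) ⟩
    sum (λ j → q * (g j * trace j)) ≡⟨ sym (*-distribˡ-sum q _) ⟩
    q * sum (λ j → g j * trace j)
      ≡⟨ cong (q *_) (sym (by-class (λ y → 𝟙 (S y)) (λ y → f y * 𝟙 (S y)) (λ _ → refl))) ⟩
    q * sum (λ y → f y * 𝟙 (S y)) ∎
    where
    open ≤-Reasoning
    cf = class-function cl f inv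
    g  = proj₁ cf
    by-class : ∀ (h k : Fin n → ℕ) → (∀ y → f y * h y ≡ k y) → sum k ≡ sum (λ j → g j * sum (λ y → δ (cl y) j * h y))
    by-class h k fh≡k = trans (sum-fibres cl k)
      (sum-cong (λ j → trans (sum-cong (λ y → move j y)) (sym (*-distribˡ-sum (g j) _))))
      where
      move : ∀ j y → δ (cl y) j * k y ≡ g j * (δ (cl y) j * h y)
      move j y with cl y F.≟ j
      ... | yes refl = trans (+-identityʳ _) (trans (sym (fh≡k y)) (cong₂ _*_ (proj₁ (proj₂ cf) y) (sym (+-identityʳ _))))
      ... | no _     = sym (*-zeroʳ (g j))
    dominated : ∀ j → g j * size j ≤ q * (g j * trace j)
    dominated j with g j in eq | proj₂ (proj₂ cf) j
    ... | zero  | _ = z≤n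
    ... | suc k | hit with hit (s≤s z≤n)
    ...   | y , refl with thin-or-thick (cl y) | thick y (subst (1 ≤_) (sym (trans (proj₁ (proj₂ cf) y) eq)) (s≤s z≤n))
    ...     | inj₁ (t , _) | t' = contradiction (trans (sym t) t') (λ ())
    ...     | inj₂ (_ , p) | _  = ≤-trans (*-monoʳ-≤ (suc k) p) (≤-reflexive (id (suc k) q (trace (cl y))))
      where
      id : ∀ a q t → a * (q * t) ≡ q * (a * t)
      id = solve-∀

-- T x y z says that x, y, z are the vertices of three fixed ranks in a common hyperedge.
record Girth6 {n : ℕ} (T : Fin n → Fin n → Fin n → Bool) : Set where
  field
    lin₁₂ : ∀ {x y z z'} → T x y z ≡ true → T x y z' ≡ true → z ≡ z'
    lin₁₃ : ∀ {x y y' z} → T x y z ≡ true → T x y' z ≡ true → y ≡ y'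
    lin₂₃ : ∀ {x x' y z} → T x y z ≡ true → T x' y z ≡ true → x ≡ x'
    c4₁₂  : ∀ {x x' u y a b c d} → T x u a ≡ true → T x y b ≡ true → T x' u c ≡ true → T x' y d ≡ true →
            u ≢ y → x ≡ x'
    c4₁₃  : ∀ {x x' u z a b c d} → T x u a ≡ true → T x b z ≡ true → T x' u c ≡ true → T x' d z ≡ true →
            x ≡ x'
    c4₂₃  : ∀ {y y' z z' a b c d} → T a y z ≡ true → T b y' z ≡ true → T c y z' ≡ true → T d y' z' ≡ true →
            y ≢ y' → z ≡ z'
    -- The walk `u , x , y , z , x'` can genuinely collapse when `x ≡ x'`, so the conclusion is not
    -- absurdity but that `x₀` is joined to `u`.
    c5    : ∀ {x₀ x x' u y z a b c d} → T x₀ y z ≡ true → T x u a ≡ true → T x y b ≡ true →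
            T x' u c ≡ true → T x' d z ≡ true → u ≢ y → ∃ λ v → T x₀ u v ≡ true

-- Second neighbourhoods and the greedy exhaustion

module Triples {n : ℕ} (T : Fin n → Fin n → Fin n → Bool) (girth : Girth6 T) where
  open Girth6 girth

  τ : Fin n → Fin n → Fin n → ℕ
  τ x y z = 𝟙 (T x y z)

  e₁₂ e₁₃ e₂₃ : Fin n → Fin n → ℕ
  e₁₂ x y = sum (λ z → τ x y z)
  e₁₃ x z = sum (λ y → τ x y z)
  e₂₃ y z = sum (λ x → τ x y z)

  deg : Fin n → ℕ
  deg x = sum (λ y → e₁₂ x y)

  total : ℕ
  total = sum deg

  e₁₂≤1 : ∀ x y → e₁₂ x y ≤ 1
  e₁₂≤1 x y = sum-≤1 _ (λ z → 𝟙≤1 _) (λ z z' p q → lin₁₂ (𝟙-true p) (𝟙-true q))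
  e₁₃≤1 : ∀ x z → e₁₃ x z ≤ 1
  e₁₃≤1 x z = sum-≤1 _ (λ y → 𝟙≤1 _) (λ y y' p q → lin₁₃ (𝟙-true p) (𝟙-true q))
  e₂₃≤1 : ∀ y z → e₂₃ y z ≤ 1
  e₂₃≤1 y z = sum-≤1 _ (λ x → 𝟙≤1 _) (λ x x' p q → lin₂₃ (𝟙-true p) (𝟙-true q))

  e₁₂⁻ : ∀ {x y} → 1 ≤ e₁₂ x y → ∃ λ z → T x y z ≡ true
  e₁₂⁻ p with sum-pos _ p
  ... | z , q = z , 𝟙-true q
  e₁₃⁻ : ∀ {x z} → 1 ≤ e₁₃ x z → ∃ λ y → T x y z ≡ true
  e₁₃⁻ p with sum-pos _ p
  ... | y , q = y , 𝟙-true q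
  e₂₃⁻ : ∀ {y z} → 1 ≤ e₂₃ y z → ∃ λ x → T x y z ≡ true
  e₂₃⁻ p with sum-pos _ p
  ... | x , q = x , 𝟙-true q

  e₁₂⁺ : ∀ {x y z} → T x y z ≡ true → 1 ≤ e₁₂ x y
  e₁₂⁺ {x} {y} {z} p = ≤-trans (≤-reflexive (cong 𝟙 (sym p))) (term≤sum (λ z → τ x y z) z)

  codeg₁₂ codeg₁₃ : Fin n → Fin n → ℕ
  codeg₁₂ u y = sum (λ x → e₁₂ x u * e₁₂ x y)
  codeg₁₃ u z = sum (λ x → e₁₂ x u * e₁₃ x z)

  *≤1 : ∀ {a b} → a ≤ 1 → b ≤ 1 → a * b ≤ 1
  *≤1 = *-mono-≤

  codeg₁₂≤1 : ∀ u y → u ≢ y → codeg₁₂ u y ≤ 1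
  codeg₁₂≤1 u y u≢y = sum-≤1 _ (λ x → *≤1 (e₁₂≤1 x u) (e₁₂≤1 x y)) uniq
    where
    uniq : ∀ x x' → 1 ≤ e₁₂ x u * e₁₂ x y → 1 ≤ e₁₂ x' u * e₁₂ x' y → x ≡ x'
    uniq x x' p q with *-pos (e₁₂ x u) _ p | *-pos (e₁₂ x' u) _ q
    ... | p₁ , p₂ | q₁ , q₂ =
      c4₁₂ (proj₂ (e₁₂⁻ p₁)) (proj₂ (e₁₂⁻ p₂)) (proj₂ (e₁₂⁻ q₁)) (proj₂ (e₁₂⁻ q₂)) u≢y

  codeg₁₃≤1 : ∀ u z → codeg₁₃ u z ≤ 1
  codeg₁₃≤1 u z = sum-≤1 _ (λ x → *≤1 (e₁₂≤1 x u) (e₁₃≤1 x z)) uniq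
    where
    uniq : ∀ x x' → 1 ≤ e₁₂ x u * e₁₃ x z → 1 ≤ e₁₂ x' u * e₁₃ x' z → x ≡ x'
    uniq x x' p q with *-pos (e₁₂ x u) _ p | *-pos (e₁₂ x' u) _ q
    ... | p₁ , p₂ | q₁ , q₂ =
      c4₁₃ (proj₂ (e₁₂⁻ p₁)) (proj₂ (e₁₃⁻ p₂)) (proj₂ (e₁₂⁻ q₁)) (proj₂ (e₁₃⁻ q₂))

  codeg₂₃≤1 : ∀ y y' → y ≢ y' → sum (λ z → e₂₃ y z * e₂₃ y' z) ≤ 1
  codeg₂₃≤1 y y' y≢y' = sum-≤1 _ (λ z → *≤1 (e₂₃≤1 y z) (e₂₃≤1 y' z)) uniq
    where
    uniq : ∀ z z' → 1 ≤ e₂₃ y z * e₂₃ y' z → 1 ≤ e₂₃ y z' * e₂₃ y' z' → z ≡ z'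
    uniq z z' p q with *-pos (e₂₃ y z) _ p | *-pos (e₂₃ y z') _ q
    ... | p₁ , p₂ | q₁ , q₂ =
      c4₂₃ (proj₂ (e₂₃⁻ p₁)) (proj₂ (e₂₃⁻ p₂)) (proj₂ (e₂₃⁻ q₁)) (proj₂ (e₂₃⁻ q₂)) y≢y'

  total≤n² : total ≤ n * n
  total≤n² = sum-≤-const (λ x → ≤-trans (sum-≤-const (λ y → e₁₂≤1 x y)) (≤-reflexive (*-identityʳ n)))

  sum-deg² : sum (λ x → deg x * deg x) ≤ n * n + total
  sum-deg² = subst (λ a → sum (λ x → deg x * deg x) ≤ a * a + total) (trans (sum-const n 1) (*-identityʳ n))
    (sum-squares-≤ (λ y x → e₁₂ x y) (λ _ → 1) (λ y x → e₁₂≤1 x y) codeg₁₂≤1)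

  -- The vertex `u` is left out of `S u` because its codegree with itself is its whole degree, not
  -- at most one.
  S S' : Fin n → Fin n → Bool
  S u y  = not (does (u F.≟ y)) ∧ does (1 ≤? codeg₁₂ u y)
  S' u z = does (1 ≤? codeg₁₃ u z)

  S⁻ : ∀ {u y} → S u y ≡ true → u ≢ y × 1 ≤ codeg₁₂ u y
  S⁻ {u} {y} p with u F.≟ y | does-cases (1 ≤? codeg₁₂ u y)
  ... | no ne | inj₁ (_ , q)  = ne , q
  ... | no ne | inj₂ (eq , _) = contradiction (trans (sym p) eq) (λ ())

  S'⁻ : ∀ {u z} → S' u z ≡ true → 1 ≤ codeg₁₃ u z
  S'⁻ {u} {z} p with does-cases (1 ≤? codeg₁₃ u z)
  ... | inj₁ (_ , q)  = q
  ... | inj₂ (eq , _) = contradiction (trans (sym p) eq) (λ ())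

  codeg₁₂≤S : ∀ u y → codeg₁₂ u y ≤ 𝟙 (S u y) + δ u y * codeg₁₂ u u
  codeg₁₂≤S u y with u F.≟ y
  ... | yes refl = ≤-reflexive (sym (+-identityʳ _))
  ... | no ne    = ≤-trans (≤𝟙-1≤? (codeg₁₂≤1 u y ne)) (≤-reflexive (sym (+-identityʳ _)))

  codeg₁₃≤S' : ∀ u z → codeg₁₃ u z ≤ 𝟙 (S' u z)
  codeg₁₃≤S' u z = ≤𝟙-1≤? (codeg₁₃≤1 u z)

  -- By `c5` the vertex `x` is a common neighbour of `u` and `y`, hence unique for given `y`; and
  -- `x , y` determine `z`.
  rectangle-sparse : ∀ u → sum (λ x → sum (λ y → sum (λ z → τ x y z * (𝟙 (S u y) * 𝟙 (S' u z))))) ≤ n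
  rectangle-sparse u = begin
    sum (λ x → sum (λ y → sum (λ z → τ x y z * (𝟙 (S u y) * 𝟙 (S' u z)))))
      ≤⟨ sum³-mono apex ⟩
    sum (λ x → sum (λ y → sum (λ z → τ x y z * (𝟙 (S u y) * e₁₂ x u))))
      ≡⟨ sum-cong (λ x → sum-cong (λ y → sym (*-distribʳ-sum _ (τ x y)))) ⟩
    sum (λ x → sum (λ y → e₁₂ x y * (𝟙 (S u y) * e₁₂ x u)))
      ≡⟨ sum-comm _ ⟩
    sum (λ y → sum (λ x → e₁₂ x y * (𝟙 (S u y) * e₁₂ x u)))
      ≡⟨ sum-cong (λ y → trans (sum-cong (λ x → id (e₁₂ x y) (𝟙 (S u y)) (e₁₂ x u))) (sym (*-distribˡ-sum (𝟙 (S u y)) _))) ⟩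
    sum (λ y → 𝟙 (S u y) * codeg₁₂ u y)
      ≤⟨ sum-≤-const one ⟩
    n * 1 ≡⟨ *-identityʳ n ⟩
    n ∎
    where
    open ≤-Reasoning
    id : ∀ a b c → a * (b * c) ≡ b * (c * a)
    id = solve-∀
    one : ∀ y → 𝟙 (S u y) * codeg₁₂ u y ≤ 1
    one y with S u y in eq
    ... | true  = ≤-trans (≤-reflexive (+-identityʳ _)) (codeg₁₂≤1 u y (proj₁ (S⁻ eq)))
    ... | false = z≤n
    apex : ∀ x y z → τ x y z * (𝟙 (S u y) * 𝟙 (S' u z)) ≤ τ x y z * (𝟙 (S u y) * e₁₂ x u)
    apex x y z with T x y z in t | S u y in p | S' u z in q
    ... | false | _ | _ = z≤n
    ... | true | false | _ = z≤n
    ... | true | true | false = z≤n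
    ... | true | true | true with sum-pos _ (proj₂ (S⁻ p)) | sum-pos _ (S'⁻ q)
    ...   | x₁ , r₁ | x₂ , r₂ with *-pos (e₁₂ x₁ u) _ r₁ | *-pos (e₁₂ x₂ u) _ r₂
    ...     | a , b | c , d = ≤-trans (e₁₂⁺ (proj₂ found)) (≤-reflexive (sym (trans (+-identityʳ _) (+-identityʳ _))))
      where
      found : ∃ λ v → T x u v ≡ true
      found = c5 t (proj₂ (e₁₂⁻ a)) (proj₂ (e₁₂⁻ b)) (proj₂ (e₁₂⁻ c)) (proj₂ (e₁₃⁻ d)) (proj₁ (S⁻ p))

  live : List (Fin n) → Fin n → Fin n → Bool
  live []       y z = true
  live (u ∷ us) y z = live us y z ∧ not (S u y ∧ S' u z)

  live-measure : List (Fin n) → ℕ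
  live-measure us = sum (λ y → sum (λ z → 𝟙 (live us y z)))

  gain : List (Fin n) → Fin n → ℕ
  gain us u = sum (λ y → sum (λ z → 𝟙 (live us y z) * (𝟙 (S u y) * 𝟙 (S' u z))))

  live-split : ∀ us u y z → 𝟙 (live us y z) ≡ 𝟙 (live (u ∷ us) y z) + 𝟙 (live us y z) * (𝟙 (S u y) * 𝟙 (S' u z))
  live-split us u y z with live us y z | S u y | S' u z
  ... | false | _     | _     = refl
  ... | true  | false | _     = refl
  ... | true  | true  | false = refl
  ... | true  | true  | true  = refl

  measure-split : ∀ us u → live-measure us ≡ live-measure (u ∷ us) + gain us u
  measure-split us u = trans (sum-cong (λ y → sum-cong (λ z → live-split us u y z))) (sum²-distrib-+ _ _)

  live-total : List (Fin n) → ℕ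
  live-total us = sum (λ x → sum (λ y → sum (λ z → τ x y z * 𝟙 (live us y z))))

  -- Each removed rectangle costs at most `n` triples, negligible against `n^{3/2}` as long as `us`
  -- has bounded length.
  live-loss : ∀ us → total ≤ live-total us + length us * n
  live-loss [] = ≤-trans (≤-reflexive (sum³-cong (λ x y z → sym (*-identityʳ _)))) (m≤m+n _ _)
  live-loss (u ∷ us) = begin
    total ≤⟨ live-loss us ⟩
    live-total us + length us * n ≤⟨ +-monoˡ-≤ (length us * n) step ⟩
    live-total (u ∷ us) + n + length us * n ≡⟨ +-assoc (live-total (u ∷ us)) n _ ⟩
    live-total (u ∷ us) + (n + length us * n) ∎
    where
    open ≤-Reasoning
    split : ∀ x y z → τ x y z * 𝟙 (live us y z) ≤ τ x y z * 𝟙 (live (u ∷ us) y z) + τ x y z * (𝟙 (S u y) * 𝟙 (S' u z))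
    split x y z = begin
      τ x y z * 𝟙 (live us y z) ≡⟨ cong (τ x y z *_) (live-split us u y z) ⟩
      τ x y z * (𝟙 (live (u ∷ us) y z) + 𝟙 (live us y z) * (𝟙 (S u y) * 𝟙 (S' u z)))
        ≤⟨ *-monoʳ-≤ (τ x y z) (+-monoʳ-≤ (𝟙 (live (u ∷ us) y z))
             (≤-trans (*-monoˡ-≤ (𝟙 (S u y) * 𝟙 (S' u z)) (𝟙≤1 (live us y z))) (≤-reflexive (*-identityˡ _)))) ⟩
      τ x y z * (𝟙 (live (u ∷ us) y z) + 𝟙 (S u y) * 𝟙 (S' u z)) ≡⟨ *-distribˡ-+ (τ x y z) _ _ ⟩
      τ x y z * 𝟙 (live (u ∷ us) y z) + τ x y z * (𝟙 (S u y) * 𝟙 (S' u z)) ∎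
    step : live-total us ≤ live-total (u ∷ us) + n
    step = ≤-trans (sum³-mono split) (≤-trans (≤-reflexive (sum³-distrib-+ _ _)) (+-monoʳ-≤ _ (rectangle-sparse u)))

  -- Each further `u` removes more than `n² / q` of the live measure, so `f` serves as fuel; from
  -- the full square `f = q` is enough.
  greedy : ∀ q f us → q * live-measure us ≤ f * (n * n) →
    ∃ λ us' → length us' ≤ f + length us × (∀ u → q * gain us' u ≤ n * n)
  greedy q f us fuel with any? (λ u → n * n <? q * gain us u)
  ... | no ¬p = us , m≤n+m _ f , λ u → ≮⇒≥ (λ lt → ¬p (u , lt))
  greedy q zero us fuel | yes (u , lt) = contradiction (≤-trans lt q-gain) (λ ())
    where
    q-gain : q * gain us u ≤ 0
    q-gain = ≤-trans (*-monoʳ-≤ q (≤-trans (m≤n+m _ (live-measure (u ∷ us))) (≤-reflexive (sym (measure-split us u))))) fuel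
  greedy q (suc f) us fuel | yes (u , lt) with greedy q f (u ∷ us) smaller
    where
    open ≤-Reasoning
    smaller : q * live-measure (u ∷ us) ≤ f * (n * n)
    smaller = +-cancelˡ-≤ (n * n) _ _ (begin
      n * n + q * live-measure (u ∷ us) ≤⟨ +-monoˡ-≤ _ (<⇒≤ lt) ⟩
      q * gain us u + q * live-measure (u ∷ us) ≡⟨ sym (*-distribˡ-+ q (gain us u) _) ⟩
      q * (gain us u + live-measure (u ∷ us)) ≡⟨ cong (q *_) (trans (+-comm (gain us u) _) (sym (measure-split us u))) ⟩
      q * live-measure us ≤⟨ fuel ⟩
      n * n + f * (n * n) ∎)
  ... | us' , len , ok = us' , ≤-trans len (≤-reflexive (+-suc f (length us))) , ok

  live-invariantˡ : ∀ us {y y'} z → All (λ f → f y ≡ f y') (map S us) → live us y z ≡ live us y' z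
  live-invariantˡ []       z []         = refl
  live-invariantˡ (u ∷ us) z (eq ∷ eqs) = cong₂ (λ a b → a ∧ not (b ∧ S' u z)) (live-invariantˡ us z eqs) eq

  live-invariantʳ : ∀ us y {z z'} → All (λ f → f z ≡ f z') (map S' us) → live us y z ≡ live us y z'
  live-invariantʳ []       y []         = refl
  live-invariantʳ (u ∷ us) y (eq ∷ eqs) = cong₂ (λ a b → a ∧ not (S u y ∧ b)) (live-invariantʳ us y eqs) eq

-- Incidences seen through thick classes

module Counting {n : ℕ} (T : Fin n → Fin n → Fin n → Bool) (girth : Girth6 T)
                (us : List (Fin n)) (q : ℕ) where
  open Triples T girth

  cl  = classify (map S us)
  cl' = classify (map S' us)

  module Y (u : Fin n) = Thin cl (S u) q
  module Z (u : Fin n) = Thin cl' (S' u) q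

  thinʸ thinᶻ : Fin n → Fin n → Bool
  thinʸ u y = Y.thin u (cl y)
  thinᶻ u z = Z.thin u (cl' z)

  -- For fixed `u` this set of live pairs is a union of products of classes, and at least a fraction
  -- `1 / q²` of each product lies in the rectangle of `u`.
  D : Fin n → Fin n → Fin n → ℕ
  D u y z = 𝟙 (live us y z) * (𝟙 (not (thinʸ u y)) * 𝟙 (not (thinᶻ u z)))

  W : Fin n → Fin n → ℕ
  W x u = sum (λ y → sum (λ z → τ x y z * D u y z))

  live-deg : Fin n → ℕ
  live-deg x = sum (λ y → sum (λ z → τ x y z * 𝟙 (live us y z)))

  D≤1 : ∀ u y z → D u y z ≤ 1
  D≤1 u y z = *≤1 (𝟙≤1 (live us y z)) (*≤1 (𝟙≤1 (not (thinʸ u y))) (𝟙≤1 (not (thinᶻ u z))))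

  W≤deg : ∀ x u → W x u ≤ deg x
  W≤deg x u = sum-mono (λ y → sum-mono (λ z →
    ≤-trans (*-monoʳ-≤ (τ x y z) (D≤1 u y z)) (≤-reflexive (*-identityʳ _))))

  private
    in-deg : Fin n → ℕ
    in-deg u = sum (λ x → e₁₂ x u)

    badʸ badᶻ : Fin n → ℕ
    badʸ u = sum (λ x → sum (λ y → sum (λ z → e₁₂ x u * (τ x y z * 𝟙 (thinʸ u y)))))
    badᶻ u = sum (λ x → sum (λ y → sum (λ z → e₁₂ x u * (τ x y z * 𝟙 (thinᶻ u z)))))

    -- The thin classes contain at most `n / q` vertices of `S u`, each of codegree at most one with
    -- `u`. The term `in-deg u` comes from `y ≡ u`, which lies outside `S u`.
    badʸ-bound : ∀ u → q * badʸ u ≤ n + q * in-deg u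
    badʸ-bound u = begin
      q * badʸ u ≡⟨ cong (q *_) rearrange ⟩
      q * sum (λ y → 𝟙 (thinʸ u y) * codeg₁₂ u y)
        ≤⟨ *-monoʳ-≤ q (sum-mono (λ y → bound y)) ⟩
      q * sum (λ y → 𝟙 (thinʸ u y) * 𝟙 (S u y) + δ u y * codeg₁₂ u u)
        ≡⟨ cong (q *_) (trans (sum-distrib-+ _ _) (cong (sum (λ y → 𝟙 (thinʸ u y) * 𝟙 (S u y)) +_) (sum-δ u (λ _ → codeg₁₂ u u)))) ⟩
      q * (sum (λ y → 𝟙 (thinʸ u y) * 𝟙 (S u y)) + codeg₁₂ u u)
        ≡⟨ *-distribˡ-+ q _ (codeg₁₂ u u) ⟩
      q * sum (λ y → 𝟙 (thinʸ u y) * 𝟙 (S u y)) + q * codeg₁₂ u u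
        ≤⟨ +-mono-≤ (Y.thin-trace u) (*-monoʳ-≤ q (sum-mono (λ x →
             ≤-trans (*-monoʳ-≤ (e₁₂ x u) (e₁₂≤1 x u)) (≤-reflexive (*-identityʳ _))))) ⟩
      n + q * in-deg u ∎
      where
      open ≤-Reasoning
      rearrange : badʸ u ≡ sum (λ y → 𝟙 (thinʸ u y) * codeg₁₂ u y)
      rearrange = begin-equality
        badʸ u
          ≡⟨ sum-cong (λ x → sum-cong (λ y → trans (sum-cong (λ z → id (e₁₂ x u) (τ x y z) (𝟙 (thinʸ u y))))
                                                   (sym (*-distribˡ-sum (𝟙 (thinʸ u y) * e₁₂ x u) (τ x y))))) ⟩
        sum (λ x → sum (λ y → 𝟙 (thinʸ u y) * e₁₂ x u * e₁₂ x y))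
          ≡⟨ sum-comm _ ⟩
        sum (λ y → sum (λ x → 𝟙 (thinʸ u y) * e₁₂ x u * e₁₂ x y))
          ≡⟨ sum-cong (λ y → trans (sum-cong (λ x → *-assoc (𝟙 (thinʸ u y)) (e₁₂ x u) (e₁₂ x y)))
                                   (sym (*-distribˡ-sum (𝟙 (thinʸ u y)) _))) ⟩
        sum (λ y → 𝟙 (thinʸ u y) * codeg₁₂ u y) ∎
        where
        id : ∀ a b c → a * (b * c) ≡ c * a * b
        id = solve-∀
      bound : ∀ y → 𝟙 (thinʸ u y) * codeg₁₂ u y ≤ 𝟙 (thinʸ u y) * 𝟙 (S u y) + δ u y * codeg₁₂ u u
      bound y with thinʸ u y
      ... | true  = ≤-trans (≤-reflexive (+-identityʳ _))
                      (≤-trans (codeg₁₂≤S u y) (+-monoˡ-≤ (δ u y * codeg₁₂ u u) (≤-reflexive (sym (+-identityʳ (𝟙 (S u y)))))))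
      ... | false = z≤n

    badᶻ-bound : ∀ u → q * badᶻ u ≤ n
    badᶻ-bound u = begin
      q * badᶻ u ≡⟨ cong (q *_) rearrange ⟩
      q * sum (λ z → 𝟙 (thinᶻ u z) * codeg₁₃ u z)
        ≤⟨ *-monoʳ-≤ q (sum-mono (λ z → *-monoʳ-≤ (𝟙 (thinᶻ u z)) (codeg₁₃≤S' u z))) ⟩
      q * sum (λ z → 𝟙 (thinᶻ u z) * 𝟙 (S' u z)) ≤⟨ Z.thin-trace u ⟩
      n ∎
      where
      open ≤-Reasoning
      rearrange : badᶻ u ≡ sum (λ z → 𝟙 (thinᶻ u z) * codeg₁₃ u z)
      rearrange = begin-equality
        badᶻ u
          ≡⟨ sum-cong (λ x → trans (sum-comm _) (sum-cong (λ z →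
               trans (sum-cong (λ y → id (e₁₂ x u) (τ x y z) (𝟙 (thinᶻ u z))))
                     (sym (*-distribˡ-sum (𝟙 (thinᶻ u z) * e₁₂ x u) (λ y → τ x y z)))))) ⟩
        sum (λ x → sum (λ z → 𝟙 (thinᶻ u z) * e₁₂ x u * e₁₃ x z))
          ≡⟨ sum-comm _ ⟩
        sum (λ z → sum (λ x → 𝟙 (thinᶻ u z) * e₁₂ x u * e₁₃ x z))
          ≡⟨ sum-cong (λ z → trans (sum-cong (λ x → *-assoc (𝟙 (thinᶻ u z)) (e₁₂ x u) (e₁₃ x z)))
                                   (sym (*-distribˡ-sum (𝟙 (thinᶻ u z)) _))) ⟩
        sum (λ z → 𝟙 (thinᶻ u z) * codeg₁₃ u z) ∎
        where
        id : ∀ a b c → a * (b * c) ≡ c * a * b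
        id = solve-∀

    split : ∀ u → sum (λ x → e₁₂ x u * live-deg x) ≤ sum (λ x → e₁₂ x u * W x u) + badʸ u + badᶻ u
    split u = begin
      sum (λ x → e₁₂ x u * live-deg x)
        ≡⟨ sum-cong (λ x → *-distribˡ-sum² (e₁₂ x u) _) ⟩
      sum (λ x → sum (λ y → sum (λ z → e₁₂ x u * (τ x y z * 𝟙 (live us y z)))))
        ≤⟨ sum³-mono term ⟩
      sum (λ x → sum (λ y → sum (λ z → good x y z + bʸ x y z + bᶻ x y z)))
        ≡⟨ trans (sum³-distrib-+ _ _) (cong (_+ badᶻ u) (sum³-distrib-+ _ _)) ⟩
      sum (λ x → sum (λ y → sum (λ z → good x y z))) + badʸ u + badᶻ u
        ≡⟨ cong (λ a → a + badʸ u + badᶻ u) (sum-cong (λ x → sym (*-distribˡ-sum² (e₁₂ x u) _))) ⟩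
      sum (λ x → e₁₂ x u * W x u) + badʸ u + badᶻ u ∎
      where
      open ≤-Reasoning
      good bʸ bᶻ : Fin n → Fin n → Fin n → ℕ
      good x y z = e₁₂ x u * (τ x y z * D u y z)
      bʸ x y z = e₁₂ x u * (τ x y z * 𝟙 (thinʸ u y))
      bᶻ x y z = e₁₂ x u * (τ x y z * 𝟙 (thinᶻ u z))
      cases : ∀ l a b → 𝟙 l ≤ 𝟙 l * (𝟙 (not a) * 𝟙 (not b)) + 𝟙 a + 𝟙 b
      cases false a     b     = z≤n
      cases true  true  b     = s≤s z≤n
      cases true  false true  = s≤s z≤n
      cases true  false false = s≤s z≤n
      id : ∀ e t a b c → e * (t * (a + b + c)) ≡ e * (t * a) + e * (t * b) + e * (t * c)
      id = solve-∀
      term : ∀ x y z → e₁₂ x u * (τ x y z * 𝟙 (live us y z)) ≤ good x y z + bʸ x y z + bᶻ x y z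
      term x y z = ≤-trans
        (*-monoʳ-≤ (e₁₂ x u) (*-monoʳ-≤ (τ x y z) (cases (live us y z) (thinʸ u y) (thinᶻ u z))))
        (≤-reflexive (id (e₁₂ x u) (τ x y z) (D u y z) (𝟙 (thinʸ u y)) (𝟙 (thinᶻ u z))))

  good-pairs : ℕ
  good-pairs = sum (λ u → sum (λ x → e₁₂ x u * W x u))

  -- Both sides count pairs of a live triple (x , y , z) and an edge (x , u); thin classes and u = y are bounded
  -- by the codegree conditions.
  incidences : q * sum (λ x → deg x * live-deg x) ≤ q * good-pairs + (n * n + q * total) + n * n
  incidences = begin
    q * sum (λ x → deg x * live-deg x)
      ≡⟨ cong (q *_) (trans (sum-cong (λ x → *-distribʳ-sum (live-deg x) (e₁₂ x))) (sum-comm _)) ⟩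
    q * sum (λ u → sum (λ x → e₁₂ x u * live-deg x))
      ≤⟨ *-monoʳ-≤ q (sum-mono split) ⟩
    q * sum (λ u → sum (λ x → e₁₂ x u * W x u) + badʸ u + badᶻ u)
      ≡⟨ cong (q *_) (trans (sum-distrib-+ _ _) (cong (_+ sum badᶻ) (sum-distrib-+ _ _))) ⟩
    q * (good-pairs + sum badʸ + sum badᶻ)
      ≡⟨ trans (*-distribˡ-+ q _ (sum badᶻ)) (cong (_+ q * sum badᶻ) (*-distribˡ-+ q good-pairs _)) ⟩
    q * good-pairs + q * sum badʸ + q * sum badᶻ
      ≡⟨ cong₂ (λ a b → q * good-pairs + a + b) (*-distribˡ-sum q badʸ) (*-distribˡ-sum q badᶻ) ⟩
    q * good-pairs + sum (λ u → q * badʸ u) + sum (λ u → q * badᶻ u)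
      ≤⟨ +-mono-≤ (+-monoʳ-≤ (q * good-pairs) (sum-mono badʸ-bound)) (sum-≤-const badᶻ-bound) ⟩
    q * good-pairs + sum (λ u → n + q * in-deg u) + n * n
      ≡⟨ cong (λ a → q * good-pairs + a + n * n) (trans (sum-distrib-+ _ _) (cong₂ _+_ (sum-const n n) in-degrees)) ⟩
    q * good-pairs + (n * n + q * total) + n * n ∎
    where
    open ≤-Reasoning
    in-degrees : sum (λ u → q * in-deg u) ≡ q * total
    in-degrees = trans (sym (*-distribˡ-sum q in-deg)) (cong (q *_) (sum-comm (λ u x → e₁₂ x u)))

  D-invariantˡ : ∀ u z {y y'} → cl y ≡ cl y' → D u y z ≡ D u y' z
  D-invariantˡ u z {y} {y'} eq = cong₂ (λ a b → 𝟙 a * (𝟙 (not b) * 𝟙 (not (thinᶻ u z))))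
    (live-invariantˡ us z (classify-sound (map S us) eq)) (cong (Y.thin u) eq)

  D-invariantʳ : ∀ u y {z z'} → cl' z ≡ cl' z' → D u y z ≡ D u y z'
  D-invariantʳ u y {z} {z'} eq = cong₂ (λ a b → 𝟙 a * (𝟙 (not (thinʸ u y)) * 𝟙 (not b)))
    (live-invariantʳ us y (classify-sound (map S' us) eq)) (cong (Z.thin u) eq)

  -- `thick-sum` is used on the `y`-side and then on the `z`-side, at the price of a factor `q`
  -- each. What remains is live and inside the rectangle, so it is part of the gain that choosing
  -- `u` would bring.
  D-measure : ∀ u → sum (λ y → sum (λ z → D u y z)) ≤ q * q * gain us u
  D-measure u = begin
    sum (λ y → sum (λ z → D u y z))
      ≡⟨ sum-comm (D u) ⟩
    sum (λ z → sum (λ y → D u y z))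
      ≤⟨ sum-mono (λ z → Y.thick-sum u (λ y → D u y z) (D-invariantˡ u z) (λ y p → thickʸ y z p)) ⟩
    sum (λ z → q * sum (λ y → D u y z * 𝟙 (S u y)))
      ≡⟨ trans (sym (*-distribˡ-sum q _)) (cong (q *_) (sum-comm _)) ⟩
    q * sum (λ y → sum (λ z → D u y z * 𝟙 (S u y)))
      ≤⟨ *-monoʳ-≤ q (sum-mono (λ y → Z.thick-sum u (λ z → D u y z * 𝟙 (S u y))
           (λ eq → cong (_* 𝟙 (S u y)) (D-invariantʳ u y eq)) (λ z p → thickᶻ y z (proj₁ (*-pos (D u y z) _ p))))) ⟩
    q * sum (λ y → q * sum (λ z → D u y z * 𝟙 (S u y) * 𝟙 (S' u z)))
      ≡⟨ trans (cong (q *_) (sym (*-distribˡ-sum q _))) (sym (*-assoc q q _)) ⟩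
    q * q * sum (λ y → sum (λ z → D u y z * 𝟙 (S u y) * 𝟙 (S' u z)))
      ≤⟨ *-monoʳ-≤ (q * q) (sum-mono (λ y → sum-mono (λ z → term y z))) ⟩
    q * q * gain us u ∎
    where
    open ≤-Reasoning
    thickʸ : ∀ y z → 1 ≤ D u y z → thinʸ u y ≡ false
    thickʸ y z p with thinʸ u y | *-pos (𝟙 (live us y z)) _ p
    ... | false | _ = refl
    ... | true  | _ , ()
    thickᶻ : ∀ y z → 1 ≤ D u y z → thinᶻ u z ≡ false
    thickᶻ y z p with thinᶻ u z | proj₂ (*-pos (𝟙 (not (thinʸ u y))) _ (proj₂ (*-pos (𝟙 (live us y z)) _ p)))
    ... | false | _ = refl
    ... | true  | ()
    term : ∀ y z → D u y z * 𝟙 (S u y) * 𝟙 (S' u z) ≤ 𝟙 (live us y z) * (𝟙 (S u y) * 𝟙 (S' u z))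
    term y z = ≤-trans (≤-reflexive (*-assoc (D u y z) _ _)) (*-monoˡ-≤ (𝟙 (S u y) * 𝟙 (S' u z))
      (≤-trans (*-monoʳ-≤ (𝟙 (live us y z)) (*≤1 (𝟙≤1 (not (thinʸ u y))) (𝟙≤1 (not (thinᶻ u z)))))
               (≤-reflexive (*-identityʳ (𝟙 (live us y z))))))

  W-sum : ∀ u → sum (λ x → W x u) ≡ sum (λ y → sum (λ z → D u y z * e₂₃ y z))
  W-sum u = trans (sum-rotate (λ x y z → τ x y z * D u y z)) (sum-cong (λ y → sum-cong (λ z →
    trans (sum-cong (λ x → *-comm (τ x y z) (D u y z))) (sym (*-distribˡ-sum (D u y z) (λ x → τ x y z))))))

  -- `W x u` depends on `u` only through the set of classes that are thin for `u`. These bits are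
  -- read as functions of `u`, so that `classify profile` splits the vertices `u` into boundedly
  -- many classes.
  profile : List (Fin n → Bool)
  profile = map (λ j u → Y.thin u j) (allFin _) ++ map (λ j u → Z.thin u j) (allFin _)

  length-profile : length profile ≡ 2 ^ length us + 2 ^ length us
  length-profile = trans (length-++ (map (λ j u → Y.thin u j) (allFin _)))
    (cong₂ _+_ (half S (λ j u → Y.thin u j)) (half S' (λ j u → Z.thin u j)))
    where
    half : (f : Fin n → Fin n → Bool) (g : Fin (2 ^ length (map f us)) → Fin n → Bool) →
           length (map g (allFin _)) ≡ 2 ^ length us
    half f g = trans (length-map g (allFin _)) (trans (length-tabulate (λ i → i)) (cong (2 ^_) (length-map f us)))

  W-invariant : ∀ x {u u'} → classify profile u ≡ classify profile u' → W x u ≡ W x u'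
  W-invariant x {u} {u'} eq = sum-cong (λ y → sum-cong (λ z →
    cong₂ (λ a b → τ x y z * (𝟙 (live us y z) * (𝟙 (not a) * 𝟙 (not b)))) (sameʸ (cl y)) (sameᶻ (cl' z))))
    where
    both = All.++⁻ (map (λ j u → Y.thin u j) (allFin _)) (classify-sound profile eq)
    sameʸ : ∀ j → Y.thin u j ≡ Y.thin u' j
    sameʸ j = All.lookup (All.map⁻ (proj₁ both)) (∈-allFin j)
    sameᶻ : ∀ j → Z.thin u j ≡ Z.thin u' j
    sameᶻ j = All.lookup (All.map⁻ (proj₂ both)) (∈-allFin j)

-- Few triples when all degrees are of order at most `√n`

*-cancel-pos : ∀ {a b c} → 1 ≤ a → a * b ≤ a * c → b ≤ c
*-cancel-pos {suc a} _ = *-cancelˡ-≤ (suc a)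

-- `q₁` is the threshold for thin classes and `q₃` the one for heavy pairs; `L` and `L'` are the
-- parameters of the first and second use of `kst`; `q` bounds the number of chosen vertices. The
-- dependence runs backwards: `q` makes `D` small enough for `L`, and `L` makes the heavy pairs rare
-- enough for `L'`.
module LowDegree {n : ℕ} (T : Fin n → Fin n → Fin n → Bool) (girth : Girth6 T) (C s : ℕ)
  (1≤C : 1 ≤ C) (1≤s : 1 ≤ s) (s²≤n : s * s ≤ n) (n≤4s² : n ≤ 4 * (s * s))
  (low : ∀ x → Triples.deg T girth x ≤ C * s)
  (q₁ q₃ L' L q : ℕ) (q₁≡ : q₁ ≡ 64 * (C * C)) (q₃≡ : q₃ ≡ 4 * C * q₁) (L'≡ : L' ≡ 6 * q₃)
  (L≡ : L ≡ 6 * q₃ * (L' * L')) (q≡ : q ≡ q₁ * q₁ * (L * L))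
  (s₁ : 2 * (2 ^ q * L) ≤ s) (s₂ : 2 * (2 ^ (2 ^ q + 2 ^ q) * L') ≤ s)
  (s₃ : 2 * C * q ≤ s) (s₄ : q₁ * C ≤ s) where
  open Triples T girth
  open ≤-Reasoning

  1≤q₁ : 1 ≤ q₁
  1≤q₁ = ≤-trans (*-mono-≤ {1} {64} (s≤s z≤n) (*-mono-≤ 1≤C 1≤C)) (≤-reflexive (sym q₁≡))
  1≤q₃ : 1 ≤ q₃
  1≤q₃ = ≤-trans (*-mono-≤ (*-mono-≤ {1} {4} (s≤s z≤n) 1≤C) 1≤q₁) (≤-reflexive (sym q₃≡))
  1≤L' : 1 ≤ L'
  1≤L' = ≤-trans (*-mono-≤ {1} {6} (s≤s z≤n) 1≤q₃) (≤-reflexive (sym L'≡))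
  1≤L : 1 ≤ L
  1≤L = ≤-trans (*-mono-≤ (*-mono-≤ {1} {6} (s≤s z≤n) 1≤q₃) (*-mono-≤ 1≤L' 1≤L')) (≤-reflexive (sym L≡))

  initial : q * live-measure [] ≤ q * (n * n)
  initial = *-monoʳ-≤ q (≤-reflexive (trans (sum-cong (λ y → trans (sum-const n 1) (*-identityʳ n))) (sum-const n n)))

  chosen = greedy q q [] initial
  us = proj₁ chosen

  us≤q : length us ≤ q
  us≤q = ≤-trans (proj₁ (proj₂ chosen)) (≤-reflexive (+-identityʳ q))

  open Counting T girth us q₁

  D-small : ∀ u → L * L * sum (λ y → sum (λ z → D u y z)) ≤ n * n
  D-small u = begin
    L * L * sum (λ y → sum (λ z → D u y z)) ≤⟨ *-monoʳ-≤ (L * L) (D-measure u) ⟩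
    L * L * (q₁ * q₁ * gain us u)           ≡⟨ id L q₁ (gain us u) ⟩
    q₁ * q₁ * (L * L) * gain us u           ≡⟨ cong (_* gain us u) (sym q≡) ⟩
    q * gain us u                           ≤⟨ proj₂ (proj₂ chosen) u ⟩
    n * n ∎
    where
    id : ∀ L q g → L * L * (q * q * g) ≡ q * q * (L * L) * g
    id = solve-∀

  W-total : ℕ
  W-total = sum (λ u → sum (λ x → W x u))

  W-small : L * W-total ≤ n * (6 * (s * n))
  W-small = ≤-trans (≤-reflexive (*-distribˡ-sum L _)) (sum-≤-const (λ u →
    ≤-trans (≤-reflexive (cong (L *_) (W-sum u)))
      (kst s L 1≤s 1≤L s²≤n n≤4s² classes e₂₃ e₂₃≤1 codeg₂₃≤1 cl (D u) (D≤1 u) (D-invariantˡ u) (D-small u))))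
    where
    classes : 2 * (2 ^ length (map S us) * L) ≤ s
    classes = ≤-trans (*-monoʳ-≤ 2 (*-monoˡ-≤ L (^-monoʳ-≤ 2 (≤-trans (≤-reflexive (length-map S us)) us≤q)))) s₁

  -- The cut at `W x u = s / q₃` is a small fraction of the degree bound `C s`: edges at light pairs
  -- contribute little, and heavy pairs have small measure because `W-total` is small.
  heavy : Fin n → Fin n → Bool
  heavy u x = does (s ≤? q₃ * W x u)

  -- Markov's inequality.
  heavy-count : s * sum (λ u → sum (λ x → 𝟙 (heavy u x))) ≤ q₃ * W-total
  heavy-count = begin
    s * sum (λ u → sum (λ x → 𝟙 (heavy u x)))   ≡⟨ *-distribˡ-sum² s _ ⟩
    sum (λ u → sum (λ x → s * 𝟙 (heavy u x)))   ≤⟨ sum-mono (λ u → sum-mono (λ x → term u x)) ⟩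
    sum (λ u → sum (λ x → q₃ * W x u))          ≡⟨ sym (*-distribˡ-sum² q₃ _) ⟩
    q₃ * W-total ∎
    where
    term : ∀ u x → s * 𝟙 (heavy u x) ≤ q₃ * W x u
    term u x with does-cases (s ≤? q₃ * W x u)
    ... | inj₁ (eq , p) rewrite eq = ≤-trans (≤-reflexive (*-identityʳ s)) p
    ... | inj₂ (eq , _) rewrite eq = ≤-trans (≤-reflexive (*-zeroʳ s)) z≤n

  heavy-small : L' * L' * sum (λ u → sum (λ x → 𝟙 (heavy u x))) ≤ n * n
  -- The origin of `L`: the `6` comes from `kst`, the `q₃` from Markov's inequality, and `L' * L'`
  -- is what the second use of `kst` asks for.
  heavy-small = *-cancel-pos {6 * q₃ * s} (*-mono-≤ (*-mono-≤ {1} {6} (s≤s z≤n) 1≤q₃) 1≤s) (begin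
    6 * q₃ * s * (L' * L' * H)    ≡⟨ id₁ q₃ s L' H ⟩
    6 * q₃ * (L' * L') * (s * H)  ≡⟨ cong (_* (s * H)) (sym L≡) ⟩
    L * (s * H)                   ≤⟨ *-monoʳ-≤ L heavy-count ⟩
    L * (q₃ * W-total)            ≡⟨ id₂ L q₃ W-total ⟩
    q₃ * (L * W-total)            ≤⟨ *-monoʳ-≤ q₃ W-small ⟩
    q₃ * (n * (6 * (s * n)))      ≡⟨ id₃ q₃ n s ⟩
    6 * q₃ * s * (n * n) ∎)
    where
    H = sum (λ u → sum (λ x → 𝟙 (heavy u x)))
    id₁ : ∀ q s L H → 6 * q * s * (L * L * H) ≡ 6 * q * (L * L) * (s * H)
    id₁ = solve-∀
    id₂ : ∀ L q W → L * (q * W) ≡ q * (L * W)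
    id₂ = solve-∀
    id₃ : ∀ q n s → q * (n * (6 * (s * n))) ≡ 6 * q * s * (n * n)
    id₃ = solve-∀

  heavy-edges : ℕ
  heavy-edges = sum (λ u → sum (λ x → 𝟙 (heavy u x) * e₁₂ x u))

  heavy-edges-few : L' * heavy-edges ≤ 6 * (s * n)
  heavy-edges-few = kst s L' 1≤s 1≤L' s²≤n n≤4s² classes (λ u x → e₁₂ x u) (λ u x → e₁₂≤1 x u) codeg₁₂≤1
    (classify profile) (λ u x → 𝟙 (heavy u x)) (λ u x → 𝟙≤1 _)
    (λ x eq → cong (λ w → 𝟙 (does (s ≤? q₃ * w))) (W-invariant x eq)) heavy-small
    where
    classes : 2 * (2 ^ length profile * L') ≤ s
    classes = ≤-trans (*-monoʳ-≤ 2 (*-monoˡ-≤ L' (^-monoʳ-≤ 2 (≤-trans (≤-reflexive length-profile)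
      (+-mono-≤ (^-monoʳ-≤ 2 us≤q) (^-monoʳ-≤ 2 us≤q)))))) s₂

  total≤ : total ≤ n * (C * s)
  total≤ = sum-≤-const low

  -- At a heavy pair `W x u` is bounded by the degree, hence by `C s`; at a light one by `s / q₃`.
  good-split : q₃ * good-pairs ≤ q₃ * (C * s) * heavy-edges + s * total
  good-split = begin
    q₃ * good-pairs ≡⟨ *-distribˡ-sum² q₃ _ ⟩
    sum (λ u → sum (λ x → q₃ * (e₁₂ x u * W x u)))
      ≤⟨ sum-mono (λ u → sum-mono (λ x → term u x)) ⟩
    sum (λ u → sum (λ x → q₃ * (C * s) * (𝟙 (heavy u x) * e₁₂ x u) + s * e₁₂ x u))
      ≡⟨ sum²-distrib-+ _ _ ⟩
    sum (λ u → sum (λ x → q₃ * (C * s) * (𝟙 (heavy u x) * e₁₂ x u))) + sum (λ u → sum (λ x → s * e₁₂ x u))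
      ≡⟨ sym (cong₂ _+_ (*-distribˡ-sum² (q₃ * (C * s)) _) (trans (cong (s *_) (sum-comm e₁₂)) (*-distribˡ-sum² s _))) ⟩
    q₃ * (C * s) * heavy-edges + s * total ∎
    where
    id₁ : ∀ q e c → q * (e * c) ≡ q * c * (1 * e)
    id₁ = solve-∀
    id₂ : ∀ q e w → q * (e * w) ≡ q * w * e
    id₂ = solve-∀
    term : ∀ u x → q₃ * (e₁₂ x u * W x u) ≤ q₃ * (C * s) * (𝟙 (heavy u x) * e₁₂ x u) + s * e₁₂ x u
    term u x with does-cases (s ≤? q₃ * W x u)
    ... | inj₁ (eq , _) rewrite eq = ≤-trans (*-monoʳ-≤ q₃ (*-monoʳ-≤ (e₁₂ x u) (≤-trans (W≤deg x u) (low x))))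
          (≤-trans (≤-reflexive (id₁ q₃ (e₁₂ x u) (C * s))) (m≤m+n _ _))
    ... | inj₂ (_ , ¬p) = ≤-trans (≤-reflexive (id₂ q₃ (e₁₂ x u) (W x u)))
          (≤-trans (*-monoˡ-≤ (e₁₂ x u) (<⇒≤ (≰⇒> ¬p))) (m≤n+m _ _))

  good-few : 2 * (q₁ * good-pairs) ≤ n * n
  good-few = *-cancel-pos {2 * C} (*-mono-≤ {1} {2} (s≤s z≤n) 1≤C) (begin
    2 * C * (2 * (q₁ * good-pairs)) ≡⟨ id₀ C q₁ good-pairs ⟩
    4 * C * q₁ * good-pairs         ≡⟨ cong (_* good-pairs) (sym q₃≡) ⟩
    q₃ * good-pairs                 ≤⟨ *-cancel-pos {6 * q₃} (*-mono-≤ {1} {6} (s≤s z≤n) 1≤q₃) scaled ⟩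
    2 * C * (s * s * n)             ≤⟨ *-monoʳ-≤ (2 * C) (*-monoˡ-≤ n s²≤n) ⟩
    2 * C * (n * n) ∎)
    where
    id₀ : ∀ C q g → 2 * C * (2 * (q * g)) ≡ 4 * C * q * g
    id₀ = solve-∀
    id₁ : ∀ q c h s t L → L * (q * c * h + s * t) ≡ q * c * (L * h) + L * s * t
    id₁ = solve-∀
    id₂ : ∀ q C s n → q * (C * s) * (6 * (s * n)) + 6 * q * s * (n * (C * s)) ≡ 6 * q * (2 * C * (s * s * n))
    id₂ = solve-∀
    -- The choice `L' ≡ 6 * q₃` gives the heavy and the light part the same bound.
    scaled : 6 * q₃ * (q₃ * good-pairs) ≤ 6 * q₃ * (2 * C * (s * s * n))
    scaled = begin
      6 * q₃ * (q₃ * good-pairs) ≡⟨ cong (_* (q₃ * good-pairs)) (sym L'≡) ⟩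
      L' * (q₃ * good-pairs)     ≤⟨ *-monoʳ-≤ L' good-split ⟩
      L' * (q₃ * (C * s) * heavy-edges + s * total) ≡⟨ id₁ q₃ (C * s) heavy-edges s total L' ⟩
      q₃ * (C * s) * (L' * heavy-edges) + L' * s * total
        ≤⟨ +-mono-≤ (*-monoʳ-≤ (q₃ * (C * s)) heavy-edges-few) (*-monoʳ-≤ (L' * s) total≤) ⟩
      q₃ * (C * s) * (6 * (s * n)) + L' * s * (n * (C * s))
        ≡⟨ cong (λ a → q₃ * (C * s) * (6 * (s * n)) + a * s * (n * (C * s))) L'≡ ⟩
      q₃ * (C * s) * (6 * (s * n)) + 6 * q₃ * s * (n * (C * s)) ≡⟨ id₂ q₃ C s n ⟩
      6 * q₃ * (2 * C * (s * s * n)) ∎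

  incidence-total : ℕ
  incidence-total = sum (λ x → deg x * live-deg x)

  live-deg≤deg : ∀ x → live-deg x ≤ deg x
  live-deg≤deg x = sum-mono (λ y → sum-mono (λ z →
    ≤-trans (*-monoʳ-≤ (τ x y z) (𝟙≤1 (live us y z))) (≤-reflexive (*-identityʳ (τ x y z)))))

  incidences-few : q₁ * incidence-total ≤ q₁ * good-pairs + 3 * (n * n)
  incidences-few = begin
    q₁ * incidence-total ≤⟨ incidences ⟩
    q₁ * good-pairs + (n * n + q₁ * total) + n * n
      ≤⟨ +-monoˡ-≤ (n * n) (+-monoʳ-≤ (q₁ * good-pairs) (+-monoʳ-≤ (n * n) q₁-total)) ⟩
    q₁ * good-pairs + (n * n + n * n) + n * n ≡⟨ id (q₁ * good-pairs) (n * n) ⟩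
    q₁ * good-pairs + 3 * (n * n) ∎
    where
    id : ∀ a b → a + (b + b) + b ≡ a + 3 * b
    id = solve-∀
    id' : ∀ q n C s → q * (n * (C * s)) ≡ n * (q * C * s)
    id' = solve-∀
    q₁-total : q₁ * total ≤ n * n
    q₁-total = begin
      q₁ * total           ≤⟨ *-monoʳ-≤ q₁ total≤ ⟩
      q₁ * (n * (C * s))   ≡⟨ id' q₁ n C s ⟩
      n * (q₁ * C * s)     ≤⟨ *-monoʳ-≤ n (≤-trans (*-monoˡ-≤ s s₄) s²≤n) ⟩
      n * n ∎

  -- Cauchy-Schwarz for `live-deg` gives `q₁ * incidence-total ≥ 4 n²`. At most `3 n²` of this is
  -- lost to thin classes and to `u ≡ y`; the remaining `n²` contradicts `good-few`. The `64 C²` in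
  -- `q₁` is `16 (2 C)²`, with `(2 C)²` from squaring `ns≤` and `16` from `4 n² ≤ 16 n s²`.
  contradictory : ¬ (n * s < C * total)
  contradictory many = <-irrefl refl (begin-strict
    q₁ * good-pairs <⟨ m<m+n (q₁ * good-pairs) (≤-trans (*-mono-≤ 1≤n 1≤n) nn≤) ⟩
    q₁ * good-pairs + q₁ * good-pairs ≡⟨ cong (q₁ * good-pairs +_) (sym (+-identityʳ _)) ⟩
    2 * (q₁ * good-pairs) ≤⟨ good-few ⟩
    n * n ≤⟨ nn≤ ⟩
    q₁ * good-pairs ∎)
    where
    1≤n : 1 ≤ n
    1≤n = ≤-trans (*-mono-≤ 1≤s 1≤s) s²≤n
    lt = live-total us
    id₁ : ∀ C x q n → 2 * (C * (x + q * n)) ≡ 2 * C * x + 2 * C * q * n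
    id₁ = solve-∀
    id₂ : ∀ n s → n * s + n * s ≡ 2 * (n * s)
    id₂ = solve-∀
    -- The chosen rectangles cost at most `q n` triples, and by `s₃` the loss `C q n` is at most
    -- `n s / 2`.
    ns≤ : n * s ≤ 2 * C * lt
    ns≤ = +-cancelʳ-≤ (n * s) _ _ (begin
      n * s + n * s ≡⟨ id₂ n s ⟩
      2 * (n * s) ≤⟨ *-monoʳ-≤ 2 (<⇒≤ many) ⟩
      2 * (C * total) ≤⟨ *-monoʳ-≤ 2 (*-monoʳ-≤ C (≤-trans (live-loss us) (+-monoʳ-≤ lt (*-monoˡ-≤ n us≤q)))) ⟩
      2 * (C * (lt + q * n)) ≡⟨ id₁ C lt q n ⟩
      2 * C * lt + 2 * C * q * n ≤⟨ +-monoʳ-≤ (2 * C * lt) (*-monoˡ-≤ n s₃) ⟩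
      2 * C * lt + s * n ≡⟨ cong (2 * C * lt +_) (*-comm s n) ⟩
      2 * C * lt + n * s ∎)
    id₃ : ∀ n s → n * (n * (s * s)) ≡ n * s * (n * s)
    id₃ = solve-∀
    id₄ : ∀ C x → 2 * C * x * (2 * C * x) ≡ 4 * (C * C) * (x * x)
    id₄ = solve-∀
    id₅ : ∀ C n x → 4 * (C * C) * (n * x) ≡ n * (4 * (C * C) * x)
    id₅ = solve-∀
    id₆ : ∀ n s → 4 * (n * (4 * (s * s))) ≡ 16 * (n * (s * s))
    id₆ = solve-∀
    id₇ : ∀ C x → 16 * (4 * (C * C) * x) ≡ 64 * (C * C) * x
    id₇ = solve-∀
    nss≤ : n * (s * s) ≤ 4 * (C * C) * incidence-total
    nss≤ = *-cancel-pos 1≤n (begin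
      n * (n * (s * s)) ≡⟨ id₃ n s ⟩
      n * s * (n * s) ≤⟨ *-mono-≤ ns≤ ns≤ ⟩
      2 * C * lt * (2 * C * lt) ≡⟨ id₄ C lt ⟩
      4 * (C * C) * (lt * lt) ≤⟨ *-monoʳ-≤ (4 * (C * C)) (≤-trans (sum-cauchy-schwarz live-deg)
           (*-monoʳ-≤ n (sum-mono (λ x → *-monoˡ-≤ (live-deg x) (live-deg≤deg x))))) ⟩
      4 * (C * C) * (n * incidence-total) ≡⟨ id₅ C n incidence-total ⟩
      n * (4 * (C * C) * incidence-total) ∎)
    nn≤ : n * n ≤ q₁ * good-pairs
    nn≤ = +-cancelʳ-≤ (3 * (n * n)) _ _ (begin
      4 * (n * n)                 ≤⟨ *-monoʳ-≤ 4 (*-monoʳ-≤ n n≤4s²) ⟩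
      4 * (n * (4 * (s * s)))     ≡⟨ id₆ n s ⟩
      16 * (n * (s * s))          ≤⟨ *-monoʳ-≤ 16 nss≤ ⟩
      16 * (4 * (C * C) * incidence-total) ≡⟨ id₇ C incidence-total ⟩
      64 * (C * C) * incidence-total ≡⟨ cong (_* incidence-total) (sym q₁≡) ⟩
      q₁ * incidence-total        ≤⟨ incidences-few ⟩
      q₁ * good-pairs + 3 * (n * n) ∎)

low-degree-bound : (C : ℕ) → 1 ≤ C → ∃ λ s₀ → (n s : ℕ) → s₀ ≤ s → s * s ≤ n → n ≤ 4 * (s * s) →
  (T : Fin n → Fin n → Fin n → Bool) (girth : Girth6 T) → (∀ x → Triples.deg T girth x ≤ C * s) →
  C * Triples.total T girth ≤ n * s
-- The constants are abstracted one by one, so that these towers are never normalised.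
low-degree-bound C 1≤C with named (64 * (C * C))
  where
  named : (x : ℕ) → ∃ λ y → y ≡ x
  named x = x , refl
... | q₁ , q₁≡ with 4 * C * q₁ in q₃≡
... | q₃ with 6 * q₃ in L'≡
... | L' with 6 * q₃ * (L' * L') in L≡
... | L with q₁ * q₁ * (L * L) in q≡
... | q = a + b + c + d + 1 , λ n s s₀≤s s²≤n n≤4s² T girth low →
  ≮⇒≥ (LowDegree.contradictory T girth C s 1≤C (≤-trans (m≤n+m 1 (a + b + c + d)) s₀≤s) s²≤n n≤4s² low
         q₁ q₃ L' L q q₁≡ (sym q₃≡) (sym L'≡) (sym L≡) (sym q≡)
         (m+n≤o⇒m≤o a (m+n≤o⇒m≤o (a + b) (parts s₀≤s)))
         (m+n≤o⇒n≤o a (m+n≤o⇒m≤o (a + b) (parts s₀≤s)))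
         (m+n≤o⇒n≤o (a + b) (parts s₀≤s))
         (m+n≤o⇒n≤o (a + b + c) (m+n≤o⇒m≤o (a + b + c + d) s₀≤s)))
  where
  a b c d : ℕ
  a = 2 * (2 ^ q * L)
  b = 2 * (2 ^ (2 ^ q + 2 ^ q) * L')
  c = 2 * C * q
  d = q₁ * C
  parts : ∀ {s} → a + b + c + d + 1 ≤ s → a + b + c ≤ s
  parts le = m+n≤o⇒m≤o (a + b + c) (m+n≤o⇒m≤o (a + b + c + d) le)

-- Removing the vertices of high degree

-- All conditions survive when first vertices are dropped; in particular the triple produced by `c5`
-- starts at `x₀`, which is kept.
restrict : {T : Fin n → Fin n → Fin n → Bool} (P : Fin n → Bool) → Girth6 T → Girth6 (λ x y z → P x ∧ T x y z)
restrict {T = T} P girth = record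
  { lin₁₂ = λ {x} p q → G.lin₁₂ (snd (P x) p) (snd (P x) q)
  ; lin₁₃ = λ {x} p q → G.lin₁₃ (snd (P x) p) (snd (P x) q)
  ; lin₂₃ = λ {x} {x'} p q → G.lin₂₃ (snd (P x) p) (snd (P x') q)
  ; c4₁₂  = λ {x} {x'} p q p' q' → G.c4₁₂ (snd (P x) p) (snd (P x) q) (snd (P x') p') (snd (P x') q')
  ; c4₁₃  = λ {x} {x'} p q p' q' → G.c4₁₃ (snd (P x) p) (snd (P x) q) (snd (P x') p') (snd (P x') q')
  ; c4₂₃  = λ {a = a} {b} {c} {d} p q p' q' → G.c4₂₃ (snd (P a) p) (snd (P b) q) (snd (P c) p') (snd (P d) q')
  ; c5    = λ {x₀} {x} {x'} t p q p' q' ne →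
      lift x₀ t (G.c5 (snd (P x₀) t) (snd (P x) p) (snd (P x) q) (snd (P x') p') (snd (P x') q') ne)
  }
  where
  module G = Girth6 girth
  snd : ∀ a {b} → a ∧ b ≡ true → b ≡ true
  snd true p = p
  lift : ∀ x {b u} → P x ∧ b ≡ true → (∃ λ v → T x u v ≡ true) → ∃ λ v → P x ∧ T x u v ≡ true
  lift x p (v , q) with P x
  ... | true = v , q

private
  -- By the second moment `sum-deg²`, vertices of degree above `C s` carry at most
  -- `2 n² / (C s) ≤ 8 n s / C` triples. With `C = 16 c`, the low and the high part each take half
  -- of the bound.
  few-high : (c C : ℕ) → 1 ≤ c → 16 * c ≡ C → (s₀ : ℕ) →
    ((n s : ℕ) → s₀ ≤ s → s * s ≤ n → n ≤ 4 * (s * s) → (T : Fin n → Fin n → Fin n → Bool) (girth : Girth6 T) →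
      (∀ x → Triples.deg T girth x ≤ C * s) → C * Triples.total T girth ≤ n * s) →
    (n s : ℕ) → s₀ + 1 ≤ s → s * s ≤ n → n ≤ 4 * (s * s) →
    (T : Fin n → Fin n → Fin n → Bool) (girth : Girth6 T) → c * Triples.total T girth ≤ n * s
  few-high c C 1≤c C≡ s₀ bound n s s₀≤s s²≤n n≤4s² T girth = *-cancel-pos {2} (s≤s z≤n) (begin
      2 * (c * total)                          ≤⟨ *-monoʳ-≤ 2 (*-monoʳ-≤ c split) ⟩
      2 * (c * (R.total + high))               ≡⟨ id₁ c R.total high ⟩
      2 * c * R.total + 2 * c * high           ≤⟨ +-mono-≤ low-part high-part ⟩
      n * s + n * s                            ≡⟨ cong (n * s +_) (sym (+-identityʳ _)) ⟩
      2 * (n * s) ∎)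
    where
    open ≤-Reasoning
    open Triples T girth
    low : Fin n → Bool
    low x = does (deg x ≤? C * s)
    module R = Triples (λ x y z → low x ∧ T x y z) (restrict low girth)
    high : ℕ
    high = sum (λ x → 𝟙 (not (low x)) * deg x)
    1≤s : 1 ≤ s
    1≤s = ≤-trans (m≤n+m 1 s₀) s₀≤s
    R-deg : ∀ x → R.deg x ≡ 𝟙 (low x) * deg x
    R-deg x = trans (sum-cong (λ y → sum-cong (λ z → 𝟙-∧ (low x) (T x y z)))) (sym (*-distribˡ-sum² (𝟙 (low x)) _))
    R-low : ∀ x → R.deg x ≤ C * s
    R-low x with does-cases (deg x ≤? C * s)
    ... | inj₁ (eq , p) = ≤-trans (≤-reflexive (trans (R-deg x) (trans (cong (λ b → 𝟙 b * deg x) eq) (+-identityʳ _)))) p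
    ... | inj₂ (eq , _) = ≤-trans (≤-reflexive (trans (R-deg x) (cong (λ b → 𝟙 b * deg x) eq))) z≤n
    split : total ≤ R.total + high
    split = ≤-reflexive (trans (sum-cong (λ x → trans (sym (*-identityˡ (deg x))) (trans (cong (_* deg x) (sym (𝟙-not (low x))))
      (trans (*-distribʳ-+ (deg x) (𝟙 (low x)) (𝟙 (not (low x)))) (cong (_+ 𝟙 (not (low x)) * deg x) (sym (R-deg x)))))))
      (sum-distrib-+ R.deg _))
    id₁ : ∀ c a b → 2 * (c * (a + b)) ≡ 2 * c * a + 2 * c * b
    id₁ = solve-∀
    id₂ : ∀ c a → 16 * c * a ≡ 2 * c * a + 14 * (c * a)
    id₂ = solve-∀
    low-part : 2 * c * R.total ≤ n * s
    low-part = ≤-trans (m≤m+n _ (14 * (c * R.total))) (≤-trans (≤-reflexive (trans (sym (id₂ c R.total)) (cong (_* R.total) C≡)))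
      (bound n s (≤-trans (m≤m+n s₀ 1) s₀≤s) s²≤n n≤4s² _ (restrict low girth) R-low))
    high-square : C * s * high ≤ n * n + n * n
    high-square = begin
      C * s * high                                  ≡⟨ *-distribˡ-sum (C * s) _ ⟩
      sum (λ x → C * s * (𝟙 (not (low x)) * deg x)) ≤⟨ sum-mono term ⟩
      sum (λ x → deg x * deg x)                     ≤⟨ sum-deg² ⟩
      n * n + total                                 ≤⟨ +-monoʳ-≤ (n * n) total≤n² ⟩
      n * n + n * n ∎
      where
      term : ∀ x → C * s * (𝟙 (not (low x)) * deg x) ≤ deg x * deg x
      term x with does-cases (deg x ≤? C * s)
      ... | inj₁ (eq , _) rewrite eq = ≤-trans (≤-reflexive (*-zeroʳ (C * s))) z≤n
      ... | inj₂ (eq , p) rewrite eq = ≤-trans (≤-reflexive (cong (C * s *_) (+-identityʳ (deg x))))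
                                               (*-monoˡ-≤ (deg x) (<⇒≤ (≰⇒> p)))
    id₃ : ∀ c s h → 8 * s * (2 * c * h) ≡ 16 * c * s * h
    id₃ = solve-∀
    id₄ : ∀ n s → n * (4 * (s * s)) + n * (4 * (s * s)) ≡ 8 * s * (n * s)
    id₄ = solve-∀
    high-part : 2 * c * high ≤ n * s
    high-part = *-cancel-pos {8 * s} (*-mono-≤ {1} {8} (s≤s z≤n) 1≤s) (begin
      8 * s * (2 * c * high)  ≡⟨ id₃ c s high ⟩
      16 * c * s * high       ≡⟨ cong (λ C → C * s * high) C≡ ⟩
      C * s * high            ≤⟨ high-square ⟩
      n * n + n * n           ≤⟨ +-mono-≤ (*-monoʳ-≤ n n≤4s²) (*-monoʳ-≤ n n≤4s²) ⟩
      n * (4 * (s * s)) + n * (4 * (s * s)) ≡⟨ id₄ n s ⟩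
      8 * s * (n * s) ∎)

triples-few : (c : ℕ) → 1 ≤ c → ∃ λ s₀ → (n s : ℕ) → s₀ ≤ s → s * s ≤ n → n ≤ 4 * (s * s) →
  (T : Fin n → Fin n → Fin n → Bool) (girth : Girth6 T) → c * Triples.total T girth ≤ n * s
triples-few c 1≤c = proj₁ base + 1 , few-high c (16 * c) 1≤c refl (proj₁ base) (proj₂ base)
  where base = low-degree-bound (16 * c) (*-mono-≤ {1} {16} (s≤s z≤n) 1≤c)

-- Cardinality bounds by repetition-free lists

-- "At most `c` elements satisfy `P`", in a form that asks neither for an enumeration nor for
-- decidability of `P`.
Bound : {A : Set} → (A → Set) → ℕ → Set
Bound P c = ∀ L → Unique L → All P L → length L ≤ c

module _ {A : Set} {P : A → Set} where

  Bound-mono : ∀ {Q : A → Set} {c c'} → (∀ {x} → P x → Q x) → c ≤ c' → Bound Q c → Bound P c'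
  Bound-mono P⊆Q c≤c' b L u ps = ≤-trans (b L u (All.map P⊆Q ps)) c≤c'

  -- A bound may be proved in the presence of a witness, which supplies side conditions such as
  -- `d ≤ n` for sets of `d` vertices.
  Bound-inhabited : ∀ {c} → (∃ P → Bound P c) → Bound P c
  Bound-inhabited b []      u ps       = z≤n
  Bound-inhabited b (x ∷ L) u (p ∷ ps) = b (x , p) (x ∷ L) u (p ∷ ps)

  Bound-subsingleton : (∀ {x y} → P x → P y → x ≡ y) → Bound P 1
  Bound-subsingleton eq []          u ps = z≤n
  Bound-subsingleton eq (x ∷ [])    u ps = ≤-refl
  Bound-subsingleton eq (x ∷ y ∷ L) ((x≢y ∷ _) ∷ _) (p ∷ q ∷ _) = contradiction (eq p q) x≢y

  Bound-⊎ : ∀ {Q R : A → Set} {a b} → (∀ {x} → P x → Q x ⊎ R x) → Bound Q a → Bound R b → Bound P (a + b)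
  Bound-⊎ {Q} {R} {a} {b} split bQ bR L u ps with parts L u ps
    where
    parts : ∀ L → Unique L → All P L → ∃ λ L₁ → ∃ λ L₂ → length L ≡ length L₁ + length L₂ ×
      ((∀ {z} → All (z ≢_) L → All (z ≢_) L₁) × Unique L₁ × All Q L₁) ×
      ((∀ {z} → All (z ≢_) L → All (z ≢_) L₂) × Unique L₂ × All R L₂)
    parts [] u ps = [] , [] , refl , ((λ _ → []) , [] , []) , ((λ _ → []) , [] , [])
    parts (x ∷ L) (x∉L ∷ u) (p ∷ ps) with split p | parts L u ps
    ... | inj₁ q | L₁ , L₂ , len , (sub₁ , u₁ , ps₁) , (sub₂ , u₂ , ps₂) =
      x ∷ L₁ , L₂ , cong suc len ,
      ((λ { (z≢x ∷ z∉) → z≢x ∷ sub₁ z∉ }) , sub₁ x∉L ∷ u₁ , q ∷ ps₁) ,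
      ((λ { (_ ∷ z∉) → sub₂ z∉ }) , u₂ , ps₂)
    ... | inj₂ r | L₁ , L₂ , len , (sub₁ , u₁ , ps₁) , (sub₂ , u₂ , ps₂) =
      L₁ , x ∷ L₂ , trans (cong suc len) (sym (+-suc (length L₁) (length L₂))) ,
      ((λ { (_ ∷ z∉) → sub₁ z∉ }) , u₁ , ps₁) ,
      ((λ { (z≢x ∷ z∉) → z≢x ∷ sub₂ z∉ }) , sub₂ x∉L ∷ u₂ , r ∷ ps₂)
  ... | L₁ , L₂ , len , (_ , u₁ , ps₁) , (_ , u₂ , ps₂) =
    subst (_≤ a + b) (sym len) (+-mono-≤ (bQ L₁ u₁ ps₁) (bR L₂ u₂ ps₂))

Bound-∃ : ∀ {A : Set} {k c} {P : A → Set} (R : Fin k → A → Set) → (∀ {x} → P x → ∃ λ j → R j x) →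
          (∀ j → Bound (R j) c) → Bound P (k * c)
Bound-∃ {k = zero} R split b [] u ps = z≤n
Bound-∃ {k = zero} R split b (x ∷ L) u (p ∷ ps) with split p
... | () , _
Bound-∃ {A} {k = suc k} {P = P} R split b = Bound-⊎ head-or-tail (b zero) (Bound-∃ (λ j → R (suc j)) (λ r → r) (λ j → b (suc j)))
  where
  head-or-tail : ∀ {x} → P x → R zero x ⊎ ∃ λ j → R (suc j) x
  head-or-tail p with split p
  ... | zero  , r = inj₁ r
  ... | suc j , r = inj₂ (j , r)

module _ {A B : Set} {P : A → Set} (f : A → B) where

  map-unique : (∀ {x y} → P x → P y → f x ≡ f y → x ≡ y) → ∀ L → Unique L → All P L → Unique (map f L)
  map-unique inj []      u        ps       = []
  map-unique inj (x ∷ L) (x∉ ∷ u) (p ∷ ps) = distinct L x∉ ps ∷ map-unique inj L u ps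
    where
    distinct : ∀ L → All (x ≢_) L → All P L → All (f x ≢_) (map f L)
    distinct []      []        []       = []
    distinct (y ∷ L) (ne ∷ x∉) (q ∷ qs) = (λ eq → ne (inj p q eq)) ∷ distinct L x∉ qs

  Bound-injective : ∀ {Q : B → Set} {c} → (∀ {x} → P x → Q (f x)) → (∀ {x y} → P x → P y → f x ≡ f y → x ≡ y) →
                    Bound Q c → Bound P c
  Bound-injective {c = c} P⇒Q inj b L u ps =
    subst (_≤ c) (length-map f L) (b (map f L) (map-unique inj L u ps) (All.map⁺ (All.map P⇒Q ps)))

  Bound-fibres : ∀ {Q : B → Set} {b c} → DecidableEquality B → (∀ {x} → P x → Q (f x)) → Bound Q b →
                 (∀ y → Q y → Bound (λ x → P x × f x ≡ y) c) → Bound P (b * c)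
  Bound-fibres {Q} {b} {c} _≟_ P⇒Q bQ bF L u ps =
    ≤-trans (over (deduplicate _≟_ (map f L)) (All.deduplicate⁺ _≟_ values) L u (All.tabulate in-values))
            (*-monoˡ-≤ c (bQ _ (DecUnique.deduplicate-! _≟_ (map f L)) (All.deduplicate⁺ _≟_ values)))
    where
    values : All Q (map f L)
    values = All.map⁺ (All.map P⇒Q ps)
    in-values : ∀ {x} → x List.∈ L → P x × f x List.∈ deduplicate _≟_ (map f L)
    in-values x∈L = All.lookup ps x∈L , ∈-deduplicate⁺ _≟_ (∈-map⁺ f x∈L)
    over : ∀ Y → All Q Y → Bound (λ x → P x × f x List.∈ Y) (length Y * c)
    over []      []       = λ { [] _ _ → z≤n ; (x ∷ L) _ ((_ , ()) ∷ _) }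
    over (y ∷ Y) (q ∷ qs) = Bound-⊎ (λ { (p , here eq) → inj₁ (p , eq) ; (p , there e) → inj₂ (p , e) })
                                    (bF y q) (over Y qs)

Bound-Vec : ∀ {A : Set} {P : A → Set} {c} k → DecidableEquality A → Bound P c →
            Bound (λ (v : Vec A k) → ∀ i → P (lookup v i)) (c ^ k)
Bound-Vec zero    _≟_ b = Bound-subsingleton (λ { {[]} {[]} _ _ → refl })
Bound-Vec {A} {P} {c} (suc k) _≟_ b = Bound-fibres (λ { (x ∷ _) → x }) _≟_ (λ { {x ∷ _} p → p zero }) b
  (λ y _ → Bound-injective (λ { (_ ∷ v) → v }) (λ { {x ∷ v} (p , _) i → p (suc i) })
    (λ { {x ∷ v} {x' ∷ v'} (_ , refl) (_ , refl) refl → refl }) (Bound-Vec k _≟_ b))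

-- Subsets as bit vectors

infix 4 _∈ˢ_ _⊆ˢ_
_∈ˢ_ : Fin n → Subset n → Set
v ∈ˢ B = lookup B v ≡ true

_⊆ˢ_ : Subset n → Subset n → Set
I ⊆ˢ B = ∀ {v} → v ∈ˢ I → v ∈ˢ B

lookup-ext : ∀ {A : Set} {xs ys : Vec A n} → (∀ i → lookup xs i ≡ lookup ys i) → xs ≡ ys
lookup-ext {xs = xs} {ys} h =
  trans (sym (Vec.tabulate∘lookup xs)) (trans (Vec.tabulate-cong h) (Vec.tabulate∘lookup ys))

χ : Subset n → Fin n → ℕ
χ B v = 𝟙 (lookup B v)

card : Subset n → ℕ
card B = sum (χ B)

card≤n : (B : Subset n) → card B ≤ n
card≤n {n} B = ≤-trans (sum-≤-const (λ v → 𝟙≤1 _)) (≤-reflexive (*-identityʳ n))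

χ-mono : {I B : Subset n} → I ⊆ˢ B → ∀ v → χ I v ≤ χ B v
χ-mono {I = I} {B} sub v with lookup I v in eq
... | false = z≤n
... | true  rewrite sub eq = ≤-refl

card-mono : {I B : Subset n} → I ⊆ˢ B → card I ≤ card B
card-mono {I = I} {B} sub = sum-mono (χ-mono {I = I} {B} sub)

card-pos : (B : Subset n) → 1 ≤ card B → ∃ λ v → v ∈ˢ B
card-pos B p with sum-pos (χ B) p
... | v , q = v , 𝟙-true q

card≡0 : {B : Subset n} → card B ≡ 0 → ∀ v → lookup B v ≡ false
card≡0 {B = B} eq v with lookup B v in eq'
... | false = refl
... | true  = contradiction (≤-trans (≤-reflexive (cong 𝟙 (sym eq'))) (≤-trans (term≤sum (χ B) v) (≤-reflexive eq))) λ ()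

infixl 6 _∖_
_∖_ : Subset n → Fin n → Subset n
B ∖ v = tabulate (λ w → lookup B w ∧ not (does (v F.≟ w)))

∧⁻ : ∀ {a b} → a ∧ b ≡ true → a ≡ true × b ≡ true
∧⁻ {true} {true} _ = refl , refl

not-does⁻ : ∀ {P : Set} {d : Dec P} → not (does d) ≡ true → ¬ P
not-does⁻ {d = no ¬p} _ = ¬p

not-does⁺ : ∀ {P : Set} {d : Dec P} → ¬ P → not (does d) ≡ true
not-does⁺ {d = no _}  _  = refl
not-does⁺ {d = yes p} ¬p = contradiction p ¬p

module _ {B : Subset n} {v : Fin n} where

  ∈-∖⁻ : ∀ {w} → w ∈ˢ B ∖ v → w ∈ˢ B × v ≢ w
  ∈-∖⁻ {w} p with ∧⁻ (trans (sym (Vec.lookup∘tabulate _ w)) p)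
  ... | a , b = a , not-does⁻ {d = v F.≟ w} b

  ∈-∖⁺ : ∀ {w} → w ∈ˢ B → v ≢ w → w ∈ˢ B ∖ v
  ∈-∖⁺ {w} p ne = trans (Vec.lookup∘tabulate _ w) (cong₂ _∧_ p (not-does⁺ {d = v F.≟ w} ne))

  card-∖ : v ∈ˢ B → card B ≡ suc (card (B ∖ v))
  card-∖ v∈B = trans (sum-cong split) (trans (sum-distrib-+ (λ w → δ v w * 1) (χ (B ∖ v)))
                     (cong (_+ card (B ∖ v)) (sum-δ v (λ _ → 1))))
    where
    split : ∀ w → χ B w ≡ δ v w * 1 + χ (B ∖ v) w
    split w rewrite Vec.lookup∘tabulate (λ w → lookup B w ∧ not (does (v F.≟ w))) w with v F.≟ w
    ... | yes refl rewrite v∈B = refl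
    ... | no _     = cong 𝟙 (sym (Bool.∧-identityʳ (lookup B w)))

∖-injective : {I J : Subset n} {v : Fin n} → v ∈ˢ I → v ∈ˢ J → I ∖ v ≡ J ∖ v → I ≡ J
∖-injective {I = I} {J} {v} v∈I v∈J eq = lookup-ext same
  where
  same : ∀ w → lookup I w ≡ lookup J w
  same w with v F.≟ w | trans (sym (Vec.lookup∘tabulate (λ w → lookup I w ∧ not (does (v F.≟ w))) w))
                       (trans (cong (λ K → lookup K w) eq) (Vec.lookup∘tabulate (λ w → lookup J w ∧ not (does (v F.≟ w))) w))
  ... | yes refl | _ = trans v∈I (sym v∈J)
  ... | no _     | p = trans (sym (Bool.∧-identityʳ _)) (trans p (Bool.∧-identityʳ _))

-- Binomial coefficients and the number of subsets

pascal : ℕ → ℕ → ℕ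
pascal zero    zero    = 1
pascal zero    (suc d) = 0
pascal (suc b) zero    = pascal b zero
pascal (suc b) (suc d) = pascal b (suc d) + pascal b d

pascal-≤-power : ∀ b d → pascal b d ≤ suc b ^ d
pascal-≤-power zero    zero    = ≤-refl
pascal-≤-power zero    (suc d) = z≤n
pascal-≤-power (suc b) zero    = pascal-≤-power b zero
pascal-≤-power (suc b) (suc d) = begin
  pascal b (suc d) + pascal b d        ≤⟨ +-mono-≤ (pascal-≤-power b (suc d)) (pascal-≤-power b d) ⟩
  suc b * suc b ^ d + suc b ^ d        ≡⟨ +-comm (suc b * suc b ^ d) _ ⟩
  suc (suc b) * suc b ^ d              ≤⟨ *-monoʳ-≤ (suc (suc b)) (^-monoˡ-≤ d (n≤1+n (suc b))) ⟩
  suc (suc b) * suc (suc b) ^ d ∎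
  where open ≤-Reasoning

-- For `d ≤ b`, `pascal b d * q ^ (b ∸ d)` is one term of the binomial expansion of `suc q ^ b`;
-- multiplying by `q ^ d` avoids the subtraction.
pascal-weighted : ∀ q b d → pascal b d * q ^ b ≤ q ^ d * suc q ^ b
pascal-weighted q zero    zero    = ≤-refl
pascal-weighted q zero    (suc d) = z≤n
pascal-weighted q (suc b) zero    = begin
  pascal b 0 * (q * q ^ b)          ≡⟨ id (pascal b 0) q (q ^ b) ⟩
  q * (pascal b 0 * q ^ b)          ≤⟨ *-mono-≤ (n≤1+n q) (pascal-weighted q b 0) ⟩
  suc q * (1 * suc q ^ b)           ≡⟨ id' (suc q) (suc q ^ b) ⟩
  1 * (suc q * suc q ^ b) ∎
  where
  open ≤-Reasoning
  id : ∀ p q x → p * (q * x) ≡ q * (p * x)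
  id = solve-∀
  id' : ∀ q x → q * (1 * x) ≡ 1 * (q * x)
  id' = solve-∀
pascal-weighted q (suc b) (suc d) = begin
  (pascal b (suc d) + pascal b d) * (q * q ^ b)
    ≡⟨ id (pascal b (suc d)) (pascal b d) q (q ^ b) ⟩
  q * (pascal b (suc d) * q ^ b) + q * (pascal b d * q ^ b)
    ≤⟨ +-mono-≤ (*-monoʳ-≤ q (pascal-weighted q b (suc d))) (*-monoʳ-≤ q (pascal-weighted q b d)) ⟩
  q * (q * q ^ d * suc q ^ b) + q * (q ^ d * suc q ^ b)
    ≡⟨ id' q (q ^ d) (suc q ^ b) ⟩
  q * q ^ d * (suc q * suc q ^ b) ∎
  where
  open ≤-Reasoning
  id : ∀ p p' q x → (p + p') * (q * x) ≡ q * (p * x) + q * (p' * x)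
  id = solve-∀
  id' : ∀ q x y → q * (q * x * y) + q * (x * y) ≡ q * x * ((1 + q) * y)
  id' = solve-∀

-- Pascal's rule, according to whether a fixed element of `B` is taken.
subsets-bound : ∀ b d (B : Subset n) → card B ≡ b → Bound (λ I → I ⊆ˢ B × card I ≡ d) (pascal b d)
subsets-bound zero zero B eq = Bound-subsingleton (λ { {I} {J} (_ , p) (_ , q) →
  lookup-ext (λ v → trans (card≡0 {B = I} p v) (sym (card≡0 {B = J} q v))) })
subsets-bound zero (suc d) B eq = Bound-inhabited (λ { (I , sub , c) →
  contradiction (≤-trans (≤-reflexive (sym c)) (≤-trans (card-mono {I = I} {B} sub) (≤-reflexive eq))) λ () })
subsets-bound (suc b) d B eq with card-pos B (≤-trans (s≤s z≤n) (≤-reflexive (sym eq)))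
... | v , v∈B = step d
  where
  B'≡ : card (B ∖ v) ≡ b
  B'≡ = suc-injective (trans (sym (card-∖ {B = B} v∈B)) eq)
  avoiding : ∀ d → Bound (λ I → (I ⊆ˢ B × card I ≡ d) × lookup I v ≡ false) (pascal b d)
  avoiding d = Bound-mono (λ { {I} ((sub , c) , v∉I) →
      (λ {w} w∈I → ∈-∖⁺ {B = B} {v} (sub w∈I) (λ { refl → contradiction (trans (sym w∈I) v∉I) λ () })) , c })
    ≤-refl (subsets-bound b d (B ∖ v) B'≡)
  by-v : ∀ {d I} → I ⊆ˢ B × card I ≡ d →
    ((I ⊆ˢ B × card I ≡ d) × lookup I v ≡ false) ⊎ ((I ⊆ˢ B × card I ≡ d) × lookup I v ≡ true)
  by-v {I = I} p with lookup I v
  ... | false = inj₁ (p , refl)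
  ... | true  = inj₂ (p , refl)
  step : ∀ d → Bound (λ I → I ⊆ˢ B × card I ≡ d) (pascal (suc b) d)
  step zero = Bound-mono {Q = λ I → (I ⊆ˢ B × card I ≡ 0) × lookup I v ≡ false}
    (λ { {I} (sub , c) → (sub , c) , card≡0 {B = I} c v }) ≤-refl (avoiding zero)
  step (suc d) = Bound-⊎ (λ {I} → by-v {I = I}) (avoiding (suc d))
    (Bound-injective (_∖ v)
      (λ { {I} ((sub , c) , v∈I) →
        (λ w∈ → ∈-∖⁺ {B = B} {v} (sub (proj₁ (∈-∖⁻ {B = I} {v} w∈))) (proj₂ (∈-∖⁻ {B = I} {v} w∈))) ,
        suc-injective (trans (sym (card-∖ {B = I} v∈I)) c) })
      (λ { {I} {J} (_ , v∈I) (_ , v∈J) → ∖-injective {I = I} {J} {v} v∈I v∈J })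
      (subsets-bound b d (B ∖ v) B'≡))

-- Independent sets by the Kleitman-Winston recursion

Independent : (Fin n → Fin n → Bool) → Subset n → Set
Independent Q I = ∀ {a b} → a ∈ˢ I → b ∈ˢ I → Q a b ≡ false

IndepIn : (Fin n → Fin n → Bool) → Subset n → ℕ → Subset n → Set
IndepIn Q B d I = I ⊆ˢ B × Independent Q I × card I ≡ d

degIn : (Fin n → Fin n → Bool) → Subset n → Fin n → ℕ
degIn Q B v = sum (λ w → χ B w * 𝟙 (Q v w))

private
  infixl 6 _∖N[_]_
  _∖N[_]_ : Subset n → (Fin n → Fin n → Bool) → Fin n → Subset n
  B ∖N[ Q ] v = tabulate (λ w → lookup B w ∧ not (Q v w))

  ∈-∖N⁻ : ∀ {B : Subset n} {Q v w} → w ∈ˢ B ∖N[ Q ] v → w ∈ˢ B × Q v w ≡ false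
  ∈-∖N⁻ {w = w} p with ∧⁻ (trans (sym (Vec.lookup∘tabulate _ w)) p)
  ... | a , b = a , Bool.not-injective b

  ∈-∖N⁺ : ∀ {B : Subset n} {Q v w} → w ∈ˢ B → Q v w ≡ false → w ∈ˢ B ∖N[ Q ] v
  ∈-∖N⁺ {w = w} p q = trans (Vec.lookup∘tabulate _ w) (cong₂ _∧_ p (cong not q))

  card-∖N : (B : Subset n) (Q : Fin n → Fin n → Bool) (v : Fin n) →
            card (B ∖N[ Q ] v) + degIn Q B v ≡ card B
  card-∖N B Q v = trans (sym (sum-distrib-+ (χ (B ∖N[ Q ] v)) (λ w → χ B w * 𝟙 (Q v w)))) (sum-cong split)
    where
    split : ∀ w → χ (B ∖N[ Q ] v) w + χ B w * 𝟙 (Q v w) ≡ χ B w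
    split w rewrite Vec.lookup∘tabulate (λ w → lookup B w ∧ not (Q v w)) w with lookup B w | Q v w
    ... | true  | true  = refl
    ... | true  | false = refl
    ... | false | _     = refl

-- The Kleitman–Winston recursion i(B) ≤ i(B ∖ v) + i(B ∖ v ∖ N(v)), where v has large degree in B as
-- long as B has more than M elements; the second branch shrinks B by the factor β / (1 + β), so it can be
-- taken at most j times before B has at most M elements.
module Containers {n : ℕ} (Q : Fin n → Fin n → Bool) (A : Subset n) (β M w E : ℕ) (1≤w : 1 ≤ w)
  (base : ∀ b d → b ≤ M → pascal b d ≤ w ^ d * E)
  (dense : ∀ B → B ⊆ˢ A → M < card B → ∃ λ v → v ∈ˢ B × card B ≤ suc β * degIn Q B v) where

  -- `b` bounds the steps left and `j` the elements that may still be taken while `B` is large; the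
  -- invariant says that `j` shrinkings bring `B` down to size `M`. The factor `suc b ^ j` accounts
  -- for the steps at which elements are taken.
  independent-bound : ∀ b j B d → B ⊆ˢ A → card B ≤ b → card B * β ^ j ≤ suc β ^ j * M →
                      Bound (IndepIn Q B d) (w ^ d * E * suc b ^ j)
  independent-bound b j B d B⊆A cB inv with M <? card B
  ... | no ¬big = Bound-mono (λ { (sub , _ , c) → sub , c })
          (≤-trans (base (card B) d (≮⇒≥ ¬big)) (≤-trans (≤-reflexive (sym (*-identityʳ _)))
            (*-monoʳ-≤ (w ^ d * E) (≤-trans (≤-reflexive (sym (^-zeroˡ j))) (^-monoˡ-≤ j (s≤s z≤n))))))
          (subsets-bound (card B) d B refl)
  -- With `j` used up the invariant reads `card B ≤ M`.
  independent-bound b zero B d B⊆A cB inv | yes big =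
    contradiction (≤-trans big (subst₂ _≤_ (*-identityʳ (card B)) (*-identityˡ M) inv)) (<-irrefl refl)
  independent-bound zero (suc j) B d B⊆A cB inv | yes big = contradiction (≤-trans big cB) λ ()
  independent-bound (suc b) (suc j) B d B⊆A cB inv | yes big with dense B B⊆A big
  ... | v , v∈B , deg-v = Bound-mono (λ p → p) (total d) (Bound-⊎ (λ {I} → by-v {I}) without (with-v d))
    where
    open ≤-Reasoning
    B₁ = B ∖ v
    B₂ = B ∖ v ∖N[ Q ] v
    ∈B₁ : ∀ {x} → x ∈ˢ B₁ → x ∈ˢ B
    ∈B₁ p = proj₁ (∈-∖⁻ {B = B} {v} p)
    ∈B₂ : ∀ {x} → x ∈ˢ B₂ → x ∈ˢ B
    ∈B₂ {x} p = ∈B₁ (proj₁ (∈-∖N⁻ {B = B₁} {Q} {v} {x} p))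
    B₁≡ : card B ≡ suc (card B₁)
    B₁≡ = card-∖ {B = B} v∈B
    cB₁ : card B₁ ≤ b
    cB₁ = ≤-pred (≤-trans (≤-reflexive (sym B₁≡)) cB)
    cB₂ : card B₂ ≤ b
    cB₂ = ≤-trans (≤-trans (m≤m+n _ _) (≤-reflexive (card-∖N B₁ Q v))) cB₁
    inv₁ : card B₁ * β ^ suc j ≤ suc β ^ suc j * M
    inv₁ = ≤-trans (*-monoˡ-≤ (β ^ suc j) (≤-trans (n≤1+n _) (≤-reflexive (sym B₁≡)))) inv
    B₂≤ : card B₂ + degIn Q B v ≤ card B
    B₂≤ = ≤-trans (+-monoˡ-≤ _ (card-mono {I = B₂} {B ∖N[ Q ] v} (λ {x} p →
            ∈-∖N⁺ {B = B} {Q} {v} {x} (∈B₂ {x} p) (proj₂ (∈-∖N⁻ {B = B₁} {Q} {v} {x} p)))))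
            (≤-reflexive (card-∖N B Q v))
    shrink : suc β * card B₂ ≤ β * card B
    shrink = +-cancelʳ-≤ (card B) _ _ (begin
      suc β * card B₂ + card B                    ≤⟨ +-monoʳ-≤ (suc β * card B₂) deg-v ⟩
      suc β * card B₂ + suc β * degIn Q B v       ≡⟨ sym (*-distribˡ-+ (suc β) (card B₂) _) ⟩
      suc β * (card B₂ + degIn Q B v)             ≤⟨ *-monoʳ-≤ (suc β) B₂≤ ⟩
      suc β * card B                              ≡⟨ +-comm (card B) _ ⟩
      β * card B + card B ∎)
    inv₂ : card B₂ * β ^ j ≤ suc β ^ j * M
    inv₂ = *-cancelˡ-≤ (suc β) (begin
      suc β * (card B₂ * β ^ j) ≡⟨ sym (*-assoc (suc β) (card B₂) _) ⟩
      suc β * card B₂ * β ^ j   ≤⟨ *-monoˡ-≤ (β ^ j) shrink ⟩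
      β * card B * β ^ j        ≡⟨ trans (cong (_* β ^ j) (*-comm β (card B))) (*-assoc (card B) β _) ⟩
      card B * β ^ suc j        ≤⟨ inv ⟩
      suc β ^ suc j * M         ≡⟨ *-assoc (suc β) (suc β ^ j) M ⟩
      suc β * (suc β ^ j * M) ∎)
    by-v : ∀ {I} → IndepIn Q B d I → (IndepIn Q B d I × lookup I v ≡ false) ⊎ (IndepIn Q B d I × lookup I v ≡ true)
    by-v {I} p with lookup I v
    ... | false = inj₁ (p , refl)
    ... | true  = inj₂ (p , refl)
    without : Bound (λ I → IndepIn Q B d I × lookup I v ≡ false) (w ^ d * E * suc b ^ suc j)
    without = Bound-mono (λ { {I} ((sub , ind , c) , v∉I) →
        (λ {x} x∈I → ∈-∖⁺ {B = B} {v} (sub x∈I) (λ { refl → contradiction (trans (sym x∈I) v∉I) λ () })) ,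
        (λ {a} {b} → ind {a} {b}) , c })
      ≤-refl (independent-bound b (suc j) B₁ d (λ p → B⊆A (∈B₁ p)) cB₁ inv₁)
    with-v : ∀ d → Bound (λ I → IndepIn Q B d I × v ∈ˢ I) (w ^ pred d * E * suc b ^ j)
    -- No set of size zero contains `v`; `pred` lets one formula cover this case too.
    with-v zero = Bound-inhabited (λ { (I , (_ , _ , c) , v∈I) →
      contradiction (trans (sym v∈I) (card≡0 {B = I} c v)) λ () })
    with-v (suc d) = Bound-injective (_∖ v)
      (λ { {I} ((sub , ind , c) , v∈I) →
        (λ {x} p → let (x∈I , v≢x) = ∈-∖⁻ {B = I} {v} p in
          ∈-∖N⁺ {B = B₁} {Q} {v} {x} (∈-∖⁺ {B = B} {v} (sub x∈I) v≢x) (ind {v} {x} v∈I x∈I)) ,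
        (λ {a} {b} p q → ind {a} {b} (proj₁ (∈-∖⁻ {B = I} {v} p)) (proj₁ (∈-∖⁻ {B = I} {v} q))) ,
        suc-injective (trans (sym (card-∖ {B = I} v∈I)) c) })
      (λ { {I} {J} (_ , v∈I) (_ , v∈J) → ∖-injective {I = I} {J} {v} v∈I v∈J })
      (independent-bound b j B₂ d (λ {x} p → B⊆A (∈B₂ {x} p)) cB₂ inv₂)
    w^pred : ∀ d → w ^ pred d ≤ w ^ d
    w^pred zero    = ≤-refl
    w^pred (suc d) = ≤-trans (≤-reflexive (sym (*-identityˡ _))) (*-monoˡ-≤ (w ^ d) 1≤w)
    id : ∀ x b s → x * (b * s) + x * s ≡ x * (s + b * s)
    id = solve-∀
    total : ∀ d → w ^ d * E * suc b ^ suc j + w ^ pred d * E * suc b ^ j ≤ w ^ d * E * suc (suc b) ^ suc j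
    total d = begin
      w ^ d * E * (suc b * suc b ^ j) + w ^ pred d * E * suc b ^ j
        ≤⟨ +-monoʳ-≤ (w ^ d * E * (suc b * suc b ^ j)) (*-monoˡ-≤ (suc b ^ j) (*-monoˡ-≤ E (w^pred d))) ⟩
      w ^ d * E * (suc b * suc b ^ j) + w ^ d * E * suc b ^ j
        ≡⟨ id (w ^ d * E) (suc b) (suc b ^ j) ⟩
      w ^ d * E * (suc (suc b) * suc b ^ j)
        ≤⟨ *-monoʳ-≤ (w ^ d * E) (*-monoʳ-≤ (suc (suc b)) (^-monoˡ-≤ j (n≤1+n (suc b)))) ⟩
      w ^ d * E * suc (suc b) ^ suc j ∎

-- `C₄`-free graphs and their squares

Graph : ℕ → Set
Graph n = Vec (Subset n) n

adj : Graph n → Fin n → Fin n → Bool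
adj G a b = lookup (lookup G a) b

record C4Free (G : Graph n) : Set where
  field
    symmetric   : ∀ {a b} → adj G a b ≡ true → adj G b a ≡ true
    irreflexive : ∀ {a b} → adj G a b ≡ true → a ≢ b
    no-C4       : ∀ {a b x y} → adj G a x ≡ true → adj G a y ≡ true → adj G b x ≡ true → adj G b y ≡ true →
                  a ≢ b → x ≡ y

degree : Graph n → Fin n → ℕ
degree G a = card (lookup G a)

-- Joins distinct vertices with a common neighbour. The neighbours of an added vertex must be
-- independent here, since a second common neighbour of two of them would close a four-cycle.
square : Graph n → Fin n → Fin n → Bool
square G a b = not (does (a F.≟ b)) ∧ does (1 ≤? sum (λ w → 𝟙 (adj G w a) * 𝟙 (adj G w b)))

square⁻ : (G : Graph n) → ∀ {a b} → square G a b ≡ true → a ≢ b × ∃ λ w → adj G w a ≡ true × adj G w b ≡ true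
square⁻ G {a} {b} p with a F.≟ b | does-cases (1 ≤? sum (λ w → 𝟙 (adj G w a) * 𝟙 (adj G w b)))
... | no ne | inj₂ (eq , _) = contradiction (trans (sym p) eq) λ ()
... | no ne | inj₁ (_ , q) with sum-pos _ q
...   | w , r with *-pos (𝟙 (adj G w a)) _ r
...     | r₁ , r₂ = ne , w , 𝟙-true r₁ , 𝟙-true r₂

-- Supersaturation, from Cauchy–Schwarz for the numbers of neighbours in B.
module _ (G : Graph n) (C4 : C4Free G) (A : Subset n) (δ₀ M β : ℕ)
  (min-deg : ∀ {a} → a ∈ˢ A → δ₀ ≤ degree G a) (M-large : 2 * n ≤ M * δ₀) (β-large : 2 * n < suc β * (δ₀ * δ₀)) where
  open C4Free C4

  square-dense : ∀ B → B ⊆ˢ A → M < card B → ∃ λ v → v ∈ˢ B × card B ≤ suc β * degIn (square G) B v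
  square-dense B B⊆A big with any? (λ v → (lookup B v Bool.≟ true) ×-dec (card B ≤? suc β * degIn (square G) B v))
  ... | yes found = found
  -- Otherwise `suc β * S ≤ b²`. The sum `D` of the degrees over `B` satisfies `D ≥ δ₀ b` and
  -- `D² ≤ 2 n S`, which contradicts `β-large`.
  ... | no none = ⊥-elim (<-irrefl refl (begin-strict
      2 * n * (b * b)               <⟨ *-monoˡ-< (b * b) {{>-nonZero (*-mono-≤ 1≤b 1≤b)}} β-large ⟩
      suc β * (δ₀ * δ₀) * (b * b)   ≡⟨ id₁ (suc β) δ₀ b ⟩
      suc β * (δ₀ * b * (δ₀ * b))   ≤⟨ *-monoʳ-≤ (suc β) (≤-trans (*-mono-≤ D≥ D≥) D²≤) ⟩
      suc β * (2 * n * S)           ≡⟨ id₂ (suc β) (2 * n) S ⟩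
      2 * n * (suc β * S)           ≤⟨ *-monoʳ-≤ (2 * n) βS ⟩
      2 * n * (b * b) ∎))
    where
    open ≤-Reasoning
    id₁ : ∀ β d b → β * (d * d) * (b * b) ≡ β * (d * b * (d * b))
    id₁ = solve-∀
    id₂ : ∀ β m S → β * (m * S) ≡ m * (β * S)
    id₂ = solve-∀
    b = card B
    1≤b : 1 ≤ b
    1≤b = ≤-trans (s≤s z≤n) big
    f : Fin n → Fin n → ℕ
    f v w = χ B v * 𝟙 (adj G v w)
    D S Σf² : ℕ
    D = sum (λ w → sum (λ v → f v w))
    S = sum (λ v → χ B v * degIn (square G) B v)
    Σf² = sum (λ w → sum (λ v → f v w) * sum (λ v → f v w))
    D≡ : D ≡ sum (λ v → χ B v * degree G v)
    D≡ = trans (sum-comm (λ w v → f v w)) (sum-cong (λ v → sym (*-distribˡ-sum (χ B v) (χ (lookup G v)))))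
    D≥ : δ₀ * b ≤ D
    D≥ = begin
      δ₀ * b                            ≡⟨ *-distribˡ-sum δ₀ (χ B) ⟩
      sum (λ v → δ₀ * χ B v)            ≤⟨ sum-mono term ⟩
      sum (λ v → χ B v * degree G v)    ≡⟨ sym D≡ ⟩
      D ∎
      where
      term : ∀ v → δ₀ * χ B v ≤ χ B v * degree G v
      term v with lookup B v in eq
      ... | true  = ≤-trans (≤-reflexive (*-comm δ₀ 1)) (*-monoʳ-≤ 1 (min-deg (B⊆A eq)))
      ... | false = ≤-reflexive (*-zeroʳ δ₀)
    D≥2n : 2 * n ≤ D
    D≥2n = ≤-trans M-large (≤-trans (*-monoˡ-≤ δ₀ (<⇒≤ big)) (≤-trans (≤-reflexive (*-comm b δ₀)) D≥))
    βS : suc β * S ≤ b * b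
    βS = begin
      suc β * S ≡⟨ *-distribˡ-sum (suc β) _ ⟩
      sum (λ v → suc β * (χ B v * degIn (square G) B v)) ≤⟨ sum-mono term ⟩
      sum (λ v → χ B v * b) ≡⟨ sym (*-distribʳ-sum b (χ B)) ⟩
      b * b ∎
      where
      term : ∀ v → suc β * (χ B v * degIn (square G) B v) ≤ χ B v * b
      term v with lookup B v in eq
      ... | false = ≤-reflexive (*-zeroʳ (suc β))
      ... | true  = subst₂ _≤_ (cong (suc β *_) (sym (*-identityˡ _))) (sym (*-identityˡ _))
                      (<⇒≤ (≰⇒> (λ le → none (v , eq , le))))
    codeg≤1 : ∀ v v' → v ≢ v' → sum (λ w → 𝟙 (adj G w v) * 𝟙 (adj G w v')) ≤ 1
    codeg≤1 v v' ne = sum-≤1 _ (λ w → *-mono-≤ (𝟙≤1 (adj G w v)) (𝟙≤1 (adj G w v'))) uniq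
      where
      uniq : ∀ w w' → 1 ≤ 𝟙 (adj G w v) * 𝟙 (adj G w v') → 1 ≤ 𝟙 (adj G w' v) * 𝟙 (adj G w' v') → w ≡ w'
      uniq w w' p q with *-pos (𝟙 (adj G w v)) _ p | *-pos (𝟙 (adj G w' v)) _ q
      ... | p₁ , p₂ | q₁ , q₂ = no-C4 (symmetric (𝟙-true p₁)) (symmetric (𝟙-true q₁))
                                      (symmetric (𝟙-true p₂)) (symmetric (𝟙-true q₂)) ne
    adj-sym : ∀ a b → 𝟙 (adj G a b) ≡ 𝟙 (adj G b a)
    adj-sym a b with adj G a b in p | adj G b a in q
    ... | true  | true  = refl
    ... | false | false = refl
    ... | true  | false = contradiction (trans (sym (symmetric p)) q) λ ()
    ... | false | true  = contradiction (trans (sym (symmetric q)) p) λ ()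
    pair : ∀ v v' → sum (λ w → f v w * f v' w) ≤ χ B v * (χ B v' * 𝟙 (square G v v')) + δ v v' * sum (f v)
    pair v v' with v F.≟ v'
    ... | yes refl = begin
        sum (λ w → f v w * f v w)  ≤⟨ sum-mono (λ w → *-monoʳ-≤ (f v w) (*-mono-≤ (𝟙≤1 (lookup B v)) (𝟙≤1 (adj G v w)))) ⟩
        sum (λ w → f v w * 1)      ≡⟨ sum-cong (λ w → *-identityʳ (f v w)) ⟩
        sum (f v)                  ≡⟨ sym (*-identityˡ _) ⟩
        1 * sum (f v)              ≤⟨ m≤n+m _ (χ B v * (χ B v * 0)) ⟩
        χ B v * (χ B v * 0) + 1 * sum (f v) ∎
    ... | no ne = begin
        sum (λ w → f v w * f v' w)
          ≡⟨ sum-cong (λ w → trans (id (χ B v) (𝟙 (adj G v w)) (χ B v') (𝟙 (adj G v' w)))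
               (cong (χ B v * χ B v' *_) (cong₂ _*_ (adj-sym v w) (adj-sym v' w)))) ⟩
        sum (λ w → χ B v * χ B v' * (𝟙 (adj G w v) * 𝟙 (adj G w v')))
          ≡⟨ sym (*-distribˡ-sum (χ B v * χ B v') _) ⟩
        χ B v * χ B v' * codeg     ≤⟨ *-monoʳ-≤ (χ B v * χ B v') (≤𝟙-1≤? (codeg≤1 v v' ne)) ⟩
        χ B v * χ B v' * 𝟙 (does (1 ≤? codeg))   ≡⟨ *-assoc (χ B v) (χ B v') _ ⟩
        χ B v * (χ B v' * 𝟙 (does (1 ≤? codeg))) ≤⟨ m≤m+n _ 0 ⟩
        χ B v * (χ B v' * 𝟙 (does (1 ≤? codeg))) + 0 ∎
      where
      codeg = sum (λ w → 𝟙 (adj G w v) * 𝟙 (adj G w v'))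
      id : ∀ a x b y → a * x * (b * y) ≡ a * b * (x * y)
      id = solve-∀
    Σf²≤ : Σf² ≤ S + D
    Σf²≤ = begin
      Σf² ≡⟨ sum-of-squares f ⟩
      sum (λ v → sum (λ v' → sum (λ w → f v w * f v' w)))
        ≤⟨ sum-mono (λ v → sum-mono (λ v' → pair v v')) ⟩
      sum (λ v → sum (λ v' → χ B v * (χ B v' * 𝟙 (square G v v')) + δ v v' * sum (f v)))
        ≡⟨ sum²-distrib-+ (λ v v' → χ B v * (χ B v' * 𝟙 (square G v v'))) (λ v v' → δ v v' * sum (f v)) ⟩
      sum (λ v → sum (λ v' → χ B v * (χ B v' * 𝟙 (square G v v')))) + sum (λ v → sum (λ v' → δ v v' * sum (f v)))
        ≡⟨ cong₂ _+_ (sum-cong (λ v → sym (*-distribˡ-sum (χ B v) _)))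
                     (trans (sum-cong (λ v → sum-δʳ v (λ v → sum (f v)))) (sum-comm f)) ⟩
      S + D ∎
    -- `M-large` gives `D ≥ 2 n`, so the diagonal contribution `2 n D` is absorbed by one of the two
    -- copies of `D²`.
    D²≤ : D * D ≤ 2 * n * S
    D²≤ = +-cancelʳ-≤ (D * D) _ _ (begin
      D * D + D * D               ≡⟨ id₃ (D * D) ⟩
      2 * (D * D)                 ≤⟨ *-monoʳ-≤ 2 (≤-trans (sum-cauchy-schwarz (λ w → sum (λ v → f v w))) (*-monoʳ-≤ n Σf²≤)) ⟩
      2 * (n * (S + D))           ≡⟨ id₄ n S D ⟩
      2 * n * S + 2 * n * D       ≤⟨ +-monoʳ-≤ (2 * n * S) (*-monoˡ-≤ D D≥2n) ⟩
      2 * n * S + D * D ∎)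
      where
      id₃ : ∀ x → x + x ≡ 2 * x
      id₃ = solve-∀
      id₄ : ∀ n S D → 2 * (n * (S + D)) ≡ 2 * n * S + 2 * n * D
      id₄ = solve-∀

-- Elementary estimates for powers

m<[1+m/n]*n : ∀ m n .{{_ : NonZero n}} → m < suc (m / n) * n
m<[1+m/n]*n m n = ≤-trans (s≤s (≤-reflexive (m≡m%n+[m/n]*n m n))) (+-monoˡ-≤ (m / n * n) (m%n<n m n))

1≤2^ : ∀ x → 1 ≤ 2 ^ x
1≤2^ x = m^n>0 2 x

suc-≤-2^ : ∀ x → suc x ≤ 2 ^ x
suc-≤-2^ zero    = ≤-refl
suc-≤-2^ (suc x) = ≤-trans (+-mono-≤ (1≤2^ x) (suc-≤-2^ x)) (≤-reflexive (cong (2 ^ x +_) (sym (+-identityʳ _))))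

2^-cancel-< : ∀ {x y} → 2 ^ x < 2 ^ y → x < y
2^-cancel-< {x} {y} p = ≰⇒> (λ y≤x → <⇒≱ p (^-monoʳ-≤ 2 y≤x))

^-distribʳ-* : ∀ k a b → (a * b) ^ k ≡ a ^ k * b ^ k
^-distribʳ-* zero    a b = refl
^-distribʳ-* (suc k) a b = trans (cong (a * b *_) (^-distribʳ-* k a b)) (id a b (a ^ k) (b ^ k))
  where
  id : ∀ a b x y → a * b * (x * y) ≡ a * x * (b * y)
  id = solve-∀

-- With `y = x / 8` one has `(1 + y)^8 ≤ 2^(8 y) ≤ 2^x`; four of the eight factors dominate the
-- polynomial and the other four the constant.
quartic-≤-2^ : ∀ c → ∃ λ x₀ → ∀ x → x₀ ≤ x → c * suc x ^ 4 ≤ 2 ^ x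
quartic-≤-2^ c = c * 8 ^ 4 * 8 , bound
  where
  open ≤-Reasoning
  bound : ∀ x → c * 8 ^ 4 * 8 ≤ x → c * suc x ^ 4 ≤ 2 ^ x
  bound x big = begin
    c * suc x ^ 4              ≤⟨ *-monoʳ-≤ c (^-monoˡ-≤ 4 suc-x≤) ⟩
    c * (8 * suc y) ^ 4        ≡⟨ cong (c *_) (^-distribʳ-* 4 8 (suc y)) ⟩
    c * (8 ^ 4 * suc y ^ 4)    ≡⟨ sym (*-assoc c (8 ^ 4) (suc y ^ 4)) ⟩
    c * 8 ^ 4 * suc y ^ 4      ≤⟨ *-monoˡ-≤ (suc y ^ 4) (≤-trans (<⇒≤ y-large) suc-y≤) ⟩
    suc y ^ 4 * suc y ^ 4      ≡⟨ sym (^-distribˡ-+-* (suc y) 4 4) ⟩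
    suc y ^ 8                  ≤⟨ ^-monoˡ-≤ 8 (suc-≤-2^ y) ⟩
    (2 ^ y) ^ 8                ≡⟨ ^-*-assoc 2 y 8 ⟩
    2 ^ (y * 8)                ≤⟨ ^-monoʳ-≤ 2 (m/n*n≤m x 8) ⟩
    2 ^ x ∎
    where
    y = x / 8
    suc-x≤ : suc x ≤ 8 * suc y
    suc-x≤ = ≤-trans (m<[1+m/n]*n x 8) (≤-reflexive (*-comm (suc y) 8))
    y-large : c * 8 ^ 4 < suc y
    y-large = *-cancelʳ-< 8 (c * 8 ^ 4) (suc y) (≤-<-trans big (m<[1+m/n]*n x 8))
    suc-y≤ : suc y ≤ suc y ^ 4
    suc-y≤ = ≤-trans (≤-reflexive (sym (^-identityʳ (suc y)))) (^-monoʳ-≤ (suc y) {1} {4} (s≤s z≤n))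

-- A downward search: only the predecessor is known to fail, which is minimality for monotone
-- properties.
least : {P : ℕ → Set} → (∀ x → Dec (P x)) → ∀ x → P x → ∃ λ K → P K × (∀ {K'} → K ≡ suc K' → ¬ P K')
least P? zero    p = zero , p , λ ()
least P? (suc x) p with P? x
... | yes q = least P? x q
... | no ¬q = suc x , p , λ { refl → ¬q }

-- (1 + 1/q)^b ≤ 2 for b ≤ (q + 1)/2, by Bernoulli's inequality for (1 - 1/(q + 1))^b.
bernoulli-below : ∀ q b t → b + t ≡ suc q → suc q ^ b * t ≤ q ^ b * suc q
bernoulli-below q zero    t refl = ≤-refl
bernoulli-below q (suc b) t eq = begin
  suc q * suc q ^ b * t       ≡⟨ id₁ q (suc q ^ b) t ⟩
  suc q ^ b * (q * t + t)     ≤⟨ *-monoʳ-≤ (suc q ^ b) (+-monoʳ-≤ (q * t) t≤q) ⟩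
  suc q ^ b * (q * t + q)     ≡⟨ id₂ q (suc q ^ b) t ⟩
  q * (suc q ^ b * suc t)     ≤⟨ *-monoʳ-≤ q (bernoulli-below q b (suc t) (trans (+-suc b t) eq)) ⟩
  q * (q ^ b * suc q)         ≡⟨ sym (*-assoc q (q ^ b) (suc q)) ⟩
  q * q ^ b * suc q ∎
  where
  open ≤-Reasoning
  t≤q : t ≤ q
  t≤q = ≤-trans (m≤n+m t b) (≤-reflexive (suc-injective eq))
  id₁ : ∀ q x t → (1 + q) * x * t ≡ x * (q * t + t)
  id₁ = solve-∀
  id₂ : ∀ q x t → x * (q * t + q) ≡ q * (x * (1 + t))
  id₂ = solve-∀

power-ratio-2 : ∀ q b → 2 * b ≤ suc q → suc q ^ b ≤ 2 * q ^ b
power-ratio-2 q b 2b≤ with m≤n⇒∃[o]m+o≡n (≤-trans (m≤m+n b (b + 0)) 2b≤)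
... | t , eq = *-cancelʳ-≤ _ _ (suc q) (begin
  suc q ^ b * suc q     ≤⟨ *-monoʳ-≤ (suc q ^ b) q≤2t ⟩
  suc q ^ b * (2 * t)   ≡⟨ id (suc q ^ b) t ⟩
  2 * (suc q ^ b * t)   ≤⟨ *-monoʳ-≤ 2 (bernoulli-below q b t eq) ⟩
  2 * (q ^ b * suc q)   ≡⟨ sym (*-assoc 2 (q ^ b) (suc q)) ⟩
  2 * q ^ b * suc q ∎)
  where
  open ≤-Reasoning
  id : ∀ x t → x * (2 * t) ≡ 2 * (x * t)
  id = solve-∀
  b≤t : b ≤ t
  b≤t = +-cancelˡ-≤ b _ _ (≤-trans (≤-reflexive (cong (b +_) (sym (+-identityʳ b)))) (≤-trans 2b≤ (≤-reflexive (sym eq))))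
  q≤2t : suc q ≤ 2 * t
  q≤2t = ≤-trans (≤-reflexive (sym eq)) (≤-trans (+-monoˡ-≤ t b≤t) (≤-reflexive (cong (t +_) (sym (+-identityʳ t)))))

-- The exponent is cut into `h` blocks of length at most `j`, each costing a factor two.
power-ratio : ∀ q j h b → 2 * j ≤ suc q → b ≤ h * j → suc q ^ b ≤ 2 ^ h * q ^ b
power-ratio q j zero    zero 2j≤ b≤ = ≤-refl
power-ratio q j (suc h) b    2j≤ b≤ with b ≤? j
... | yes b≤j = ≤-trans (power-ratio-2 q b (≤-trans (*-monoʳ-≤ 2 b≤j) 2j≤))
                        (*-monoˡ-≤ (q ^ b) (*-monoʳ-≤ 2 (1≤2^ h)))
... | no b≰j with m≤n⇒∃[o]m+o≡n (<⇒≤ (≰⇒> b≰j))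
...   | b' , refl = begin
  suc q ^ (j + b')                ≡⟨ ^-distribˡ-+-* (suc q) j b' ⟩
  suc q ^ j * suc q ^ b'          ≤⟨ *-mono-≤ (power-ratio-2 q j 2j≤) (power-ratio q j h b' 2j≤ (+-cancelˡ-≤ j _ _ b≤)) ⟩
  2 * q ^ j * (2 ^ h * q ^ b')    ≡⟨ id (q ^ j) (2 ^ h) (q ^ b') ⟩
  2 * 2 ^ h * (q ^ j * q ^ b')    ≡⟨ cong (2 * 2 ^ h *_) (sym (^-distribˡ-+-* q j b')) ⟩
  2 * 2 ^ h * q ^ (j + b') ∎
  where
  open ≤-Reasoning
  id : ∀ x y z → 2 * x * (y * z) ≡ 2 * y * (x * z)
  id = solve-∀

-- Bernoulli's inequality for `(1 + 1/β)^b`, cleared of denominators.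
bernoulli-above : ∀ β b → β ^ b * (β + b) ≤ suc β ^ b * β
bernoulli-above β zero    = ≤-reflexive (cong (1 *_) (+-identityʳ β))
bernoulli-above β (suc b) = begin
  β * β ^ b * (β + suc b)           ≤⟨ m≤m+n _ (β ^ b * b) ⟩
  β * β ^ b * (β + suc b) + β ^ b * b ≡⟨ id β (β ^ b) b ⟩
  suc β * (β ^ b * (β + b))         ≤⟨ *-monoʳ-≤ (suc β) (bernoulli-above β b) ⟩
  suc β * (suc β ^ b * β)           ≡⟨ sym (*-assoc (suc β) (suc β ^ b) β) ⟩
  suc β * suc β ^ b * β ∎
  where
  open ≤-Reasoning
  id : ∀ β x b → β * x * (β + (1 + b)) + x * b ≡ (1 + β) * (x * (β + b))
  id = solve-∀

power-doubles : ∀ β ℓ → 1 ≤ β → 2 ^ ℓ * β ^ (β * ℓ) ≤ suc β ^ (β * ℓ)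
power-doubles β ℓ 1≤β = begin
  2 ^ ℓ * β ^ (β * ℓ)    ≡⟨ cong (2 ^ ℓ *_) (sym (^-*-assoc β β ℓ)) ⟩
  2 ^ ℓ * (β ^ β) ^ ℓ    ≡⟨ sym (^-distribʳ-* ℓ 2 (β ^ β)) ⟩
  (2 * β ^ β) ^ ℓ        ≤⟨ ^-monoˡ-≤ ℓ (*-cancel-pos 1≤β (begin
      β * (2 * β ^ β)       ≡⟨ id β (β ^ β) ⟩
      β ^ β * (β + β)       ≤⟨ bernoulli-above β β ⟩
      suc β ^ β * β         ≡⟨ *-comm (suc β ^ β) β ⟩
      β * suc β ^ β ∎)) ⟩
  (suc β ^ β) ^ ℓ        ≡⟨ ^-*-assoc (suc β) β ℓ ⟩
  suc β ^ (β * ℓ) ∎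
  where
  open ≤-Reasoning
  id : ∀ β x → β * (2 * x) ≡ x * (β + β)
  id = solve-∀

-- The number of possible neighbourhoods of an added vertex

-- h plays the role of ⌊ s / k ⌋.
module Local (k K₀ : ℕ) (1≤k : 1 ≤ k) (1≤K₀ : 1 ≤ K₀)
  (K₀-large : ∀ x → K₀ ≤ x → 48 * (k * k) * suc x ≤ 2 ^ x)
  (n s h ℓ : ℕ) (1≤s : 1 ≤ s) (n≤4s² : n ≤ 4 * (s * s)) (1≤ℓ : 1 ≤ ℓ) (n<2^ℓ : suc n ≤ 2 ^ ℓ)
  (h-floor : ∀ x → k * x ≤ s → x ≤ h) (h-ceil : s ≤ k * suc h)
  (s-large₁ : k * (ℓ * (32 * (ℓ * k * (ℓ * k)) * ℓ)) ≤ s) (s-large₂ : 2 * (ℓ * k) ≤ s) where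
  open ≤-Reasoning

  -- For large `d` the shares of `h` bits pay for the steps at which container elements are taken,
  -- for the choice inside the last container, and for the excess of `1 + K` over `K₀`. Each
  -- neighbour pays `K₀` bits.
  budget : ℕ → ℕ
  budget d = 2 ^ (suc (3 * h)) * 2 ^ (K₀ * d)

  private
    D = ℓ * k
    -- From `s ≤ 2 δ D` follows `2 n ≤ 8 s² ≤ 32 D² δ²`, as `square-dense` requires.
    β = 32 * (D * D)
    -- `β` shrinkings at least halve a set, so `β ℓ` of them exhaust `n < 2^ℓ` vertices.
    J = β * ℓ

    1≤D : 1 ≤ D
    1≤D = *-mono-≤ 1≤ℓ 1≤k
    1≤β : 1 ≤ β
    1≤β = *-mono-≤ {1} {32} (s≤s z≤n) (*-mono-≤ 1≤D 1≤D)

    -- Each chosen element is charged 1 + K bits, with K minimal such that the remaining choice inside a container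
    -- of size M = O(n / d) costs at most 1 + s / k bits; by minimality (1 + K) d ≤ s / k + K₀ d.
    module Dense (G : Graph n) (C4 : C4Free G) (A : Subset n) (δ : ℕ) (2≤δ : 2 ≤ δ)
      (min-deg : ∀ {a} → a ∈ˢ A → suc δ ≤ suc (degree G a)) (d≤n : suc δ ≤ n) (s≤dD : s ≤ suc δ * D) where
      instance
        δ≢0 : NonZero δ
        δ≢0 = >-nonZero (≤-trans (s≤s z≤n) 2≤δ)
        k≢0 : NonZero k
        k≢0 = >-nonZero 1≤k
        s≢0 : NonZero s
        s≢0 = >-nonZero 1≤s
      d M : ℕ
      d = suc δ
      M = suc (2 * n / δ)

      d≤2δ : d ≤ 2 * δ
      d≤2δ = ≤-trans (+-monoˡ-≤ δ (≤-trans (s≤s z≤n) 2≤δ)) (≤-reflexive (cong (δ +_) (sym (+-identityʳ δ))))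

      M-large : 2 * n ≤ M * δ
      M-large = <⇒≤ (m<[1+m/n]*n (2 * n) δ)

      Md≤ : M * d ≤ 24 * (s * s)
      Md≤ = begin
        M * d                       ≤⟨ *-monoʳ-≤ M d≤2δ ⟩
        M * (2 * δ)                 ≡⟨ id₁ (2 * n / δ) δ ⟩
        2 * (δ + 2 * n / δ * δ)     ≤⟨ *-monoʳ-≤ 2 (+-mono-≤ (≤-trans (n≤1+n δ) d≤n) (m/n*n≤m (2 * n) δ)) ⟩
        2 * (n + 2 * n)             ≡⟨ id₂ n ⟩
        6 * n                       ≤⟨ *-monoʳ-≤ 6 n≤4s² ⟩
        6 * (4 * (s * s))           ≡⟨ sym (*-assoc 6 4 (s * s)) ⟩
        24 * (s * s) ∎
        where
        id₁ : ∀ x δ → (1 + x) * (2 * δ) ≡ 2 * (δ + x * δ)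
        id₁ = solve-∀
        id₂ : ∀ n → 2 * (n + 2 * n) ≡ 6 * n
        id₂ = solve-∀

      β-large : 2 * n < suc β * (δ * δ)
      β-large = begin-strict
        2 * n                                   ≤⟨ *-monoʳ-≤ 2 n≤4s² ⟩
        2 * (4 * (s * s))                       ≤⟨ *-monoʳ-≤ 2 (*-monoʳ-≤ 4 (*-mono-≤ s≤2δD s≤2δD)) ⟩
        2 * (4 * (2 * δ * D * (2 * δ * D)))     ≡⟨ id δ D ⟩
        β * (δ * δ)                             <⟨ m<n+m (β * (δ * δ)) (*-mono-≤ 1≤δ 1≤δ) ⟩
        suc β * (δ * δ) ∎
        where
        1≤δ : 1 ≤ δ
        1≤δ = ≤-trans (s≤s z≤n) 2≤δ
        s≤2δD : s ≤ 2 * δ * D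
        s≤2δD = ≤-trans s≤dD (*-monoˡ-≤ D d≤2δ)
        id : ∀ δ D → 2 * (4 * (2 * δ * D * (2 * δ * D))) ≡ 32 * (D * D) * (δ * δ)
        id = solve-∀

      found = least (λ K → M * k ≤? s * 2 ^ K) (M * k)
        (≤-trans (≤-trans (n≤1+n _) (suc-≤-2^ (M * k))) (m≤n*m (2 ^ (M * k)) s))
      K : ℕ
      K = proj₁ found
      K-minimal : ∀ {K'} → K ≡ suc K' → ¬ M * k ≤ s * 2 ^ K'
      K-minimal = proj₂ (proj₂ found)

      M≤ : M ≤ suc h * 2 ^ K
      M≤ = *-cancelʳ-≤ M (suc h * 2 ^ K) k (begin
        M * k               ≤⟨ proj₁ (proj₂ found) ⟩
        s * 2 ^ K           ≤⟨ *-monoˡ-≤ (2 ^ K) h-ceil ⟩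
        k * suc h * 2 ^ K   ≡⟨ trans (*-assoc k (suc h) (2 ^ K)) (*-comm k _) ⟩
        suc h * 2 ^ K * k ∎)

      -- In `pascal-weighted` with `w = 2^(K + 1)`, the factor `(1 + 1/w)^b` is at most `2^(h + 1)`,
      -- because `b ≤ M ≤ (h + 1) 2^K`.
      base : ∀ b d → b ≤ M → pascal b d ≤ (2 ^ suc K) ^ d * 2 ^ suc h
      base b d b≤M = *-cancelʳ-≤ _ _ (w ^ b) {{m^n≢0 w b {{m^n≢0 2 (suc K)}}}} (begin
        pascal b d * w ^ b          ≤⟨ pascal-weighted w b d ⟩
        w ^ d * suc w ^ b           ≤⟨ *-monoʳ-≤ (w ^ d) (power-ratio w (2 ^ K) (suc h) b (n≤1+n w) (≤-trans b≤M M≤)) ⟩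
        w ^ d * (2 ^ suc h * w ^ b) ≡⟨ sym (*-assoc (w ^ d) (2 ^ suc h) (w ^ b)) ⟩
        w ^ d * 2 ^ suc h * w ^ b ∎)
        where w = 2 ^ suc K

      -- For `K ≥ K₀` minimality gives `2^K d ≤ 48 k s`, while `K₀-large` gives
      -- `48 k² (K + 1) ≤ 2^K`; together `k (K + 1) d ≤ s`.
      exponent : suc K * d ≤ h + K₀ * d
      exponent with suc K ≤? K₀
      ... | yes le = ≤-trans (*-monoˡ-≤ d le) (m≤n+m _ h)
      ... | no gt  = ≤-trans (h-floor _ (by-minimality K refl (≤-pred (≰⇒> gt)))) (m≤m+n h _)
        where
        by-minimality : ∀ K' → K ≡ K' → K₀ ≤ K' → k * (suc K' * d) ≤ s
        by-minimality zero     _  K₀≤ = contradiction (≤-trans 1≤K₀ K₀≤) λ ()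
        by-minimality (suc K') eq K₀≤ = *-cancelˡ-≤ (48 * k) {{m*n≢0 48 k}} (begin
          48 * k * (k * (suc (suc K') * d))   ≡⟨ id₁ k (suc (suc K')) d ⟩
          48 * (k * k) * suc (suc K') * d     ≤⟨ *-monoˡ-≤ d (K₀-large (suc K') K₀≤) ⟩
          2 * 2 ^ K' * d                      ≡⟨ *-assoc 2 (2 ^ K') d ⟩
          2 * (2 ^ K' * d)                    ≤⟨ *-monoʳ-≤ 2 halved ⟩
          2 * (24 * k * s)                    ≡⟨ id₂ k s ⟩
          48 * k * s ∎)
          where
          id₁ : ∀ k x d → 48 * k * (k * (x * d)) ≡ 48 * (k * k) * x * d
          id₁ = solve-∀
          id₂ : ∀ k s → 2 * (24 * k * s) ≡ 48 * k * s
          id₂ = solve-∀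
          id₃ : ∀ s k → 24 * (s * s) * k ≡ s * (24 * k * s)
          id₃ = solve-∀
          id₄ : ∀ M k d → M * k * d ≡ M * d * k
          id₄ = solve-∀
          halved : 2 ^ K' * d ≤ 24 * k * s
          halved = *-cancelˡ-≤ s (begin
            s * (2 ^ K' * d)   ≡⟨ sym (*-assoc s (2 ^ K') d) ⟩
            s * 2 ^ K' * d     ≤⟨ *-monoˡ-≤ d (<⇒≤ (≰⇒> (K-minimal eq))) ⟩
            M * k * d          ≡⟨ id₄ M k d ⟩
            M * d * k          ≤⟨ *-monoˡ-≤ k Md≤ ⟩
            24 * (s * s) * k   ≡⟨ id₃ s k ⟩
            s * (24 * k * s) ∎)

      open Containers (square G) A β M (2 ^ suc K) (2 ^ suc h) (1≤2^ (suc K)) base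
        (square-dense G C4 A δ M β (λ p → ≤-pred (min-deg p)) M-large β-large)

      J≤h : ℓ * J ≤ h
      J≤h = h-floor (ℓ * J) s-large₁

      shrunk : card A * β ^ J ≤ suc β ^ J * M
      shrunk = begin
        card A * β ^ J  ≤⟨ *-monoˡ-≤ (β ^ J) (≤-trans (card≤n A) (≤-trans (n≤1+n n) n<2^ℓ)) ⟩
        2 ^ ℓ * β ^ J   ≤⟨ power-doubles β ℓ 1≤β ⟩
        suc β ^ J       ≤⟨ m≤m*n (suc β ^ J) M ⟩
        suc β ^ J * M ∎

      bound : Bound (IndepIn (square G) A d) (budget d)
      bound = Bound-mono (λ p → p) (begin
        (2 ^ suc K) ^ d * 2 ^ suc h * suc n ^ J
          ≡⟨ cong (λ x → x * 2 ^ suc h * suc n ^ J) (^-*-assoc 2 (suc K) d) ⟩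
        2 ^ (suc K * d) * 2 ^ suc h * suc n ^ J
          ≤⟨ *-mono-≤ (*-monoˡ-≤ (2 ^ suc h) (^-monoʳ-≤ 2 exponent)) (^-monoˡ-≤ J n<2^ℓ) ⟩
        2 ^ (h + K₀ * d) * 2 ^ suc h * (2 ^ ℓ) ^ J
          ≡⟨ cong (2 ^ (h + K₀ * d) * 2 ^ suc h *_) (^-*-assoc 2 ℓ J) ⟩
        2 ^ (h + K₀ * d) * 2 ^ suc h * 2 ^ (ℓ * J)
          ≤⟨ *-monoʳ-≤ (2 ^ (h + K₀ * d) * 2 ^ suc h) (^-monoʳ-≤ 2 J≤h) ⟩
        2 ^ (h + K₀ * d) * 2 ^ suc h * 2 ^ h
          ≡⟨ cong (_* 2 ^ h) (sym (^-distribˡ-+-* 2 (h + K₀ * d) (suc h))) ⟩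
        2 ^ (h + K₀ * d + suc h) * 2 ^ h
          ≡⟨ sym (^-distribˡ-+-* 2 (h + K₀ * d + suc h) h) ⟩
        2 ^ (h + K₀ * d + suc h + h)
          ≡⟨ cong (2 ^_) (id h (K₀ * d)) ⟩
        2 ^ (suc (3 * h) + K₀ * d)
          ≡⟨ ^-distribˡ-+-* 2 (suc (3 * h)) (K₀ * d) ⟩
        budget d ∎) (independent-bound n J A d (λ p → p) (card≤n A) shrunk)
        where
        id : ∀ h x → h + x + (1 + h) + h ≡ 1 + 3 * h + x
        id = solve-∀

  -- For `d ≤ s / (ℓ k)`, listing the neighbours costs `ℓ d ≤ h` bits. A larger `d` forces enough
  -- degree in `A` for the containers.
  local-bound : (G : Graph n) → C4Free G → (A : Subset n) (d : ℕ) → (∀ {a} → a ∈ˢ A → d ≤ suc (degree G a)) →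
                Bound (IndepIn (square G) A d) (budget d)
  local-bound G C4 A d min-deg with d * D ≤? s
  ... | yes small = Bound-mono (λ { (sub , _ , c) → sub , c }) (begin
      pascal (card A) d   ≤⟨ pascal-≤-power (card A) d ⟩
      suc (card A) ^ d    ≤⟨ ^-monoˡ-≤ d (≤-trans (s≤s (card≤n A)) n<2^ℓ) ⟩
      (2 ^ ℓ) ^ d         ≡⟨ ^-*-assoc 2 ℓ d ⟩
      2 ^ (ℓ * d)         ≤⟨ ^-monoʳ-≤ 2 (h-floor (ℓ * d) (≤-trans (≤-reflexive (id k ℓ d)) small)) ⟩
      2 ^ h               ≤⟨ ^-monoʳ-≤ 2 (≤-trans (m≤m+n h (2 * h)) (n≤1+n _)) ⟩
      2 ^ suc (3 * h)     ≤⟨ m≤m*n _ (2 ^ (K₀ * d)) {{>-nonZero (1≤2^ (K₀ * d))}} ⟩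
      budget d ∎) (subsets-bound (card A) d A refl)
    where
    id : ∀ k ℓ d → k * (ℓ * d) ≡ d * (ℓ * k)
    id = solve-∀
  ... | no large = Bound-inhabited (λ { (I , sub , _ , c) →
      dense d refl (≤-trans (≤-reflexive (sym c)) (card≤n I)) })
    where
    s<dD : s < d * D
    s<dD = ≰⇒> large
    3≤d : 2 < d
    3≤d = *-cancelʳ-< D 2 d (≤-<-trans s-large₂ s<dD)
    dense : ∀ d' → d ≡ d' → d' ≤ n → Bound (IndepIn (square G) A d') (budget d')
    dense zero     eq d≤n = contradiction (≤-trans 3≤d (≤-reflexive eq)) λ ()
    dense (suc δ') eq d≤n = Dense.bound G C4 A δ' (≤-pred (≤-trans 3≤d (≤-reflexive eq)))
      (λ p → ≤-trans (≤-reflexive (sym eq)) (min-deg p)) d≤n (≤-trans (<⇒≤ s<dD) (≤-reflexive (cong (_* D) eq)))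

-- Deleting and restoring a vertex

infixl 6 _∖∖_
-- Deletion isolates `v` but keeps the index set, so that all graphs have the same type.
_∖∖_ : Graph n → Fin n → Graph n
G ∖∖ v = tabulate (λ a → tabulate (λ b → adj G a b ∧ (not (does (v F.≟ a)) ∧ not (does (v F.≟ b)))))

edge-sum : Graph n → ℕ
edge-sum G = sum (degree G)

module _ (G : Graph n) (v : Fin n) where

  adj-∖∖ : ∀ a b → adj (G ∖∖ v) a b ≡ adj G a b ∧ (not (does (v F.≟ a)) ∧ not (does (v F.≟ b)))
  adj-∖∖ a b = trans (cong (λ r → lookup r b) (Vec.lookup∘tabulate _ a)) (Vec.lookup∘tabulate _ b)

  ∖∖⁻ : ∀ {a b} → adj (G ∖∖ v) a b ≡ true → adj G a b ≡ true × v ≢ a × v ≢ b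
  ∖∖⁻ {a} {b} p with ∧⁻ (trans (sym (adj-∖∖ a b)) p)
  ... | q , r with ∧⁻ r
  ...   | r₁ , r₂ = q , not-does⁻ {d = v F.≟ a} r₁ , not-does⁻ {d = v F.≟ b} r₂

  adj-∖∖-off : ∀ {a b} → v ≢ a → v ≢ b → adj (G ∖∖ v) a b ≡ adj G a b
  adj-∖∖-off {a} {b} na nb = trans (adj-∖∖ a b)
    (trans (cong₂ (λ x y → adj G a b ∧ (x ∧ y)) (not-does⁺ {d = v F.≟ a} na) (not-does⁺ {d = v F.≟ b} nb))
           (Bool.∧-identityʳ _))

  ∖∖-C4Free : C4Free G → C4Free (G ∖∖ v)
  ∖∖-C4Free C4 = record
    { symmetric   = λ p → let (q , na , nb) = ∖∖⁻ p in trans (adj-∖∖-off nb na) (symmetric q)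
    ; irreflexive = λ p → irreflexive (proj₁ (∖∖⁻ p))
    ; no-C4       = λ p q r s → no-C4 (proj₁ (∖∖⁻ p)) (proj₁ (∖∖⁻ q)) (proj₁ (∖∖⁻ r)) (proj₁ (∖∖⁻ s))
    }
    where open C4Free C4

  degree-∖∖ : ∀ {x} → v ≢ x → degree G x ≤ suc (degree (G ∖∖ v) x)
  degree-∖∖ {x} nx = begin
    degree G x ≤⟨ sum-mono term ⟩
    sum (λ w → δ v w * 1 + χ (lookup (G ∖∖ v) x) w)
      ≡⟨ trans (sum-distrib-+ (λ w → δ v w * 1) (χ (lookup (G ∖∖ v) x)))
               (cong (_+ degree (G ∖∖ v) x) (sum-δ v (λ _ → 1))) ⟩
    suc (degree (G ∖∖ v) x) ∎
    where
    open ≤-Reasoning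
    term : ∀ w → χ (lookup G x) w ≤ δ v w * 1 + χ (lookup (G ∖∖ v) x) w
    term w with v F.≟ w
    ... | yes _ = ≤-trans (𝟙≤1 (adj G x w)) (m≤m+n 1 _)
    ... | no nw = ≤-reflexive (cong 𝟙 (sym (adj-∖∖-off nx nw)))

  edge-sum-∖∖ : edge-sum (G ∖∖ v) + degree G v ≤ edge-sum G
  edge-sum-∖∖ = begin
    edge-sum (G ∖∖ v) + degree G v
      ≡⟨ cong (edge-sum (G ∖∖ v) +_) (sym (sum-δ v (degree G))) ⟩
    edge-sum (G ∖∖ v) + sum (λ x → δ v x * degree G x)
      ≡⟨ sym (sum-distrib-+ (degree (G ∖∖ v)) (λ x → δ v x * degree G x)) ⟩
    sum (λ x → degree (G ∖∖ v) x + δ v x * degree G x)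
      ≤⟨ sum-mono term ⟩
    edge-sum G ∎
    where
    open ≤-Reasoning
    sub : ∀ x → degree (G ∖∖ v) x ≤ degree G x
    sub x = card-mono {I = lookup (G ∖∖ v) x} {lookup G x} (λ p → proj₁ (∖∖⁻ p))
    term : ∀ x → degree (G ∖∖ v) x + δ v x * degree G x ≤ degree G x
    term x with v F.≟ x
    ... | no _     = ≤-trans (≤-reflexive (+-identityʳ _)) (sub x)
    ... | yes refl = ≤-trans (+-monoˡ-≤ (1 * degree G v) (≤-reflexive row≡0)) (≤-reflexive (*-identityˡ _))
      where
      row≡0 : degree (G ∖∖ v) v ≡ 0
      row≡0 = sum-zero (λ w → cong 𝟙 (Bool.¬-not (λ p → proj₁ (proj₂ (∖∖⁻ p)) refl)))

adj-sym : {G : Graph n} → C4Free G → ∀ a b → adj G a b ≡ adj G b a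
adj-sym {G = G} C4 a b with adj G a b in p | adj G b a in q
... | true  | true  = refl
... | false | false = refl
... | true  | false = trans (sym (C4Free.symmetric C4 p)) q
... | false | true  = trans (sym p) (C4Free.symmetric C4 q)

-- Row `v` also gives column `v`, by symmetry.
∖∖-injective : {G H : Graph n} {v : Fin n} → C4Free G → C4Free H → G ∖∖ v ≡ H ∖∖ v → lookup G v ≡ lookup H v → G ≡ H
∖∖-injective {G = G} {H} {v} C4G C4H eq row = lookup-ext (λ a → lookup-ext (same a))
  where
  same : ∀ a b → adj G a b ≡ adj H a b
  same a b with v F.≟ a | v F.≟ b
  ... | yes refl | _        = cong (λ r → lookup r b) row
  ... | no _     | yes refl = trans (adj-sym {G = G} C4G a v) (trans (cong (λ r → lookup r a) row) (adj-sym {G = H} C4H v a))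
  ... | no na    | no nb    = trans (sym (adj-∖∖-off G v na nb)) (trans (cong (λ K → adj K a b) eq) (adj-∖∖-off H v na nb))

-- A graph is rebuilt by adding vertices in the reverse of an order of successive deletions of a vertex of
-- minimum degree; the neighbourhood of the added vertex is independent in the square of the smaller graph.
module Rebuild (n Y K₀ : ℕ)
  (local : (G : Graph n) → C4Free G → (A : Subset n) (d : ℕ) → (∀ {a} → a ∈ˢ A → d ≤ suc (degree G a)) →
           Bound (IndepIn (square G) A d) (Y * 2 ^ (K₀ * d))) where

  -- The set `A` records which vertices are still present; the graph alone cannot tell a deleted
  -- vertex from an isolated one.
  record Supported (a E : ℕ) (p : Subset n × Graph n) : Set where
    field
      size     : card (proj₁ p) ≡ a
      c4-free  : C4Free (proj₂ p)
      support  : ∀ {x y} → adj (proj₂ p) x y ≡ true → x ∈ˢ proj₁ p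
      edges≤   : edge-sum (proj₂ p) ≤ E

  -- Choices per vertex: `n` for the vertex, `suc n` for its degree, and `Y` for the part of the
  -- neighbourhood count not charged to edges.
  X : ℕ
  X = n * (suc n * Y)

  private
    record Minimal (a E : ℕ) (v : Fin n) (d : Fin (suc n)) (p : Subset n × Graph n) : Set where
      field
        supported : Supported (suc a) E p
        v∈A       : v ∈ˢ proj₁ p
        deg-v     : degree (proj₂ p) v ≡ toℕ d
        minimum   : ∀ {x} → x ∈ˢ proj₁ p → toℕ d ≤ degree (proj₂ p) x
      open Supported supported public

    choose : ∀ {a E p} → Supported (suc a) E p → ∃ λ v → ∃ λ d → Minimal a E v d p
    choose {a} {E} {A , G} sup = by-least (least small? n (let (v , v∈A) = nonempty in v , v∈A , card≤n (lookup G v)))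
      where
      nonempty : ∃ λ v → v ∈ˢ A
      nonempty = card-pos A (≤-trans (s≤s z≤n) (≤-reflexive (sym (Supported.size sup))))
      Small : ℕ → Set
      Small D = ∃ λ v → v ∈ˢ A × degree G v ≤ D
      small? : ∀ D → Dec (Small D)
      small? D = any? (λ v → (lookup A v Bool.≟ true) ×-dec (degree G v ≤? D))
      by-least : (∃ λ D → Small D × (∀ {D'} → D ≡ suc D' → ¬ Small D')) → ∃ λ v → ∃ λ d → Minimal a E v d (A , G)
      by-least (D , (v , v∈A , le) , minimal) = v , fromℕ< (s≤s (card≤n (lookup G v))) , record
        { supported = sup
        ; v∈A = v∈A
        ; deg-v = sym (F.toℕ-fromℕ< _)
        ; minimum = λ {x} x∈A → ≤-trans (≤-reflexive (F.toℕ-fromℕ< _)) (≤-trans le (at-least D refl x x∈A))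
        }
        where
        at-least : ∀ D' → D ≡ D' → ∀ x → x ∈ˢ A → D' ≤ degree G x
        at-least zero     _  x _   = z≤n
        at-least (suc D') eq x x∈A = ≰⇒> (λ le → minimal eq (x , x∈A , le))

    _≟ᵖ_ : DecidableEquality (Subset n × Graph n)
    _≟ᵖ_ = Prod.≡-dec (Vec.≡-dec Bool._≟_) (Vec.≡-dec (Vec.≡-dec Bool._≟_))

  rebuild : ∀ a E → Bound (Supported a E) (X ^ a * 2 ^ (K₀ * E))
  rebuild zero E = Bound-mono (λ p → p) (≤-trans (1≤2^ (K₀ * E)) (≤-reflexive (sym (*-identityˡ _))))
    (Bound-subsingleton (λ { {A , G} {B , H} p q → cong₂ _,_
      (lookup-ext (λ v → trans (empty p v) (sym (empty q v))))
      (lookup-ext (λ x → lookup-ext (λ y → trans (edgeless p x y) (sym (edgeless q x y))))) }))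
    where
    empty : ∀ {A G} → Supported 0 E (A , G) → ∀ v → lookup A v ≡ false
    empty {A} p = card≡0 {B = A} (Supported.size p)
    edgeless : ∀ {A G} → Supported 0 E (A , G) → ∀ x y → adj G x y ≡ false
    edgeless p x y = Bool.¬-not (λ e → contradiction (trans (sym (Supported.support p e)) (empty p x)) λ ())
  rebuild (suc a) E = Bound-mono (λ p → p) (≤-reflexive total)
    (Bound-∃ (λ v p → ∃ λ d → Minimal a E v d p) choose
      (λ v → Bound-∃ (λ d p → Minimal a E v d p) (λ m → m) (λ d → extend v d)))
    where
    total : n * (suc n * (X ^ a * Y * 2 ^ (K₀ * E))) ≡ X ^ suc a * 2 ^ (K₀ * E)
    total = id n (X ^ a) Y (2 ^ (K₀ * E))
      where
      id : ∀ n x y z → n * ((1 + n) * (x * y * z)) ≡ n * ((1 + n) * y) * x * z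
      id = solve-∀
    extend : ∀ v d → Bound (Minimal a E v d) (X ^ a * Y * 2 ^ (K₀ * E))
    -- A witness shows `d ≤ E`, so the truncated subtraction `E ∸ toℕ d` is exact and the powers of
    -- two recombine.
    extend v d = Bound-inhabited (λ { (p , m) → Bound-mono (λ q → q) (≤-reflexive (product (d≤E m)))
      (Bound-fibres (λ (A , G) → A ∖ v , G ∖∖ v) _≟ᵖ_ smaller
        (Bound-mono {Q = Supported a (E ∸ toℕ d)} proj₁ ≤-refl (rebuild a (E ∸ toℕ d))) fibre) })
      where
      open ≤-Reasoning
      d≤E : ∀ {p} → Minimal a E v d p → toℕ d ≤ E
      d≤E {A , G} m = ≤-trans (≤-reflexive (sym (Minimal.deg-v m))) (≤-trans (term≤sum (degree G) v) (Minimal.edges≤ m))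
      product : toℕ d ≤ E → X ^ a * 2 ^ (K₀ * (E ∸ toℕ d)) * (Y * 2 ^ (K₀ * toℕ d)) ≡ X ^ a * Y * 2 ^ (K₀ * E)
      product le = trans (id (X ^ a) (2 ^ (K₀ * (E ∸ toℕ d))) Y (2 ^ (K₀ * toℕ d))) (cong (X ^ a * Y *_)
        (trans (sym (^-distribˡ-+-* 2 (K₀ * (E ∸ toℕ d)) (K₀ * toℕ d)))
          (cong (2 ^_) (trans (sym (*-distribˡ-+ K₀ (E ∸ toℕ d) (toℕ d))) (cong (K₀ *_) (m∸n+n≡m le))))))
        where
        id : ∀ x e y f → x * e * (y * f) ≡ x * y * (e * f)
        id = solve-∀
      Smaller : Subset n × Graph n → Set
      Smaller p = Supported a (E ∸ toℕ d) p × (∀ {x} → x ∈ˢ proj₁ p → toℕ d ≤ suc (degree (proj₂ p) x))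
      smaller : ∀ {p} → Minimal a E v d p → Smaller (proj₁ p ∖ v , proj₂ p ∖∖ v)
      smaller {A , G} m = record
          { size = suc-injective (trans (sym (card-∖ {B = A} (Minimal.v∈A m))) (Minimal.size m))
          ; c4-free = ∖∖-C4Free G v (Minimal.c4-free m)
          ; support = λ p → let (q , nx , _) = ∖∖⁻ G v p in ∈-∖⁺ {B = A} {v} (Minimal.support m q) nx
          ; edges≤ = +-cancelʳ-≤ (toℕ d) _ _ (begin
              edge-sum (G ∖∖ v) + toℕ d      ≡⟨ cong (edge-sum (G ∖∖ v) +_) (sym (Minimal.deg-v m)) ⟩
              edge-sum (G ∖∖ v) + degree G v ≤⟨ edge-sum-∖∖ G v ⟩
              edge-sum G                     ≤⟨ Minimal.edges≤ m ⟩
              E                              ≡⟨ sym (m∸n+n≡m (d≤E m)) ⟩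
              E ∸ toℕ d + toℕ d ∎)
          } , λ x∈ → let (x∈A , v≢x) = ∈-∖⁻ {B = A} {v} x∈ in
                ≤-trans (Minimal.minimum m x∈A) (degree-∖∖ G v v≢x)
      -- A graph in the fibre is determined by its row at `v`, and `local` counts these rows. Its
      -- minimum degree condition allows for the one edge to `v` that each vertex may have lost.
      fibre : ∀ y → Smaller y → Bound (λ p → Minimal a E v d p × (proj₁ p ∖ v , proj₂ p ∖∖ v) ≡ y) (Y * 2 ^ (K₀ * toℕ d))
      fibre (A' , G') (sup' , min') = Bound-injective (λ p → lookup (proj₂ p) v)
        (λ { {A , G} (m , refl) →
          (λ {w} p → ∈-∖⁺ {B = A} {v} (Minimal.support m (C4Free.symmetric (Minimal.c4-free m) p))
                       (C4Free.irreflexive (Minimal.c4-free m) p)) ,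
          (λ {x} {y} p q → Bool.¬-not (λ sq → independent m p q (square⁻ (G ∖∖ v) sq))) ,
          Minimal.deg-v m })
        (λ { {A , G} {B , H} (m , refl) (m' , eq) row → cong₂ _,_
          (∖-injective {I = A} {B} {v} (Minimal.v∈A m) (Minimal.v∈A m') (sym (cong proj₁ eq)))
          (∖∖-injective {G = G} {H} {v} (Minimal.c4-free m) (Minimal.c4-free m') (sym (cong proj₂ eq)) row) })
        (local G' (Supported.c4-free sup') A' (toℕ d) min')
        where
        independent : ∀ {A G x y} → Minimal a E v d (A , G) → adj G v x ≡ true → adj G v y ≡ true →
          ¬ (x ≢ y × ∃ λ w → adj (G ∖∖ v) w x ≡ true × adj (G ∖∖ v) w y ≡ true)
        independent {G = G} m p q (x≢y , w , r , s) = x≢y (C4Free.no-C4 (Minimal.c4-free m) p q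
          (proj₁ (∖∖⁻ G v r)) (proj₁ (∖∖⁻ G v s)) (proj₁ (proj₂ (∖∖⁻ G v r))))

  c4-free-bound : ∀ E → Bound (λ G → C4Free G × edge-sum G ≤ E) (X ^ n * 2 ^ (K₀ * E))
  c4-free-bound E = Bound-injective (λ G → tabulate (λ _ → true) , G)
    (λ (C4 , le) → record
      { size = trans (sum-cong {n} (λ v → cong 𝟙 (Vec.lookup∘tabulate (λ _ → true) v))) (trans (sum-const n 1) (*-identityʳ n))
      ; c4-free = C4 ; support = λ {x} _ → Vec.lookup∘tabulate _ x ; edges≤ = le })
    (λ _ _ → cong proj₂) (rebuild n E)

-- The logarithmic scale and the count of `C₄`-free graphs

private
  -- If `2^x ≤ s < 2^(x + 1)`, then `ℓ = 2 (x + 2)` satisfies `2^ℓ ≥ 4 (s + 1)² > n`, and a fixed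
  -- multiple of `ℓ⁴` stays below `s`. The constant is `2 * 32 * k³`, times `16` from
  -- `ℓ⁴ = 16 (x + 2)⁴`.
  log-scale-from : ∀ k C x₀ → 1 ≤ k → 64 * (k * k * k) * 16 ≡ C → (∀ x → x₀ ≤ x → C * suc x ^ 4 ≤ 2 ^ x) →
    ∀ n s → 2 ^ x₀ ≤ s → n ≤ 4 * (s * s) → ∃ λ ℓ → 1 ≤ ℓ × suc n ≤ 2 ^ ℓ ×
    k * (ℓ * (32 * (ℓ * k * (ℓ * k)) * ℓ)) ≤ s × 2 * (ℓ * k) ≤ s
  log-scale-from k C x₀ 1≤k C≡ large n s s₀≤s n≤4s² with least (λ x → suc s ≤? 2 ^ x) s (suc-≤-2^ s)
  ... | zero  , s≤s s≤0 , _ = contradiction (≤-trans (≤-trans (1≤2^ x₀) s₀≤s) s≤0) λ ()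
  ... | suc x , s<2^x , minimal = ℓ , s≤s z≤n , n<2^ℓ , quartic , ≤-trans linear≤quartic quartic
    where
    open ≤-Reasoning
    ℓ = suc (suc x) + suc (suc x)
    2^x≤s : 2 ^ x ≤ s
    2^x≤s = ≤-pred (≰⇒> (minimal refl))
    x₀≤x : x₀ ≤ suc x
    x₀≤x = <⇒≤ (2^-cancel-< (≤-trans (s≤s s₀≤s) s<2^x))
    n<2^ℓ : suc n ≤ 2 ^ ℓ
    n<2^ℓ = begin
      suc n                             ≤⟨ s≤s n≤4s² ⟩
      suc (4 * (s * s))                 ≤⟨ m≤m+n _ (8 * s + 3) ⟩
      suc (4 * (s * s)) + (8 * s + 3)   ≡⟨ id s ⟩
      2 * suc s * (2 * suc s)           ≤⟨ *-mono-≤ (*-monoʳ-≤ 2 s<2^x) (*-monoʳ-≤ 2 s<2^x) ⟩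
      2 ^ suc (suc x) * 2 ^ suc (suc x) ≡⟨ sym (^-distribˡ-+-* 2 (suc (suc x)) (suc (suc x))) ⟩
      2 ^ ℓ ∎
      where
      id : ∀ s → 1 + 4 * (s * s) + (8 * s + 3) ≡ 2 * (1 + s) * (2 * (1 + s))
      id = solve-∀
    quartic : k * (ℓ * (32 * (ℓ * k * (ℓ * k)) * ℓ)) ≤ s
    quartic = *-cancelˡ-≤ 2 (begin
      2 * (k * (ℓ * (32 * (ℓ * k * (ℓ * k)) * ℓ)))    ≡⟨ id₁ k ℓ ⟩
      64 * (k * k * k) * (ℓ * ℓ * (ℓ * ℓ))            ≡⟨ id₂ (64 * (k * k * k)) (suc (suc x)) ⟩
      64 * (k * k * k) * 16 * suc (suc x) ^ 4         ≡⟨ cong (_* suc (suc x) ^ 4) C≡ ⟩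
      C * suc (suc x) ^ 4                             ≤⟨ large (suc x) x₀≤x ⟩
      2 * 2 ^ x                                       ≤⟨ *-monoʳ-≤ 2 2^x≤s ⟩
      2 * s ∎)
      where
      id₁ : ∀ k y → 2 * (k * (y * (32 * (y * k * (y * k)) * y))) ≡ 64 * (k * k * k) * (y * y * (y * y))
      id₁ = solve-∀
      id₂ : ∀ c y → c * ((y + y) * (y + y) * ((y + y) * (y + y))) ≡ c * 16 * (y * (y * (y * (y * 1))))
      id₂ = solve-∀
    linear≤quartic : 2 * (ℓ * k) ≤ k * (ℓ * (32 * (ℓ * k * (ℓ * k)) * ℓ))
    linear≤quartic = begin
      2 * (ℓ * k)   ≡⟨ id k ℓ ⟩
      k * (ℓ * (2 * 1 * 1)) ≤⟨ *-monoʳ-≤ k (*-monoʳ-≤ ℓ (*-mono-≤ (*-mono-≤ {2} {32} (s≤s (s≤s z≤n)) (*-mono-≤ 1≤ℓk 1≤ℓk)) (s≤s z≤n))) ⟩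
      k * (ℓ * (32 * (ℓ * k * (ℓ * k)) * ℓ)) ∎
      where
      id : ∀ k y → 2 * (y * k) ≡ k * (y * (2 * 1 * 1))
      id = solve-∀
      1≤ℓk : 1 ≤ ℓ * k
      1≤ℓk = *-mono-≤ {1} {ℓ} (s≤s z≤n) 1≤k

log-scale : ∀ k → 1 ≤ k → ∃ λ s₀ → ∀ n s → s₀ ≤ s → n ≤ 4 * (s * s) → ∃ λ ℓ → 1 ≤ ℓ × suc n ≤ 2 ^ ℓ ×
  k * (ℓ * (32 * (ℓ * k * (ℓ * k)) * ℓ)) ≤ s × 2 * (ℓ * k) ≤ s
log-scale k 1≤k = 2 ^ proj₁ q , log-scale-from k (64 * (k * k * k) * 16) (proj₁ q) 1≤k refl (proj₂ q)
  where q = quartic-≤-2^ (64 * (k * k * k) * 16)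

private
  -- A vertex costs at most `6 h` bits: `h` each for its name and its degree, `4 h` for the rest.
  -- After the `k`-th power, `k' = 12 k` keeps the vertices within `n s / 2`, and the edge
  -- hypothesis does the same for the edges.
  count : ∀ k k' K₀ → 12 * k ≡ k' → 1 ≤ k' → 1 ≤ K₀ → (∀ x → K₀ ≤ x → 48 * (k' * k') * suc x ≤ 2 ^ x) →
    ∀ n s ℓ → 1 ≤ s → n ≤ 4 * (s * s) → 1 ≤ ℓ → suc n ≤ 2 ^ ℓ →
    k' * (ℓ * (32 * (ℓ * k' * (ℓ * k')) * ℓ)) ≤ s → 2 * (ℓ * k') ≤ s → ∀ E → 2 * (k * K₀) * E ≤ n * s →
    ∃ λ b → Bound {A = Graph n} (λ G → C4Free G × edge-sum G ≤ E) b × b ^ k ≤ 2 ^ (n * s)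
  count k k' K₀ k'≡ 1≤k' 1≤K₀ K₀-large n s ℓ 1≤s n≤4s² 1≤ℓ n<2^ℓ large₁ large₂ E E-small = X ^ n * 2 ^ (K₀ * E) , c4-free-bound E , power
    where
    open ≤-Reasoning
    instance
      k'≢0 : NonZero k'
      k'≢0 = >-nonZero 1≤k'
    h = s / k'
    h-floor : ∀ x → k' * x ≤ s → x ≤ h
    h-floor x le = ≤-pred (*-cancelʳ-< k' x (suc h) (≤-<-trans (≤-trans (≤-reflexive (*-comm x k')) le) (m<[1+m/n]*n s k')))
    h-ceil : s ≤ k' * suc h
    h-ceil = ≤-trans (<⇒≤ (m<[1+m/n]*n s k')) (≤-reflexive (*-comm (suc h) k'))
    h≤ : k' * h ≤ s
    h≤ = ≤-trans (≤-reflexive (*-comm k' h)) (m/n*n≤m s k')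
    module L = Local k' K₀ 1≤k' 1≤K₀ K₀-large n s h ℓ 1≤s n≤4s² 1≤ℓ n<2^ℓ h-floor h-ceil large₁ large₂
    open Rebuild n (2 ^ suc (3 * h)) K₀ L.local-bound
    ℓ≤h : ℓ ≤ h
    ℓ≤h = h-floor ℓ (≤-trans (≤-reflexive (*-comm k' ℓ)) (≤-trans (m≤m+n _ _) large₂))
    X≤ : X ≤ 2 ^ (6 * h)
    X≤ = begin
      n * (suc n * 2 ^ suc (3 * h)) ≤⟨ *-mono-≤ (≤-trans (n≤1+n n) n≤2^h) (*-mono-≤ n≤2^h (^-monoʳ-≤ 2 (+-monoˡ-≤ (3 * h) (≤-trans 1≤ℓ ℓ≤h)))) ⟩
      2 ^ h * (2 ^ h * 2 ^ (h + 3 * h)) ≡⟨ cong (2 ^ h *_) (sym (^-distribˡ-+-* 2 h (h + 3 * h))) ⟩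
      2 ^ h * 2 ^ (h + (h + 3 * h)) ≡⟨ sym (^-distribˡ-+-* 2 h (h + (h + 3 * h))) ⟩
      2 ^ (h + (h + (h + 3 * h))) ≡⟨ cong (2 ^_) (id h) ⟩
      2 ^ (6 * h) ∎
      where
      n≤2^h : suc n ≤ 2 ^ h
      n≤2^h = ≤-trans n<2^ℓ (^-monoʳ-≤ 2 ℓ≤h)
      id : ∀ h → h + (h + (h + 3 * h)) ≡ 6 * h
      id = solve-∀
    power : (X ^ n * 2 ^ (K₀ * E)) ^ k ≤ 2 ^ (n * s)
    power = begin
      (X ^ n * 2 ^ (K₀ * E)) ^ k            ≤⟨ ^-monoˡ-≤ k (*-monoˡ-≤ (2 ^ (K₀ * E)) (^-monoˡ-≤ n X≤)) ⟩
      ((2 ^ (6 * h)) ^ n * 2 ^ (K₀ * E)) ^ k ≡⟨ cong (λ x → (x * 2 ^ (K₀ * E)) ^ k) (^-*-assoc 2 (6 * h) n) ⟩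
      (2 ^ (6 * h * n) * 2 ^ (K₀ * E)) ^ k  ≡⟨ cong (_^ k) (sym (^-distribˡ-+-* 2 (6 * h * n) (K₀ * E))) ⟩
      (2 ^ (6 * h * n + K₀ * E)) ^ k        ≡⟨ ^-*-assoc 2 (6 * h * n + K₀ * E) k ⟩
      2 ^ ((6 * h * n + K₀ * E) * k)        ≤⟨ ^-monoʳ-≤ 2 exponent ⟩
      2 ^ (n * s) ∎
      where
      id : ∀ h n K E k → 2 * ((6 * h * n + K * E) * k) ≡ n * (12 * k * h) + 2 * (k * K) * E
      id = solve-∀
      exponent : (6 * h * n + K₀ * E) * k ≤ n * s
      exponent = *-cancelˡ-≤ 2 (begin
        2 * ((6 * h * n + K₀ * E) * k)        ≡⟨ id h n K₀ E k ⟩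
        n * (12 * k * h) + 2 * (k * K₀) * E   ≡⟨ cong (λ k' → n * (k' * h) + 2 * (k * K₀) * E) k'≡ ⟩
        n * (k' * h) + 2 * (k * K₀) * E       ≤⟨ +-mono-≤ (*-monoʳ-≤ n h≤) E-small ⟩
        n * s + n * s                         ≡⟨ cong (n * s +_) (sym (+-identityʳ _)) ⟩
        2 * (n * s) ∎)

c4-free-count : ∀ k → 1 ≤ k → ∃ λ c → ∃ λ s₀ → 1 ≤ c × (∀ n s → s₀ ≤ s → n ≤ 4 * (s * s) → ∀ E → c * E ≤ n * s →
  ∃ λ b → Bound {A = Graph n} (λ G → C4Free G × edge-sum G ≤ E) b × b ^ k ≤ 2 ^ (n * s))
c4-free-count k 1≤k = 2 * (k * suc x₀) , s₀ + 1 , *-mono-≤ {1} {2} (s≤s z≤n) (*-mono-≤ 1≤k (s≤s z≤n)) ,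
  λ n s s₀≤s n≤4s² → from n s s₀≤s n≤4s² (proj₂ scale n s (m+n≤o⇒m≤o s₀ s₀≤s) n≤4s²)
  where
  k' s₀ x₀ : ℕ
  k' = 12 * k
  1≤k' : 1 ≤ k'
  1≤k' = *-mono-≤ {1} {12} (s≤s z≤n) 1≤k
  scale = log-scale k' 1≤k'
  s₀ = proj₁ scale
  exponential = quartic-≤-2^ (48 * (k' * k'))
  x₀ = proj₁ exponential
  K₀-large : ∀ x → suc x₀ ≤ x → 48 * (k' * k') * suc x ≤ 2 ^ x
  K₀-large x le = ≤-trans (*-monoʳ-≤ (48 * (k' * k'))
    (≤-trans (≤-reflexive (sym (^-identityʳ (suc x)))) (^-monoʳ-≤ (suc x) {1} {4} (s≤s z≤n))))
    (proj₂ exponential x (≤-trans (n≤1+n x₀) le))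
  from : ∀ n s → s₀ + 1 ≤ s → n ≤ 4 * (s * s) → (∃ λ ℓ → 1 ≤ ℓ × suc n ≤ 2 ^ ℓ ×
    k' * (ℓ * (32 * (ℓ * k' * (ℓ * k')) * ℓ)) ≤ s × 2 * (ℓ * k') ≤ s) → ∀ E → 2 * (k * suc x₀) * E ≤ n * s →
    ∃ λ b → Bound {A = Graph n} (λ G → C4Free G × edge-sum G ≤ E) b × b ^ k ≤ 2 ^ (n * s)
  from n s s₀≤s n≤4s² (ℓ , 1≤ℓ , n<2^ℓ , large₁ , large₂) =
    count k k' (suc x₀) refl 1≤k' (s≤s z≤n) K₀-large n s ℓ (m+n≤o⇒n≤o s₀ s₀≤s) n≤4s² 1≤ℓ n<2^ℓ large₁ large₂

-- Ranks in a hyperedge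

-- The vertices of a hyperedge are numbered by their rank.
rank : Subset n → Fin n → ℕ
rank (b ∷ e) zero    = 0
rank (b ∷ e) (suc x) = 𝟙 b + rank e x

rank-injective : (e : Subset n) → ∀ {x y} → x ∈ˢ e → y ∈ˢ e → rank e x ≡ rank e y → x ≡ y
rank-injective (b ∷ e)    {zero}  {zero}  _   _   _  = refl
rank-injective (true ∷ e) {zero}  {suc y} _   _   ()
rank-injective (true ∷ e) {suc x} {zero}  _   _   ()
rank-injective (b ∷ e)    {suc x} {suc y} x∈e y∈e eq =
  cong suc (rank-injective e x∈e y∈e (+-cancelˡ-≡ (𝟙 b) _ _ eq))

rank<size : (e : Subset n) → ∀ {x} → x ∈ˢ e → rank e x < ∣ e ∣
rank<size (true ∷ e)  {zero}  _   = s≤s z≤n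
rank<size (true ∷ e)  {suc x} x∈e = s≤s (rank<size e x∈e)
rank<size (false ∷ e) {suc x} x∈e = rank<size e x∈e

rank-surjective : (e : Subset n) → ∀ i → i < ∣ e ∣ → ∃ λ x → x ∈ˢ e × rank e x ≡ i
rank-surjective (true ∷ e)  zero    _       = zero , refl , refl
rank-surjective (true ∷ e)  (suc i) (s≤s p) with rank-surjective e i p
... | x , x∈e , eq = suc x , x∈e , cong suc eq
rank-surjective (false ∷ e) i       p       with rank-surjective e i p
... | x , x∈e , eq = suc x , x∈e , eq

⊆ˢ-size-≡ : {e f : Subset n} → e ⊆ˢ f → ∣ e ∣ ≡ ∣ f ∣ → e ≡ f
⊆ˢ-size-≡ {e = e} {f} sub eq = lookup-ext same
  where
  same : ∀ x → lookup e x ≡ lookup f x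
  same x with lookup e x in p | lookup f x in q
  ... | true  | true  = refl
  ... | false | false = refl
  ... | true  | false = trans (sym (sub p)) q
  ... | false | true  = contradiction eq (<⇒≢ (p⊂q⇒∣p∣<∣q∣ {p = e} {f}
    ((λ {y} y∈e → Vec.lookup⇒[]= y f (sub (Vec.[]=⇒lookup y∈e))) ,
     x , Vec.lookup⇒[]= x f q , λ x∈e → contradiction (trans (sym (Vec.[]=⇒lookup x∈e)) p) λ ())))

_≟ˢ_ : DecidableEquality (Subset n)
_≟ˢ_ = Vec.≡-dec Bool._≟_

-- Short closed walks collapse into one hyperedge

module ClosedWalks {n : ℕ} (H : Hypergraph n) (girth : GirthGreaterThan 5 H) where

  Joins : Fin n → Fin n → Subset n → Set
  Joins x y e = H e ≡ true × x ∈ˢ e × y ∈ˢ e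

  flip : ∀ {x y e} → Joins x y e → Joins y x e
  flip (h , p , q) = h , q , p

  private
    berge : ∀ m → 2 ≤ suc m → suc m ≤ 5 → (vs : Vec (Fin n) (suc m)) (es : Vec (Subset n) (suc m)) →
      VUnique.Unique vs → VUnique.Unique es → ¬ (∀ i → Joins (lookup vs i) (lookup vs (next i)) (lookup es i))
    berge m 2≤ ≤5 vs es uv ue joins = girth m 2≤ ≤5 record
      { vtx      = lookup vs
      ; edg      = lookup es
      ; vtx-inj  = λ {i} {j} → lookup-injective uv i j
      ; edg-inj  = λ {i} {j} → lookup-injective ue i j
      ; edg-edge = λ i → proj₁ (joins i)
      ; vtx-in   = λ i → Vec.lookup⇒[]= _ _ (proj₁ (proj₂ (joins i)))
      ; nxt-in   = λ i → Vec.lookup⇒[]= _ _ (proj₂ (proj₂ (joins i)))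
      }

  walk₂ : ∀ {a b e₁ e₂} → a ≢ b → Joins a b e₁ → Joins a b e₂ → e₁ ≡ e₂
  walk₂ {a} {b} {e₁} {e₂} ab j₁ j₂ with e₁ ≟ˢ e₂
  ... | yes eq = eq
  ... | no ne  = ⊥-elim (berge 1 (s≤s (s≤s z≤n)) (s≤s (s≤s z≤n)) (a ∷ b ∷ []) (e₁ ∷ e₂ ∷ [])
    ((ab ∷ []) ∷ [] ∷ []) ((ne ∷ []) ∷ [] ∷ []) (λ { zero → j₁ ; (suc zero) → flip j₂ }))

  walk₃ : ∀ {a b c e₁ e₂ e₃} → a ≢ b → b ≢ c → c ≢ a → Joins a b e₁ → Joins b c e₂ → Joins c a e₃ →
          e₂ ≡ e₁ × e₃ ≡ e₁
  walk₃ {a} {b} {c} {e₁} {e₂} {e₃} ab bc ca j₁@(_ , a₁ , b₁) j₂@(_ , b₂ , c₂) j₃@(h₃ , c₃ , a₃)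
    with e₂ ≟ˢ e₁ | e₃ ≟ˢ e₁ | e₃ ≟ˢ e₂
  ... | yes refl | _ | _ = refl , walk₂ ca j₃ (proj₁ j₂ , c₂ , a₁)
  ... | no _ | yes refl | _ = walk₂ bc j₂ (h₃ , b₁ , c₃) , refl
  ... | no ne | no _ | yes refl = ⊥-elim (ne (walk₂ ab (h₃ , a₃ , b₂) j₁))
  ... | no n₁ | no n₂ | no n₃ = ⊥-elim (berge 2 (s≤s (s≤s z≤n)) (s≤s (s≤s (s≤s z≤n))) (a ∷ b ∷ c ∷ []) (e₁ ∷ e₂ ∷ e₃ ∷ [])
    ((ab ∷ ≢-sym ca ∷ []) ∷ (bc ∷ []) ∷ [] ∷ []) ((≢-sym n₁ ∷ ≢-sym n₂ ∷ []) ∷ (≢-sym n₃ ∷ []) ∷ [] ∷ [])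
    (λ { zero → j₁ ; (suc zero) → j₂ ; (suc (suc zero)) → j₃ }))

  record Walk₄ (a b c d : Fin n) (e₁ e₂ e₃ e₄ : Subset n) : Set where
    field
      ab : a ≢ b
      bc : b ≢ c
      cd : c ≢ d
      da : d ≢ a
      ac : a ≢ c
      bd : b ≢ d
      j₁ : Joins a b e₁
      j₂ : Joins b c e₂
      j₃ : Joins c d e₃
      j₄ : Joins d a e₄

  private
    rotate₄ : ∀ {a b c d e₁ e₂ e₃ e₄} → Walk₄ a b c d e₁ e₂ e₃ e₄ → Walk₄ b c d a e₂ e₃ e₄ e₁
    rotate₄ w = record { ab = bc ; bc = cd ; cd = da ; da = ab ; ac = bd ; bd = ≢-sym ac ; j₁ = j₂ ; j₂ = j₃ ; j₃ = j₄ ; j₄ = j₁ }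
      where open Walk₄ w

    Equal₄ : (e₁ e₂ e₃ e₄ : Subset n) → Set
    Equal₄ e₁ e₂ e₃ e₄ = e₂ ≡ e₁ × e₃ ≡ e₁ × e₄ ≡ e₁

    unrotate₄ : ∀ {e₁ e₂ e₃ e₄} → Equal₄ e₂ e₃ e₄ e₁ → Equal₄ e₁ e₂ e₃ e₄
    unrotate₄ (refl , refl , refl) = refl , refl , refl

    adjacent₄ : ∀ {a b c d e₁ e₂ e₃ e₄} → Walk₄ a b c d e₁ e₂ e₃ e₄ → e₂ ≡ e₁ → Equal₄ e₁ e₂ e₃ e₄
    adjacent₄ w refl with walk₃ ac cd da (proj₁ j₁ , proj₁ (proj₂ j₁) , proj₂ (proj₂ j₂)) j₃ j₄
      where open Walk₄ w
    ... | p , q = refl , p , q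

    opposite₄ : ∀ {a b c d e₁ e₂ e₃ e₄} → Walk₄ a b c d e₁ e₂ e₃ e₄ → e₃ ≡ e₁ → Equal₄ e₁ e₂ e₃ e₄
    opposite₄ w refl = adjacent₄ w (walk₂ bc j₂ (proj₁ j₁ , proj₂ (proj₂ j₁) , proj₁ (proj₂ j₃)))
      where open Walk₄ w

  -- Two consecutive equal edges allow their common vertex to be skipped, leaving a triangle; two
  -- opposite equal edges force the one between them to coincide, by `walk₂`. Four distinct edges
  -- would form a Berge cycle.
  walk₄ : ∀ {a b c d e₁ e₂ e₃ e₄} → Walk₄ a b c d e₁ e₂ e₃ e₄ → e₂ ≡ e₁ × e₃ ≡ e₁ × e₄ ≡ e₁
  walk₄ {a} {b} {c} {d} {e₁} {e₂} {e₃} {e₄} w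
    with e₂ ≟ˢ e₁ | e₃ ≟ˢ e₂ | e₄ ≟ˢ e₃ | e₁ ≟ˢ e₄ | e₃ ≟ˢ e₁ | e₄ ≟ˢ e₂
  ... | yes eq | _ | _ | _ | _ | _ = adjacent₄ w eq
  ... | _ | yes eq | _ | _ | _ | _ = unrotate₄ (adjacent₄ (rotate₄ w) eq)
  ... | _ | _ | yes eq | _ | _ | _ = unrotate₄ (unrotate₄ (adjacent₄ (rotate₄ (rotate₄ w)) eq))
  ... | _ | _ | _ | yes eq | _ | _ = unrotate₄ (unrotate₄ (unrotate₄ (adjacent₄ (rotate₄ (rotate₄ (rotate₄ w))) eq)))
  ... | _ | _ | _ | _ | yes eq | _ = opposite₄ w eq
  ... | _ | _ | _ | _ | _ | yes eq = unrotate₄ (opposite₄ (rotate₄ w) eq)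
  ... | no n₁ | no n₂ | no n₃ | no n₄ | no n₅ | no n₆ = ⊥-elim (berge 3 (s≤s (s≤s z≤n)) (s≤s (s≤s (s≤s (s≤s z≤n))))
    (a ∷ b ∷ c ∷ d ∷ []) (e₁ ∷ e₂ ∷ e₃ ∷ e₄ ∷ [])
    ((ab ∷ ac ∷ ≢-sym da ∷ []) ∷ (bc ∷ bd ∷ []) ∷ (cd ∷ []) ∷ [] ∷ [])
    ((≢-sym n₁ ∷ ≢-sym n₅ ∷ n₄ ∷ []) ∷ (≢-sym n₂ ∷ ≢-sym n₆ ∷ []) ∷ (≢-sym n₃ ∷ []) ∷ [] ∷ [])
    (λ { zero → j₁ ; (suc zero) → j₂ ; (suc (suc zero)) → j₃ ; (suc (suc (suc zero))) → j₄ }))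
    where open Walk₄ w

  record Walk₅ (a b c d f : Fin n) (e₁ e₂ e₃ e₄ e₅ : Subset n) : Set where
    field
      ab : a ≢ b
      bc : b ≢ c
      cd : c ≢ d
      df : d ≢ f
      fa : f ≢ a
      ac : a ≢ c
      bd : b ≢ d
      cf : c ≢ f
      da : d ≢ a
      fb : f ≢ b
      j₁ : Joins a b e₁
      j₂ : Joins b c e₂
      j₃ : Joins c d e₃
      j₄ : Joins d f e₄
      j₅ : Joins f a e₅

  private
    rotate₅ : ∀ {a b c d f e₁ e₂ e₃ e₄ e₅} → Walk₅ a b c d f e₁ e₂ e₃ e₄ e₅ → Walk₅ b c d f a e₂ e₃ e₄ e₅ e₁
    rotate₅ w = record
      { ab = bc ; bc = cd ; cd = df ; df = fa ; fa = ab ; ac = bd ; bd = cf ; cf = da ; da = fb ; fb = ac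
      ; j₁ = j₂ ; j₂ = j₃ ; j₃ = j₄ ; j₄ = j₅ ; j₅ = j₁ }
      where open Walk₅ w

    Equal₅ : (e₁ e₂ e₃ e₄ e₅ : Subset n) → Set
    Equal₅ e₁ e₂ e₃ e₄ e₅ = e₂ ≡ e₁ × e₃ ≡ e₁ × e₄ ≡ e₁ × e₅ ≡ e₁

    unrotate₅ : ∀ {e₁ e₂ e₃ e₄ e₅} → Equal₅ e₂ e₃ e₄ e₅ e₁ → Equal₅ e₁ e₂ e₃ e₄ e₅
    unrotate₅ (refl , refl , refl , refl) = refl , refl , refl , refl

    adjacent₅ : ∀ {a b c d f e₁ e₂ e₃ e₄ e₅} → Walk₅ a b c d f e₁ e₂ e₃ e₄ e₅ → e₂ ≡ e₁ → Equal₅ e₁ e₂ e₃ e₄ e₅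
    adjacent₅ w refl = refl , walk₄ (record
      { ab = ac ; bc = cd ; cd = df ; da = fa ; ac = ≢-sym da ; bd = cf
      ; j₁ = proj₁ j₁ , proj₁ (proj₂ j₁) , proj₂ (proj₂ j₂) ; j₂ = j₃ ; j₃ = j₄ ; j₄ = j₅ })
      where open Walk₅ w

    opposite₅ : ∀ {a b c d f e₁ e₂ e₃ e₄ e₅} → Walk₅ a b c d f e₁ e₂ e₃ e₄ e₅ → e₃ ≡ e₁ → Equal₅ e₁ e₂ e₃ e₄ e₅
    opposite₅ w refl = adjacent₅ w (walk₂ bc j₂ (proj₁ j₁ , proj₂ (proj₂ j₁) , proj₁ (proj₂ j₃)))
      where open Walk₅ w

    distinct-or-equal₅ : ∀ {a b c d f e₁ e₂ e₃ e₄ e₅} → Walk₅ a b c d f e₁ e₂ e₃ e₄ e₅ →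
      (e₁ ≢ e₂ × e₁ ≢ e₃) ⊎ Equal₅ e₁ e₂ e₃ e₄ e₅
    distinct-or-equal₅ {e₁ = e₁} {e₂} {e₃} w with e₂ ≟ˢ e₁ | e₃ ≟ˢ e₁
    ... | yes eq | _      = inj₂ (adjacent₅ w eq)
    ... | no _   | yes eq = inj₂ (opposite₅ w eq)
    ... | no p   | no q   = inj₁ (≢-sym p , ≢-sym q)

  -- Any two edges of a five-walk are consecutive or one step further apart, so the five rotations
  -- of `distinct-or-equal₅` cover all ten pairs.
  walk₅ : ∀ {a b c d f e₁ e₂ e₃ e₄ e₅} → Walk₅ a b c d f e₁ e₂ e₃ e₄ e₅ →
          e₂ ≡ e₁ × e₃ ≡ e₁ × e₄ ≡ e₁ × e₅ ≡ e₁
  walk₅ {a} {b} {c} {d} {f} {e₁} {e₂} {e₃} {e₄} {e₅} w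
    with distinct-or-equal₅ w | distinct-or-equal₅ w¹ | distinct-or-equal₅ w² | distinct-or-equal₅ w³ | distinct-or-equal₅ w⁴
    where
    w¹ = rotate₅ w
    w² = rotate₅ w¹
    w³ = rotate₅ w²
    w⁴ = rotate₅ w³
  ... | inj₂ eq | _ | _ | _ | _ = eq
  ... | _ | inj₂ eq | _ | _ | _ = unrotate₅ eq
  ... | _ | _ | inj₂ eq | _ | _ = unrotate₅ (unrotate₅ eq)
  ... | _ | _ | _ | inj₂ eq | _ = unrotate₅ (unrotate₅ (unrotate₅ eq))
  ... | _ | _ | _ | _ | inj₂ eq = unrotate₅ (unrotate₅ (unrotate₅ (unrotate₅ eq)))
  ... | inj₁ (n₁₂ , n₁₃) | inj₁ (n₂₃ , n₂₄) | inj₁ (n₃₄ , n₃₅) | inj₁ (n₄₅ , n₄₁) | inj₁ (n₅₁ , n₅₂) =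
    ⊥-elim (berge 4 (s≤s (s≤s z≤n)) ≤-refl (a ∷ b ∷ c ∷ d ∷ f ∷ []) (e₁ ∷ e₂ ∷ e₃ ∷ e₄ ∷ e₅ ∷ [])
    ((ab ∷ ac ∷ ≢-sym da ∷ ≢-sym fa ∷ []) ∷ (bc ∷ bd ∷ ≢-sym fb ∷ []) ∷ (cd ∷ cf ∷ []) ∷ (df ∷ []) ∷ [] ∷ [])
    ((n₁₂ ∷ n₁₃ ∷ ≢-sym n₄₁ ∷ ≢-sym n₅₁ ∷ []) ∷ (n₂₃ ∷ n₂₄ ∷ ≢-sym n₅₂ ∷ []) ∷ (n₃₄ ∷ n₃₅ ∷ []) ∷ (n₄₅ ∷ []) ∷ [] ∷ [])
    (λ { zero → j₁ ; (suc zero) → j₂ ; (suc (suc zero)) → j₃ ; (suc (suc (suc zero))) → j₄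
       ; (suc (suc (suc (suc zero)))) → j₅ }))
    where open Walk₅ w

-- Shadow graphs and triples of ranks

does⁻ : {P : Set} {d : Dec P} → does d ≡ true → P
does⁻ {d = yes p} _ = p

does⁺ : {P : Set} {d : Dec P} → P → does d ≡ true
does⁺ {d = yes _} _ = refl
does⁺ {d = no ¬p} p = contradiction p ¬p

module Shadows {n : ℕ} (H : Hypergraph n) where

  record At (i : ℕ) (e : Subset n) (x : Fin n) : Set where
    constructor at
    field
      member : x ∈ˢ e
      ranked : rank e x ≡ i

  at? : ∀ i e x → Dec (At i e x)
  at? i e x = map′ (λ (p , q) → at p q) (λ (at p q) → p , q) ((lookup e x Bool.≟ true) ×-dec (rank e x ≟ i))

  Triple : ℕ → ℕ → ℕ → Fin n → Fin n → Fin n → Set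
  Triple i j k x y z = ∃ λ e → H e ≡ true × At i e x × At j e y × At k e z

  triple : ℕ → ℕ → ℕ → Fin n → Fin n → Fin n → Bool
  triple i j k x y z = does (anySubset? (λ e → (H e Bool.≟ true) ×-dec (at? i e x ×-dec (at? j e y ×-dec at? k e z))))

  Pair : ℕ → ℕ → Fin n → Fin n → Set
  Pair i j x y = ∃ λ e → H e ≡ true × ((At i e x × At j e y) ⊎ (At j e x × At i e y)) × x ≢ y

  pair? : ∀ i j x y → Dec (Pair i j x y)
  pair? i j x y = anySubset? (λ e → (H e Bool.≟ true) ×-dec
    (((at? i e x ×-dec at? j e y) ⊎-dec (at? j e x ×-dec at? i e y)) ×-dec ¬? (x F.≟ y)))

  shadow : ℕ → ℕ → Graph n
  shadow i j = tabulate (λ x → tabulate (λ y → does (pair? i j x y)))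

  adj-shadow : ∀ i j x y → adj (shadow i j) x y ≡ does (pair? i j x y)
  adj-shadow i j x y = trans (cong (λ r → lookup r y) (Vec.lookup∘tabulate _ x)) (Vec.lookup∘tabulate _ y)

  shadow⁻ : ∀ {i j x y} → adj (shadow i j) x y ≡ true → Pair i j x y
  shadow⁻ {i} {j} {x} {y} p = does⁻ {d = pair? i j x y} (trans (sym (adj-shadow i j x y)) p)

  shadow⁺ : ∀ {i j x y} → Pair i j x y → adj (shadow i j) x y ≡ true
  shadow⁺ {i} {j} {x} {y} p = trans (adj-shadow i j x y) (does⁺ {d = pair? i j x y} p)

module GoodHypergraph {n r : ℕ} (H : Hypergraph n) (good : Good r H) where
  open Shadows H
  open ClosedWalks H (proj₂ good)

  joins : ∀ {i j x y} (p : Pair i j x y) → Joins x y (proj₁ p)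
  joins (e , h , inj₁ (at x∈ _ , at y∈ _) , _) = h , x∈ , y∈
  joins (e , h , inj₂ (at x∈ _ , at y∈ _) , _) = h , x∈ , y∈

  same-rank : ∀ {i e x y} → At i e x → At i e y → x ≡ y
  same-rank {e = e} (at x∈ p) (at y∈ q) = rank-injective e x∈ y∈ (trans p (sym q))

  -- Within one hyperedge the neighbour of `x` is the vertex of the other rank, so a four-cycle that
  -- collapses has equal opposite vertices. Mixed orders force `i ≡ j`.
  opposite : ∀ {i j x y z e} → (At i e x × At j e y) ⊎ (At j e x × At i e y) →
             (At i e x × At j e z) ⊎ (At j e x × At i e z) → y ≡ z
  opposite (inj₁ (_ , p)) (inj₁ (_ , q)) = same-rank p q
  opposite (inj₂ (_ , p)) (inj₂ (_ , q)) = same-rank p q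
  opposite (inj₁ (at _ a , p)) (inj₂ (at _ b , q)) with trans (sym a) b
  ... | refl = same-rank p q
  opposite (inj₂ (at _ a , p)) (inj₁ (at _ b , q)) with trans (sym a) b
  ... | refl = same-rank p q

  shadow-C4Free : ∀ i j → C4Free (shadow i j)
  shadow-C4Free i j = record
    { symmetric   = λ p → shadow⁺ (swap (shadow⁻ p))
    ; irreflexive = λ p → proj₂ (proj₂ (proj₂ (shadow⁻ p)))
    ; no-C4       = λ p q r s → no-C4 (shadow⁻ p) (shadow⁻ q) (shadow⁻ r) (shadow⁻ s)
    }
    where
    swap : ∀ {x y} → Pair i j x y → Pair i j y x
    swap (e , h , inj₁ (p , q) , ne) = e , h , inj₂ (q , p) , ≢-sym ne
    swap (e , h , inj₂ (p , q) , ne) = e , h , inj₁ (q , p) , ≢-sym ne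
    no-C4 : ∀ {a b x y} → Pair i j a x → Pair i j a y → Pair i j b x → Pair i j b y → a ≢ b → x ≡ y
    no-C4 {a} {b} {x} {y} p q r s a≢b with x F.≟ y
    ... | yes eq = eq
    ... | no x≢y with walk₄ (record
          { ab = proj₂ (proj₂ (proj₂ p)) ; bc = ≢-sym (proj₂ (proj₂ (proj₂ r))) ; cd = proj₂ (proj₂ (proj₂ s))
          ; da = ≢-sym (proj₂ (proj₂ (proj₂ q))) ; ac = a≢b ; bd = x≢y
          ; j₁ = joins p ; j₂ = flip (joins r) ; j₃ = joins s ; j₄ = flip (joins q) })
    no-C4 (e , _ , p , _) (_ , _ , q , _) _ _ _ | no _ | refl , refl , refl = opposite p q

  triples-Girth6 : ∀ {i j k} → i ≢ j → j ≢ k → i ≢ k → Girth6 (triple i j k)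
  triples-Girth6 {i} {j} {k} i≢j j≢k i≢k = record
    { lin₁₂ = λ p q → lin₁₂ (open-triple p) (open-triple q)
    ; lin₁₃ = λ p q → lin₁₃ (open-triple p) (open-triple q)
    ; lin₂₃ = λ p q → lin₂₃ (open-triple p) (open-triple q)
    ; c4₁₂  = λ p q r s → c4₁₂ (open-triple p) (open-triple q) (open-triple r) (open-triple s)
    ; c4₁₃  = λ p q r s → c4₁₃ (open-triple p) (open-triple q) (open-triple r) (open-triple s)
    ; c4₂₃  = λ p q r s → c4₂₃ (open-triple p) (open-triple q) (open-triple r) (open-triple s)
    ; c5    = λ {x₀} {x} {x'} {u} {y} {z} {a} {b} {c} {d} t p q r s u≢y →
                c5 t p r (open-triple t) (open-triple p) (open-triple q) (open-triple r) (open-triple s) u≢y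
    }
    where
    Tr = Triple i j k
    open-triple : ∀ {x y z} → triple i j k x y z ≡ true → Tr x y z
    open-triple {x} {y} {z} p = does⁻ {d = anySubset? (λ e → (H e Bool.≟ true) ×-dec (at? i e x ×-dec (at? j e y ×-dec at? k e z)))} p
    J₁₂ : ∀ {x y z} (t : Tr x y z) → Joins x y (proj₁ t)
    J₁₂ (e , h , at x∈ _ , at y∈ _ , at z∈ _) = h , x∈ , y∈
    J₁₃ : ∀ {x y z} (t : Tr x y z) → Joins x z (proj₁ t)
    J₁₃ (e , h , at x∈ _ , at y∈ _ , at z∈ _) = h , x∈ , z∈
    J₂₃ : ∀ {x y z} (t : Tr x y z) → Joins y z (proj₁ t)
    J₂₃ (e , h , at x∈ _ , at y∈ _ , at z∈ _) = h , y∈ , z∈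
    at₁ : ∀ {x y z} (t : Tr x y z) → At i (proj₁ t) x
    at₁ (_ , _ , p , _) = p
    at₂ : ∀ {x y z} (t : Tr x y z) → At j (proj₁ t) y
    at₂ (_ , _ , _ , p , _) = p
    at₃ : ∀ {x y z} (t : Tr x y z) → At k (proj₁ t) z
    at₃ (_ , _ , _ , _ , p) = p
    apart : ∀ {i j e x} → i ≢ j → At i e x → ¬ At j e x
    apart i≢j (at _ p) (at _ q) = i≢j (trans (sym p) q)
    ne₁₂ : ∀ {x y z} → Tr x y z → x ≢ y
    ne₁₂ t refl = apart i≢j (at₁ t) (at₂ t)
    ne₁₃ : ∀ {x y z} → Tr x y z → x ≢ z
    ne₁₃ t refl = apart i≢k (at₁ t) (at₃ t)
    ne₂₃ : ∀ {x y z} → Tr x y z → y ≢ z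
    ne₂₃ t refl = apart j≢k (at₂ t) (at₃ t)
    move : ∀ {i e f x} → e ≡ f → At i e x → At i f x
    move refl p = p
    lin₁₂ : ∀ {x y z z'} → Tr x y z → Tr x y z' → z ≡ z'
    lin₁₂ t t' = same-rank (move (walk₂ (ne₁₂ t) (J₁₂ t) (J₁₂ t')) (at₃ t)) (at₃ t')
    lin₁₃ : ∀ {x y y' z} → Tr x y z → Tr x y' z → y ≡ y'
    lin₁₃ t t' = same-rank (move (walk₂ (ne₁₃ t) (J₁₃ t) (J₁₃ t')) (at₂ t)) (at₂ t')
    lin₂₃ : ∀ {x x' y z} → Tr x y z → Tr x' y z → x ≡ x'
    lin₂₃ t t' = same-rank (move (walk₂ (ne₂₃ t) (J₂₃ t) (J₂₃ t')) (at₁ t)) (at₁ t')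
    c4₁₂ : ∀ {x x' u y a b c d} → Tr x u a → Tr x y b → Tr x' u c → Tr x' y d → u ≢ y → x ≡ x'
    c4₁₂ {x} {x'} p q r s u≢y with x F.≟ x'
    ... | yes eq = eq
    ... | no ne with walk₄ (record { ab = ≢-sym (ne₁₂ p) ; bc = ne₁₂ q ; cd = ≢-sym (ne₁₂ s) ; da = ne₁₂ r
                                  ; ac = u≢y ; bd = ne
                                  ; j₁ = flip (J₁₂ p) ; j₂ = J₁₂ q ; j₃ = flip (J₁₂ s) ; j₄ = J₁₂ r })
    ...   | _ , _ , eq = same-rank (at₁ p) (move eq (at₁ r))
    c4₁₃ : ∀ {x x' u z a b c d} → Tr x u a → Tr x b z → Tr x' u c → Tr x' d z → x ≡ x'
    c4₁₃ {x} {x'} {u} {z} p q r s with x F.≟ x' | u F.≟ z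
    ... | yes eq | _ = eq
    ... | no _ | yes refl = ⊥-elim (apart j≢k (move (walk₂ (ne₁₂ p) (J₁₂ p) (J₁₃ q)) (at₂ p)) (at₃ q))
    ... | no ne | no u≢z with walk₄ (record { ab = ≢-sym (ne₁₂ p) ; bc = ne₁₃ q ; cd = ≢-sym (ne₁₃ s) ; da = ne₁₂ r
                                  ; ac = u≢z ; bd = ne
                                  ; j₁ = flip (J₁₂ p) ; j₂ = J₁₃ q ; j₃ = flip (J₁₃ s) ; j₄ = J₁₂ r })
    ...   | _ , _ , eq = same-rank (at₁ p) (move eq (at₁ r))
    c4₂₃ : ∀ {y y' z z' a b c d} → Tr a y z → Tr b y' z → Tr c y z' → Tr d y' z' → y ≢ y' → z ≡ z'
    c4₂₃ {y} {y'} {z} {z'} p q r s y≢y' with z F.≟ z'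
    ... | yes eq = eq
    ... | no ne with walk₄ (record { ab = ne₂₃ p ; bc = ≢-sym (ne₂₃ q) ; cd = ne₂₃ s ; da = ≢-sym (ne₂₃ r)
                                  ; ac = y≢y' ; bd = ne
                                  ; j₁ = J₂₃ p ; j₂ = flip (J₂₃ q) ; j₃ = J₂₃ s ; j₄ = flip (J₂₃ r) })
    ...   | _ , _ , eq = same-rank (at₃ p) (move eq (at₃ r))
    c5 : ∀ {x₀ x x' u y z a b c d} → triple i j k x₀ y z ≡ true → triple i j k x u a ≡ true →
         triple i j k x' u c ≡ true → Tr x₀ y z → Tr x u a → Tr x y b → Tr x' u c → Tr x' d z → u ≢ y →
         ∃ λ v → triple i j k x₀ u v ≡ true
    c5 {x₀} {x} {x'} {u} {y} {z} _ p! _ t p q r s u≢y = conclude x₀≡x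
      where
      conclude : x₀ ≡ x → ∃ λ v → triple i j k x₀ u v ≡ true
      conclude refl = _ , p!
      x₀≡x : x₀ ≡ x
      -- The walk `u , x , y , z , x'` may repeat a vertex. If `x ≡ x'` or `u ≡ z`, a triangle
      -- remains, which collapses and gives `x₀ ≡ x`; if `x ≡ z` or `y ≡ x'`, one vertex would have
      -- two ranks in a hyperedge.
      x₀≡x with x F.≟ x' | u F.≟ z | x F.≟ z | y F.≟ x'
      ... | yes refl | _ | _ | _ =
        same-rank (move (proj₁ (walk₃ (ne₁₂ q) (ne₂₃ t) (≢-sym (ne₁₃ s)) (J₁₂ q) (J₂₃ t) (flip (J₁₃ s)))) (at₁ t)) (at₁ q)
      ... | no _ | yes refl | _ | _ = same-rank (at₁ t)
        (move (sym (proj₂ (walk₃ (≢-sym (ne₁₂ p)) (ne₁₂ q) (≢-sym u≢y) (flip (J₁₂ p)) (J₁₂ q) (J₂₃ t))))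
              (move (proj₁ (walk₃ (≢-sym (ne₁₂ p)) (ne₁₂ q) (≢-sym u≢y) (flip (J₁₂ p)) (J₁₂ q) (J₂₃ t))) (at₁ q)))
      ... | no _ | no _ | yes refl | _ =
        ⊥-elim (apart i≢k (move (walk₂ (ne₁₂ q) (J₁₂ q) (flip (J₂₃ t))) (at₁ q)) (at₃ t))
      ... | no _ | no _ | no _ | yes refl
        with walk₃ (≢-sym (ne₁₂ p)) (ne₁₂ q) (≢-sym u≢y) (flip (J₁₂ p)) (J₁₂ q) (J₁₂ r)
      ...   | eq₁ , eq₂ = ⊥-elim (apart i≢j (move eq₂ (at₁ r)) (move eq₁ (at₂ q)))
      x₀≡x | no x≢x' | no u≢z | no x≢z | no y≢x' with walk₅ (record
        { ab = ≢-sym (ne₁₂ p) ; bc = ne₁₂ q ; cd = ne₂₃ t ; df = ≢-sym (ne₁₃ s) ; fa = ne₁₂ r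
        ; ac = u≢y ; bd = x≢z ; cf = y≢x' ; da = ≢-sym u≢z ; fb = ≢-sym x≢x'
        ; j₁ = flip (J₁₂ p) ; j₂ = J₁₂ q ; j₃ = J₂₃ t ; j₄ = flip (J₁₃ s) ; j₅ = J₁₂ r })
      ...   | _ , eq , _ = same-rank (move eq (at₁ t)) (at₁ p)

  -- Each edge of the shadow is counted, in one of its two orientations, by a triple with any third rank.
  shadow-edges : ∀ {i j k} → i ≢ j → j ≢ k → i ≢ k → k < r → (girth : Girth6 (triple i j k)) →
    edge-sum (shadow i j) ≤ 2 * Triples.total (triple i j k) girth
  shadow-edges {i} {j} {k} i≢j j≢k i≢k k<r girth = begin
    edge-sum (shadow i j)
      ≤⟨ sum-mono (λ x → sum-mono (λ y → ≤1-from-pos (𝟙≤1 _) (λ p → oriented (shadow⁻ (𝟙-true p))))) ⟩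
    sum (λ x → sum (λ y → e₁₂ x y + e₁₂ y x))
      ≡⟨ sum²-distrib-+ e₁₂ (λ x y → e₁₂ y x) ⟩
    total + sum (λ x → sum (λ y → e₁₂ y x))
      ≡⟨ cong (total +_) (trans (sum-comm (λ x y → e₁₂ y x)) (sym (+-identityʳ total))) ⟩
    2 * total ∎
    where
    open ≤-Reasoning
    open Triples (triple i j k) girth
    third : ∀ {x y e} → H e ≡ true → At i e x → At j e y → 1 ≤ e₁₂ x y
    third {x} {y} {e} h p q with rank-surjective e k (≤-trans k<r (≤-reflexive (sym (proj₁ good e h))))
    ... | z , z∈ , rz = e₁₂⁺ {x} {y} {z} (does⁺ {d = anySubset? (λ e → (H e Bool.≟ true) ×-dec
                                     (at? i e x ×-dec (at? j e y ×-dec at? k e z)))} (e , h , p , q , at z∈ rz))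
    oriented : ∀ {x y} → Pair i j x y → 1 ≤ e₁₂ x y + e₁₂ y x
    oriented (e , h , inj₁ (p , q) , _) = ≤-trans (third h p q) (m≤m+n _ _)
    oriented {x} {y} (e , h , inj₂ (p , q) , _) = ≤-trans (third h q p) (m≤n+m _ (e₁₂ x y))

  shadow-diagonal : ∀ i → edge-sum (shadow i i) ≡ 0
  shadow-diagonal i = sum-zero (λ x → sum-zero (λ y → cong 𝟙 (Bool.¬-not (λ p → loop (shadow⁻ p)))))
    where
    loop : ∀ {x y} → ¬ Pair i i x y
    loop (_ , _ , inj₁ (p , q) , ne) = ne (same-rank p q)
    loop (_ , _ , inj₂ (p , q) , ne) = ne (same-rank p q)

  -- Let `f` be a hyperedge through two vertices of `e`. Every further vertex of `e` closes a
  -- triangle with them, which collapses into `f`; so `e ⊆ f`, and the sizes agree.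
  covered : 3 ≤ r → ∀ e → ∣ e ∣ ≡ r →
            (∀ {x y} → x ∈ˢ e → y ∈ˢ e → x ≢ y → ∃ λ f → Joins x y f) → H e ≡ true
  covered 3≤r e size joined
    with rank-surjective e 0 (≤-trans (s≤s z≤n) (≤-trans 3≤r (≤-reflexive (sym size))))
       | rank-surjective e 1 (≤-trans (s≤s (s≤s z≤n)) (≤-trans 3≤r (≤-reflexive (sym size))))
  ... | a , a∈ , ra | b , b∈ , rb with joined a∈ b∈ (λ { refl → contradiction (trans (sym ra) rb) λ () })
  ...   | f , j@(h , a∈f , b∈f) = subst (λ e → H e ≡ true) (sym e≡f) h
    where
    a≢b : a ≢ b
    a≢b refl = contradiction (trans (sym ra) rb) λ ()
    e⊆f : e ⊆ˢ f
    e⊆f {x} x∈ with x F.≟ a | x F.≟ b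
    ... | yes refl | _ = a∈f
    ... | no _ | yes refl = b∈f
    ... | no x≢a | no x≢b with joined b∈ x∈ (≢-sym x≢b) | joined x∈ a∈ x≢a
    ...   | g , j₂ | g' , j₃ with walk₃ a≢b (≢-sym x≢b) x≢a j j₂ j₃
    ...     | refl , _ = proj₂ (proj₂ j₂)
    e≡f : e ≡ f
    e≡f = ⊆ˢ-size-≡ e⊆f (trans size (sym (proj₁ good f h)))

-- Coding a hypergraph by its shadows

third-index : ∀ r → 3 ≤ r → ∀ i j → ∃ λ k → k < r × i ≢ k × j ≢ k
third-index r 3≤r i j with i ≟ 0 | j ≟ 0 | i ≟ 1 | j ≟ 1
... | no p | no q | _ | _ = 0 , ≤-trans (s≤s z≤n) 3≤r , p , q
... | _ | _ | no p | no q = 1 , ≤-trans (s≤s (s≤s z≤n)) 3≤r , p , q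
... | yes refl | _ | _ | yes refl = 2 , 3≤r , (λ ()) , λ ()
... | _ | yes refl | yes refl | _ = 2 , 3≤r , (λ ()) , λ ()
... | yes refl | _ | yes () | _
... | _ | yes refl | _ | yes ()

-- The empty diagonal shadows are included, so that the index set is a plain product.
code : ∀ r → Hypergraph n → Vec (Graph n) (r * r)
code r H = tabulate (λ p → Shadows.shadow H (toℕ (proj₁ (remQuot {r} r p))) (toℕ (proj₂ (remQuot {r} r p))))

-- Any two vertices of `e` are adjacent in the shadow of their ranks, hence joined in `H'` as well,
-- and `covered` applies.
code-complete : ∀ {r} → 3 ≤ r → {H H' : Hypergraph n} → Good r H → Good r H' → code r H ≡ code r H' →
                ∀ e → H e ≡ true → H' e ≡ true
code-complete {r = r} 3≤r {H} {H'} good good' eq e h = G'.covered 3≤r e size joined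
  where
  module G' = GoodHypergraph H' good'
  size : ∣ e ∣ ≡ r
  size = proj₁ good e h
  same : ∀ (i j : Fin r) → Shadows.shadow H (toℕ i) (toℕ j) ≡ Shadows.shadow H' (toℕ i) (toℕ j)
  same i j = subst (λ q → Shadows.shadow H (toℕ (proj₁ q)) (toℕ (proj₂ q)) ≡ Shadows.shadow H' (toℕ (proj₁ q)) (toℕ (proj₂ q)))
    (F.remQuot-combine i j)
    (trans (sym (Vec.lookup∘tabulate _ (combine i j))) (trans (cong (λ v → lookup v (combine i j)) eq) (Vec.lookup∘tabulate _ (combine i j))))
  joined : ∀ {x y} → x ∈ˢ e → y ∈ˢ e → x ≢ y → ∃ λ f → ClosedWalks.Joins H' (proj₂ good') x y f
  joined {x} {y} x∈ y∈ x≢y = _ , G'.joins (Shadows.shadow⁻ H' (trans (cong (λ G → adj G x y) (sym (same i j)))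
      (Shadows.shadow⁺ H (e , h , inj₁ (Shadows.at x∈ (sym (F.toℕ-fromℕ< x<r)) , Shadows.at y∈ (sym (F.toℕ-fromℕ< y<r))) , x≢y))))
    where
    x<r : rank e x < r
    x<r = ≤-trans (rank<size e x∈) (≤-reflexive size)
    y<r : rank e y < r
    y<r = ≤-trans (rank<size e y∈) (≤-reflexive size)
    i j : Fin r
    i = fromℕ< x<r
    j = fromℕ< y<r

code-injective : ∀ {r} → 3 ≤ r → {H H' : Hypergraph n} → Good r H → Good r H' → Differ H H' → code r H ≢ code r H'
code-injective {r = r} 3≤r {H} {H'} good good' (e , ne) eq with H e in p | H' e in q
... | true  | true  = ne refl
... | false | false = ne refl
... | true  | false = contradiction (trans (sym (code-complete 3≤r good good' eq e p)) q) λ ()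
... | false | true  = contradiction (trans (sym (code-complete 3≤r good' good (sym eq) e q)) p) λ ()

-- Integer square roots and the final estimate

square-root : ∀ n → 1 ≤ n → ∃ λ s → s * s ≤ n × n < suc s * suc s × n ≤ 4 * (s * s)
square-root n 1≤n with least (λ s → n <? suc s * suc s) n (≤-trans (≤-reflexive (sym (*-identityʳ (suc n)))) (*-monoʳ-≤ (suc n) (s≤s z≤n)))
... | zero  , lt , _ = contradiction (≤-trans lt 1≤n) (<-irrefl refl)
... | suc s , lt , minimal = suc s , ≮⇒≥ (minimal refl) , lt , (begin
    n                             ≤⟨ <⇒≤ lt ⟩
    suc (suc s) * suc (suc s)     ≤⟨ *-mono-≤ double double ⟩
    2 * suc s * (2 * suc s)       ≡⟨ id (suc s) ⟩
    4 * (suc s * suc s) ∎)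
  where
  open ≤-Reasoning
  double : suc (suc s) ≤ 2 * suc s
  double = s≤s (≤-trans (m≤n+m (suc s) s) (≤-reflexive (cong (s +_) (sym (+-identityʳ (suc s))))))
  id : ∀ s → 2 * s * (2 * s) ≡ 4 * (s * s)
  id = solve-∀

square-cancel-≤ : ∀ {a b} → a * a ≤ b * b → a ≤ b
square-cancel-≤ le = ≮⇒≥ (λ lt → <⇒≱ (*-mono-< lt lt) le)

private
  bound : ∀ r → 3 ≤ r → ∀ k c s₀ s₁ → 1 ≤ c →
    (∀ n s → s₀ ≤ s → n ≤ 4 * (s * s) → ∀ E → c * E ≤ n * s →
      ∃ λ b → Bound {A = Graph n} (λ G → C4Free G × edge-sum G ≤ E) b × b ^ (r * r * k) ≤ 2 ^ (n * s)) →
    ((n s : ℕ) → s₁ ≤ s → s * s ≤ n → n ≤ 4 * (s * s) → (T : Fin n → Fin n → Fin n → Bool) (girth : Girth6 T) →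
      2 * c * Triples.total T girth ≤ n * s) →
    (n : ℕ) → suc (s₀ + s₁) * suc (s₀ + s₁) ≤ n → (m : ℕ) → n ^ 3 ≤ m * m →
    (L : List (Hypergraph n)) → AllPairs Differ L → All (Good r) L → length L ^ k ≤ 2 ^ m
  bound r 3≤r k c s₀ s₁ 1≤c count few n N≤n m n³≤m² L differ good with square-root n (≤-trans (s≤s z≤n) N≤n)
  ... | s , s²≤n , n<s² , n≤4s² = begin
      length L ^ k            ≤⟨ ^-monoˡ-≤ k length≤ ⟩
      (b ^ (r * r)) ^ k       ≡⟨ ^-*-assoc b (r * r) k ⟩
      b ^ (r * r * k)         ≤⟨ proj₂ (proj₂ counted) ⟩
      2 ^ (n * s)             ≤⟨ ^-monoʳ-≤ 2 ns≤m ⟩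
      2 ^ m ∎
    where
    open ≤-Reasoning
    instance
      c≢0 : NonZero c
      c≢0 = >-nonZero 1≤c
    S = suc (s₀ + s₁)
    S≤s : S ≤ s
    S≤s = ≤-pred (≰⇒> (λ s<S → <⇒≱ n<s² (≤-trans (*-mono-≤ s<S s<S) N≤n)))
    s₀≤s : s₀ ≤ s
    s₀≤s = ≤-trans (≤-trans (m≤m+n s₀ s₁) (n≤1+n _)) S≤s
    s₁≤s : s₁ ≤ s
    s₁≤s = ≤-trans (≤-trans (m≤n+m s₁ s₀) (n≤1+n _)) S≤s
    -- The largest edge sum that `count` admits; the `2` in the `2 * c` of `few` pays for the two
    -- orientations of each shadow edge.
    E = n * s / c
    counted = count n s s₀≤s n≤4s² E (≤-trans (≤-reflexive (*-comm c E)) (m/n*n≤m (n * s) c))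
    b = proj₁ counted
    ns≤m : n * s ≤ m
    ns≤m = square-cancel-≤ (begin
      n * s * (n * s)     ≡⟨ id₁ n s ⟩
      n * n * (s * s)     ≤⟨ *-monoʳ-≤ (n * n) s²≤n ⟩
      n * n * n           ≡⟨ id₂ n ⟩
      n * (n * (n * 1))   ≤⟨ n³≤m² ⟩
      m * m ∎)
      where
      id₁ : ∀ n s → n * s * (n * s) ≡ n * n * (s * s)
      id₁ = solve-∀
      id₂ : ∀ n → n * n * n ≡ n * (n * (n * 1))
      id₂ = solve-∀
    few-edges : ∀ {H} → Good r H → ∀ i j → edge-sum (Shadows.shadow H i j) ≤ E
    few-edges {H} good i j with i ≟ j
    ... | yes refl = ≤-trans (≤-reflexive (GoodHypergraph.shadow-diagonal {r = r} H good i)) z≤n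
    ... | no i≢j with third-index r 3≤r i j
    ...   | k , k<r , i≢k , j≢k = ≤-pred (*-cancelʳ-< c edges (suc E) (≤-<-trans (begin
        edges * c         ≡⟨ *-comm edges c ⟩
        c * edges         ≤⟨ *-monoʳ-≤ c (G.shadow-edges i≢j j≢k i≢k k<r girth) ⟩
        c * (2 * total)   ≡⟨ id c total ⟩
        2 * c * total     ≤⟨ few n s s₁≤s s²≤n n≤4s² (Shadows.triple H i j k) girth ⟩
        n * s ∎) (m<[1+m/n]*n (n * s) c)))
      where
      module G = GoodHypergraph H good
      edges = edge-sum (Shadows.shadow H i j)
      girth = G.triples-Girth6 i≢j j≢k i≢k
      total = Triples.total (Shadows.triple H i j k) girth
      id : ∀ c t → c * (2 * t) ≡ 2 * c * t
      id = solve-∀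
    Coded : Vec (Graph n) (r * r) → Set
    Coded v = ∀ p → C4Free (lookup v p) × edge-sum (lookup v p) ≤ E
    coded : ∀ {H} → Good r H → Coded (code r H)
    coded {H} good p = subst (λ G → C4Free G × edge-sum G ≤ E) (sym (Vec.lookup∘tabulate _ p))
      (GoodHypergraph.shadow-C4Free {r = r} H good _ _ , few-edges {H} good _ _)
    unique : ∀ L → AllPairs Differ L → All (Good r) L → Unique (map (code r) L)
    unique []      []       []       = []
    unique (H ∷ L) (d ∷ ds) (g ∷ gs) = distinct L d gs ∷ unique L ds gs
      where
      distinct : ∀ L → All (Differ H) L → All (Good r) L → All (code r H ≢_) (map (code r) L)
      distinct []       []       []        = []
      distinct (H' ∷ L) (d ∷ ds) (g' ∷ gs) = code-injective 3≤r g g' d ∷ distinct L ds gs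
    length≤ : length L ≤ b ^ (r * r)
    length≤ = subst (_≤ b ^ (r * r)) (length-map (code r) L)
      (Bound-Vec (r * r) (Vec.≡-dec (Vec.≡-dec Bool._≟_)) (proj₁ (proj₂ counted)) (map (code r) L) (unique L differ good)
        (All.map⁺ (All.map (λ {H} g → coded {H} g) good)))

-- `m` stands for any integer at least `n^{3/2}`; the arbitrary fixed `k` turns the bound into
-- `2^{m / k}`, which expresses the little-o without real exponents.
theorem1p12 : (r : ℕ) → 3 ≤ r → (k : ℕ) → 1 ≤ k →
    ∃ λ N → (n : ℕ) → N ≤ n → (m : ℕ) → n ^ 3 ≤ m * m →
    (L : List (Hypergraph n)) → AllPairs Differ L → All (Good r) L →
    length L ^ k ≤ 2 ^ m
theorem1p12 r 3≤r k 1≤k = suc (s₀ + s₁) * suc (s₀ + s₁) ,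
  bound r 3≤r k (proj₁ graphs) s₀ s₁ 1≤c (proj₂ (proj₂ (proj₂ graphs))) (proj₂ hyperedges)
  where
  1≤r : 1 ≤ r
  1≤r = ≤-trans (s≤s z≤n) 3≤r
  graphs = c4-free-count (r * r * k) (*-mono-≤ (*-mono-≤ 1≤r 1≤r) 1≤k)
  1≤c : 1 ≤ proj₁ graphs
  1≤c = proj₁ (proj₂ (proj₂ graphs))
  hyperedges = triples-few (2 * proj₁ graphs) (*-mono-≤ {1} {2} (s≤s z≤n) 1≤c)
  s₀ s₁ : ℕ
  s₀ = proj₁ (proj₂ graphs)
  s₁ = proj₁ hyperedges
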